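{- Let $n\ge 5$ and let $\Delta_n$ be a permissible uniform flag complex on the vertex set $V_n$. Then $\Delta_n$ represents a triangulation of the boundary $\partial P_n$ of the root polytope if and only if $\Delta_n$ satisfies exactly one of the following three conditions: (1) pairs of arrows of type $THTH$ and of type $HTHT$ both do not nest, and pairs of type $HTTH$ and of type $THHT$ both do not cross; (2) pairs of type $THTH$ and of type $HTHT$ both nest, and pairs of type $HTTH$ and of type $THHT$ both cross; (3) exactly one of the types $THTH$, $HTHT$ nests; and furthermore, if pairs of both types $THHT$ and $HTTH$ cross, then pairs of both types $TTHH$ and $HHTT$ nest.
   Context: Let $e_1,\dots,e_{n+1}$ be the standard basis of $\mathbb{R}^{n+1}$. The root polytope $P_n$ is the convex hull of the points $e_j-e_i$ for $i\ne j$ in $\{1,\dots,n+1\}$. An arrow is an ordered pair $(i,j)$ with $i\neq j$ in $\{1,\dots,n+1\}$, identified with the vertex $e_j-e_i$ of $P_n$; $i$ is its tail and $j$ its head. $V_n$ denotes the set of all arrows. A simplicial complex on $V_n$ represents a triangulation of $\partial P_n$ if, identifying arrows with vertices, the convex hulls of its faces form a triangulation of $\partial P_n$ (using no new vertices). A set of arrows is admissible if it is contained in $I\times J$ for some disjoint $I,J\subseteq\{1,\dots,n+1\}$. A simplicial complex $\Delta_n$ on $V_n$ is permissible if: (i) every face is admissible; (ii) for every face, the underlying undirected graph of its arrows is a forest; (iii) for every three distinct $i,j,k$ the sets $\{(i,j),(i,k)\}$ and $\{(j,i),(k,i)\}$ are edges of $\Delta_n$; for any two disjoint pairs $\{i_1,i_2\}$,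 $\{j_1,j_2\}$ exactly one of $\{(i_1,j_1),(i_2,j_2)\}$ and $\{(i_1,j_2),(i_2,j_1)\}$ is an edge; and the $2$-skeleton of $\Delta_n$ is flag. A flag complex on $V_n$ is a uniform flag complex if whether a pair $\{(i_1,j_1),(i_2,j_2)\}$ is an edge depends only on the equalities and inequalities among $i_1,i_2,j_1,j_2$. For two arrows with four distinct endpoints $p_1<p_2<p_3<p_4$, their type is the word of length 4 obtained by writing, for $p_1,\dots,p_4$ in order, $T$ if the node is a tail and $H$ if it is a head. The pair nests if its arrows join $\{p_1,p_4\}$ and $\{p_2,p_3\}$, and crosses if they join $\{p_1,p_3\}$ and $\{p_2,p_4\}$. "Pairs of type $W$ nest" means that every nesting pair of arrows of type $W$ is an edge of the complex; "do not nest" means no nesting pair of type $W$ is an edge; "cross" and "do not cross" are defined analogously with crossing pairs. (By uniformity these hold for all or for no quadruples of a given type.)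
   Formalization: The root polytope, its boundary, the convex hulls of faces and affine independence are taken over the rational numbers instead of the reals: points, convex coefficients and supporting functionals are rational. -}

module Defs where

open import Data.Nat using (ℕ; suc)
open import Data.Fin using (Fin; _<_; _≟_)
open import Data.Fin.Subset using (Subset; _∈_; Empty; _∩_)
open import Data.Rational using (ℚ; 0ℚ; 1ℚ; _+_; _*_; -_; _≤_)
  renaming (_<_ to _<ℚ_)
open import Data.List using (List; []; _∷_; map; foldr; length; allFin)
open import Data.List.Relation.Unary.All using (All)
open import Data.List.Relation.Unary.Unique.Propositional using (Unique)
import Data.List.Membership.Propositional as Mem
open import Data.List.Relation.Binary.Subset.Propositional using (_⊆_)
open import Data.Vec using (Vec; lookup)
open import Data.Product using (Σ; _×_; _,_; ∃; ∃-syntax)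
open import Data.Sum using (_⊎_)
open import Data.Bool using (if_then_else_)
open import Relation.Nullary using (¬_; does)
open import Relation.Binary.PropositionalEquality using (_≡_; _≢_)
open import Function.Bundles using (_⇔_)

-- Nodes and arrows.  The nodes {1,…,n+1} are represented by Fin (suc n)
-- (with the same order).  An arrow (i , j), i ≠ j, has tail i and head j.

Node : ℕ → Set
Node n = Fin (suc n)

record Arrow (n : ℕ) : Set where
  constructor arr
  field
    tail : Node n
    head : Node n
    .distinct : tail ≢ head
open Arrow public

-- Simplicial complexes on V_n.  A (finite) set of arrows is given by a
-- list (order / repetitions irrelevant: faces are closed under ⊆, which
-- is membership inclusion).

record SimplicialComplex (n : ℕ) : Set₁ where
  field
    Face      : List (Arrow n) → Set
    down-closed : ∀ {F G} → G ⊆ F → Face F → Face G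
open SimplicialComplex public

Edge : ∀ {n} → SimplicialComplex n → Arrow n → Arrow n → Set
Edge Δ a b = Face Δ (a ∷ b ∷ [])

IsFlag : ∀ {n} → SimplicialComplex n → Set
IsFlag Δ = ∀ F → (∀ {a b} → a Mem.∈ F → b Mem.∈ F → a ≢ b → Edge Δ a b) → Face Δ F

TwoSkeletonFlag : ∀ {n} → SimplicialComplex n → Set
TwoSkeletonFlag Δ = ∀ a b c → Edge Δ a b → Edge Δ a c → Edge Δ b c → Face Δ (a ∷ b ∷ c ∷ [])

quad : ∀ {n} → Arrow n → Arrow n → Fin 4 → Node n
quad a b Fin.zero = tail a
quad a b (Fin.suc Fin.zero) = tail b
quad a b (Fin.suc (Fin.suc Fin.zero)) = head a
quad a b (Fin.suc (Fin.suc (Fin.suc _))) = head b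

SameOrderType : ∀ {n} → (Fin 4 → Node n) → (Fin 4 → Node n) → Set
SameOrderType x y = ∀ k l → ((x k ≡ x l) ⇔ (y k ≡ y l)) × ((x k < x l) ⇔ (y k < y l))

IsUniform : ∀ {n} → SimplicialComplex n → Set
IsUniform Δ = ∀ a b a' b' → SameOrderType (quad a b) (quad a' b') → Edge Δ a b ⇔ Edge Δ a' b'

IsUniformFlag : ∀ {n} → SimplicialComplex n → Set
IsUniformFlag Δ = IsFlag Δ × IsUniform Δ

Admissible : ∀ {n} → List (Arrow n) → Set
Admissible {n} F = ∃[ I ] ∃[ J ] (Empty (I ∩ J) × All (λ a → tail a ∈ I × head a ∈ J) F)

Adj : ∀ {n} → List (Arrow n) → Node n → Node n → Set
Adj F u v = ∃[ a ] (a Mem.∈ F × ((tail a ≡ u × head a ≡ v) ⊎ (tail a ≡ v × head a ≡ u)))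

lastOr : ∀ {A : Set} → A → List A → A
lastOr d [] = d
lastOr d (x ∷ xs) = lastOr x xs

ConsecAdj : ∀ {n} → List (Arrow n) → List (Node n) → Set
ConsecAdj F [] = Data.Unit.⊤ where import Data.Unit
ConsecAdj F (x ∷ []) = Data.Unit.⊤ where import Data.Unit
ConsecAdj F (x ∷ y ∷ xs) = Adj F x y × ConsecAdj F (y ∷ xs)

IsCycle : ∀ {n} → List (Arrow n) → List (Node n) → Set
IsCycle F [] = Data.Empty.⊥ where import Data.Empty
IsCycle F (v ∷ vs) =
  Unique (v ∷ vs) × 3 Data.Nat.≤ length (v ∷ vs) × ConsecAdj F (v ∷ vs) × Adj F (lastOr v vs) v
  where import Data.Nat

IsForest : ∀ {n} → List (Arrow n) → Set
IsForest F = ∀ vs → ¬ IsCycle F vs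

ExactlyOne : Set → Set → Set
ExactlyOne A B = (A × ¬ B) ⊎ (¬ A × B)

IsPermissible : ∀ {n} → SimplicialComplex n → Set
IsPermissible {n} Δ =
    (∀ F → Face Δ F → Admissible F)
  × (∀ F → Face Δ F → IsForest F)
  × (∀ (i j k : Node n) (ij : i ≢ j) (ik : i ≢ k) (jk : j ≢ k) →
        Edge Δ (arr i j ij) (arr i k ik)
      × Edge Δ (arr j i (λ e → ij (Relation.Binary.PropositionalEquality.sym e)))
               (arr k i (λ e → ik (Relation.Binary.PropositionalEquality.sym e))))
  × (∀ (i₁ i₂ j₁ j₂ : Node n) → i₁ ≢ i₂ → j₁ ≢ j₂ →
       (d11 : i₁ ≢ j₁) (d12 : i₁ ≢ j₂) (d21 : i₂ ≢ j₁) (d22 : i₂ ≢ j₂) →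
       ExactlyOne (Edge Δ (arr i₁ j₁ d11) (arr i₂ j₂ d22))
                  (Edge Δ (arr i₁ j₂ d12) (arr i₂ j₁ d21)))
  × TwoSkeletonFlag Δ

data Label : Set where
  T H : Label

Word : Set
Word = Vec Label 4

FourDistinct : ∀ {n} → Arrow n → Arrow n → Set
FourDistinct a b = ∀ k l → k ≢ l → quad a b k ≢ quad a b l

Endpoint : ∀ {n} → Arrow n → Arrow n → Node n → Set
Endpoint a b x = ∃[ k ] quad a b k ≡ x

IsEnumeration : ∀ {n} → Arrow n → Arrow n → (Fin 4 → Node n) → Set
IsEnumeration a b p =
  FourDistinct a b
  × p (# 0) < p (# 1) × p (# 1) < p (# 2) × p (# 2) < p (# 3)
  × (∀ k → Endpoint a b (p k))
  where open import Data.Fin using (#_)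

HasLabel : ∀ {n} → Arrow n → Arrow n → Node n → Label → Set
HasLabel a b x T = (x ≡ tail a) ⊎ (x ≡ tail b)
HasLabel a b x H = (x ≡ head a) ⊎ (x ≡ head b)

HasType : ∀ {n} → Arrow n → Arrow n → (Fin 4 → Node n) → Word → Set
HasType a b p W = ∀ k → HasLabel a b (p k) (lookup W k)

Joins : ∀ {n} → Arrow n → Node n → Node n → Set
Joins a x y = (tail a ≡ x × head a ≡ y) ⊎ (tail a ≡ y × head a ≡ x)

module _ {n : ℕ} where
  open import Data.Fin using (#_)

  Nests : Arrow n → Arrow n → (Fin 4 → Node n) → Set
  Nests a b p = (Joins a (p (# 0)) (p (# 3)) × Joins b (p (# 1)) (p (# 2)))
              ⊎ (Joins a (p (# 1)) (p (# 2)) × Joins b (p (# 0)) (p (# 3)))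

  Crosses : Arrow n → Arrow n → (Fin 4 → Node n) → Set
  Crosses a b p = (Joins a (p (# 0)) (p (# 2)) × Joins b (p (# 1)) (p (# 3)))
                ⊎ (Joins a (p (# 1)) (p (# 3)) × Joins b (p (# 0)) (p (# 2)))

  PairsNest : SimplicialComplex n → Word → Set
  PairsNest Δ W = ∀ a b p → IsEnumeration a b p → HasType a b p W → Nests a b p → Edge Δ a b

  PairsDoNotNest : SimplicialComplex n → Word → Set
  PairsDoNotNest Δ W = ∀ a b p → IsEnumeration a b p → HasType a b p W → Nests a b p → ¬ Edge Δ a b

  PairsCross : SimplicialComplex n → Word → Set
  PairsCross Δ W = ∀ a b p → IsEnumeration a b p → HasType a b p W → Crosses a b p → Edge Δ a b

  PairsDoNotCross : SimplicialComplex n → Word → Set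
  PairsDoNotCross Δ W = ∀ a b p → IsEnumeration a b p → HasType a b p W → Crosses a b p → ¬ Edge Δ a b

THTH HTHT HTTH THHT TTHH HHTT : Word
THTH = T ∷ H ∷ T ∷ H ∷ []  where open Data.Vec using (_∷_; [])
HTHT = H ∷ T ∷ H ∷ T ∷ []  where open Data.Vec using (_∷_; [])
HTTH = H ∷ T ∷ T ∷ H ∷ []  where open Data.Vec using (_∷_; [])
THHT = T ∷ H ∷ H ∷ T ∷ []  where open Data.Vec using (_∷_; [])
TTHH = T ∷ T ∷ H ∷ H ∷ []  where open Data.Vec using (_∷_; [])
HHTT = H ∷ H ∷ T ∷ T ∷ []  where open Data.Vec using (_∷_; [])

module _ {n : ℕ} (Δ : SimplicialComplex n) where
  Condition1 : Set
  Condition1 = PairsDoNotNest Δ THTH × PairsDoNotNest Δ HTHT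
             × PairsDoNotCross Δ HTTH × PairsDoNotCross Δ THHT

  Condition2 : Set
  Condition2 = PairsNest Δ THTH × PairsNest Δ HTHT
             × PairsCross Δ HTTH × PairsCross Δ THHT

  Condition3 : Set
  Condition3 = ExactlyOne (PairsNest Δ THTH) (PairsNest Δ HTHT)
             × ((PairsCross Δ THHT × PairsCross Δ HTTH) → (PairsNest Δ TTHH × PairsNest Δ HHTT))

ExactlyOne3 : Set → Set → Set → Set
ExactlyOne3 A B C = (A × ¬ B × ¬ C) ⊎ (¬ A × B × ¬ C) ⊎ (¬ A × ¬ B × C)

-- Geometry (over ℚ; all vertices have integer coordinates)

Point : ℕ → Set
Point n = Node n → ℚ

vert : ∀ {n} → Arrow n → Point n
vert a k = if does (k ≟ head a) then 1ℚ else (if does (k ≟ tail a) then - 1ℚ else 0ℚ)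

sumℚ : List ℚ → ℚ
sumℚ = foldr _+_ 0ℚ

lincomb : ∀ {n} → List ℚ → List (Point n) → Point n
lincomb (w ∷ ws) (v ∷ vs) k = w * v k + lincomb ws vs k
lincomb _ _ k = 0ℚ

dot : ∀ {n} → Point n → Point n → ℚ
dot {n} c x = foldr (λ k acc → c k * x k + acc) 0ℚ (allFin (suc n))

InConv : ∀ {n} → List (Point n) → Point n → Set
InConv vs x = Σ (List ℚ) λ ws →
  length ws ≡ length vs × All (0ℚ ≤_) ws × sumℚ ws ≡ 1ℚ × (∀ k → x k ≡ lincomb ws vs k)

InP : ∀ {n} → Point n → Set
InP {n} x = ∃[ As ] InConv (map (vert {n}) As) x

-- x lies in the boundary of P_n: on a proper face, i.e. x ∈ P_n and some
-- linear functional attains its maximum over P_n at x and is not constant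
-- on P_n
InBoundary : ∀ {n} → Point n → Set
InBoundary {n} x = InP x × ∃[ c ]
  ((∀ (a : Arrow n) → dot c (vert a) ≤ dot c x) × ∃[ a ] (dot c (vert a) <ℚ dot c x))

AffIndep : ∀ {n} → List (Point n) → Set
AffIndep vs = ∀ ws → length ws ≡ length vs → sumℚ ws ≡ 0ℚ →
  (∀ k → lincomb ws vs k ≡ 0ℚ) → All (_≡ 0ℚ) ws

hull : ∀ {n} → List (Arrow n) → Point n → Set
hull F = InConv (map vert F)

RepresentsTriangulation : ∀ {n} → SimplicialComplex n → Set
RepresentsTriangulation {n} Δ =
    (∀ F → Face Δ F → Unique F → AffIndep (map vert F))
  × (∀ F G → Face Δ F → Face Δ G → ∀ x → hull F x → hull G x →
        ∃[ K ] (K ⊆ F × K ⊆ G × hull K x))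
  × (∀ F → Face Δ F → ∀ x → hull F x → InBoundary x)
  × (∀ x → InBoundary {n} x → ∃[ F ] (Face Δ F × hull F x))

{-# OPTIONS --safe #-}
-- Idea.  For sorted tails t < t′ and heads h < h′ exactly one of the straight pair (t , h), (t′ , h′)
-- and the twisted pair (t , h′), (t′ , h) is an edge, and by uniformity the choice is a bit that depends
-- only on the type of the four nodes.  So Δ is given by six bits, and (1), (2), (3) become a condition
-- ("valid") on them.
--
-- If the bits are valid: after clearing denominators, a boundary point is the barycentre of a multiset
-- of arrows, whose tails and heads are determined by the point.  Replacing incompatible pairs by the
-- other matching on the same four nodes terminates, because in every valid case a lexicographic cost
-- decreases, and it is confluent, because no two faces are complementary matchings of a hexagon (a
-- finite check on six positions).  The normal forms are the faces; their existence shows that the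
-- faces cover the boundary, and their uniqueness that faces intersect in faces and are simplices.
--
-- If the bits are not valid, either two tails and three heads (or two heads and three tails) have
-- cyclically oriented edges, and a point with these ends lies in no face, or some hexagon is a face,
-- which is not a forest.
module Submission where

open import Defs
open import Data.Nat using (ℕ; _≤_)
open import Function.Bundles using (_⇔_)

-- Alternation is what lets a point remember its ends. A coordinate only counts heads minus tails at
-- a node; if no node is both a tail and a head, one of the two counts vanishes and the difference
-- gives both. Triangulating the boundary thus becomes a question about matchings between two given
-- multisets. The two branches of `valid` meet two different obstructions. If the bits of THTH and
-- HTHT agree, THHT and HTTH must share their value: then the total length of the right-pointing
-- arrows orders all four types at once, while a deviating bit produces the cyclic choice on five
-- nodes whose roles alternate. If the bits of THTH and HTHT differ, the danger is a hexagon, and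
-- the implication from THHT and HTTH to TTHH and HHTT excludes it; the converse exhibits a hexagon
-- on six nodes with alternating roles, available since n ≥ 5.

module Swaps where

  open import Data.Nat.Properties using (suc-injective)
  open import Data.List using (List; []; _∷_; map; _++_; length; zip)
  open import Data.List.Properties using (length-map; ++-identityʳ)
  open import Data.List.Membership.Propositional using (_∈_; find)
  open import Data.List.Membership.Propositional.Properties using (∈-∃++)
  open import Data.List.Relation.Unary.Any using (here; there)
  open import Data.List.Relation.Unary.All as All using (All; []; _∷_; all?)
  open import Data.List.Relation.Unary.All.Properties using (¬All⇒Any¬)
  open import Data.List.Relation.Binary.Permutation.Propositional
    using (_↭_; refl; prep; swap; trans; ↭-sym; ↭-reflexive)
  open import Data.List.Relation.Binary.Permutation.Propositional.Properties
    using (drop-∷; shift; shifts; ∈-resp-↭; map⁺; ↭-map-inv; ++⁺ʳ; ↭-length; ↭-singleton-inv;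
      ¬x∷xs↭[])
  open import Data.Product using (_×_; _,_; proj₁; proj₂; ∃; ∃-syntax)
  open import Data.Sum using (_⊎_; inj₁; inj₂)
  open import Data.Empty using (⊥-elim)
  open import Function using (_∘_)
  open import Induction.WellFounded using (Acc; acc; WellFounded)
  open import Relation.Nullary using (¬_; yes; no; contradiction)
  open import Relation.Binary.Definitions using (Decidable; DecidableEquality)
  open import Relation.Binary.PropositionalEquality
    using (_≡_; _≢_; refl; sym; cong)
    renaming (trans to ≡-trans)

  -- Permutations of lists of two and three elements.

  ∈⇒↭∷ : ∀ {X : Set} {x : X} {l} → x ∈ l → ∃[ r ] l ↭ x ∷ r
  ∈⇒↭∷ {x = x} x∈l with ys , zs , refl ← ∈-∃++ x∈l = ys ++ zs , shift x ys zs

  ∈-∷⁻ : ∀ {X : Set} {x y : X} {l} → x ∈ y ∷ l → x ≡ y ⊎ x ∈ l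
  ∈-∷⁻ (here eq) = inj₁ eq
  ∈-∷⁻ (there p) = inj₂ p

  ↭-swap₂ : ∀ {X : Set} {x y : X} {l} → x ∷ y ∷ l ↭ y ∷ x ∷ l
  ↭-swap₂ = swap _ _ refl

  module _ {X : Set} {x y z : X} where

    p132 : x ∷ y ∷ z ∷ [] ↭ x ∷ z ∷ y ∷ []
    p132 = prep x ↭-swap₂

    p231 : x ∷ y ∷ z ∷ [] ↭ y ∷ z ∷ x ∷ []
    p231 = trans ↭-swap₂ (prep y ↭-swap₂)

    p312 : x ∷ y ∷ z ∷ [] ↭ z ∷ x ∷ y ∷ []
    p312 = trans (prep x ↭-swap₂) ↭-swap₂

    p321 : x ∷ y ∷ z ∷ [] ↭ z ∷ y ∷ x ∷ []
    p321 = trans p312 (prep z ↭-swap₂)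

  -- Matching on this view also fixes the list, so the six orders of three heads can be treated one
  -- by one.
  data Perm₃ {X : Set} (x y z : X) : List X → Set where
    q123 : Perm₃ x y z (x ∷ y ∷ z ∷ [])
    q132 : Perm₃ x y z (x ∷ z ∷ y ∷ [])
    q213 : Perm₃ x y z (y ∷ x ∷ z ∷ [])
    q231 : Perm₃ x y z (y ∷ z ∷ x ∷ [])
    q312 : Perm₃ x y z (z ∷ x ∷ y ∷ [])
    q321 : Perm₃ x y z (z ∷ y ∷ x ∷ [])

  ↭-pair-inv : ∀ {X : Set} {x y : X} {l} → x ∷ y ∷ [] ↭ l → l ≡ x ∷ y ∷ [] ⊎ l ≡ y ∷ x ∷ []
  ↭-pair-inv {l = []} p = contradiction p ¬x∷xs↭[]
  ↭-pair-inv {l = u ∷ l} p with ∈-resp-↭ (↭-sym p) (here refl)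
  ... | here refl = inj₁ (cong (u ∷_) (↭-singleton-inv (↭-sym (drop-∷ p))))
  ... | there (here refl) =
    inj₂ (cong (u ∷_) (↭-singleton-inv (↭-sym (drop-∷ (trans ↭-swap₂ p)))))

  ↭⇒Perm₃ : ∀ {X : Set} {x y z : X} {l} → x ∷ y ∷ z ∷ [] ↭ l → Perm₃ x y z l
  ↭⇒Perm₃ {l = []} p = contradiction p ¬x∷xs↭[]
  ↭⇒Perm₃ {l = u ∷ l} p with ∈-resp-↭ (↭-sym p) (here refl)
  ↭⇒Perm₃ {l = u ∷ l} p | here refl with ↭-pair-inv (drop-∷ p)
  ... | inj₁ refl = q123
  ... | inj₂ refl = q132
  ↭⇒Perm₃ {l = u ∷ l} p | there (here refl) with ↭-pair-inv (drop-∷ (trans ↭-swap₂ p))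
  ... | inj₁ refl = q213
  ... | inj₂ refl = q231
  ↭⇒Perm₃ {l = u ∷ l} p | there (there (here refl)) with ↭-pair-inv (drop-∷ (trans p231 p))
  ... | inj₁ refl = q312
  ... | inj₂ refl = q321

  -- Matchings of tails with heads, and rules that choose between two matchings.

  cross : ∀ {A B : Set} → A × B → A × B → A × B
  cross a b = proj₁ a , proj₂ b

  tails : ∀ {A B : Set} → List (A × B) → List A
  tails = map proj₁

  heads : ∀ {A B : Set} → List (A × B) → List B
  heads = map proj₂

  -- For two tails and two heads, `ok-total` and `ok-excl` allow exactly one of the two matchings,
  -- unless a shared node makes them the same; `no-hexagon` is the compatibility condition on three
  -- arrows.
  record SwapSystem (A B : Set) : Set₁ where
    field
      _≟ᴬ_ : DecidableEquality A
      _≟ᴮ_ : DecidableEquality B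
      Ok : A × B → A × B → Set
      ok? : Decidable Ok
      ok-sym : ∀ {a b} → Ok a b → Ok b a
      ok-tail : ∀ {t h h′} → Ok (t , h) (t , h′)
      ok-head : ∀ {t t′ h} → Ok (t , h) (t′ , h)
      ok-total : ∀ a b → Ok a b ⊎ Ok (cross a b) (cross b a)
      ok-excl : ∀ {t h t′ h′} → Ok (t , h) (t′ , h′) → Ok (t , h′) (t′ , h) → t ≡ t′ ⊎ h ≡ h′
      no-hexagon : ∀ {t₁ t₂ t₃ h₁ h₂ h₃} →
        t₁ ≢ t₂ → t₁ ≢ t₃ → t₂ ≢ t₃ → h₁ ≢ h₂ → h₁ ≢ h₃ → h₂ ≢ h₃ →
        Ok (t₁ , h₁) (t₂ , h₂) → Ok (t₁ , h₁) (t₃ , h₃) → Ok (t₂ , h₂) (t₃ , h₃) →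
        Ok (t₁ , h₂) (t₂ , h₃) → Ok (t₁ , h₂) (t₃ , h₁) → ¬ Ok (t₂ , h₃) (t₃ , h₁)
      _≺_ : List (A × B) → List (A × B) → Set
      ≺-wellFounded : WellFounded _≺_
      ≺-swap : ∀ {l l′ a b r} → l ↭ a ∷ b ∷ r → ¬ Ok a b → l′ ↭ cross a b ∷ cross b a ∷ r → l′ ≺ l

  -- Cliques are the normal forms of the rewriting system that replaces an incompatible pair by
  -- its cross pair.  Critical pairs involve three arrows only, so by Newman's lemma normal forms
  -- are unique as soon as they are unique for three arrows.
  module Rewriting {A B : Set} (S : SwapSystem A B) where
    open SwapSystem S

    Flow : Set
    Flow = List (A × B)

    Clique : Flow → Set
    Clique l = ∀ {a b} → a ∈ l → b ∈ l → Ok a b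

    Step : Flow → Flow → Set
    Step l l′ = ∃[ a ] ∃[ b ] ∃[ r ] (l ↭ a ∷ b ∷ r × ¬ Ok a b × l′ ↭ cross a b ∷ cross b a ∷ r)

    data _⟶*_ : Flow → Flow → Set where
      done : ∀ {l m} → l ↭ m → l ⟶* m
      step : ∀ {l l′ m} → Step l l′ → l′ ⟶* m → l ⟶* m

    Step⇒≺ : ∀ {l l′} → Step l l′ → l′ ≺ l
    Step⇒≺ (a , b , r , p , ¬ok , q) = ≺-swap p ¬ok q

    ok-refl : ∀ {a} → Ok a a
    ok-refl = ok-tail

    Clique-resp-↭ : ∀ {l m} → l ↭ m → Clique l → Clique m
    Clique-resp-↭ p c a∈m b∈m = c (∈-resp-↭ (↭-sym p) a∈m) (∈-resp-↭ (↭-sym p) b∈m)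

    Step-respˡ : ∀ {k l l′} → k ↭ l → Step l l′ → Step k l′
    Step-respˡ p (a , b , r , q , ¬ok , q′) = a , b , r , trans p q , ¬ok , q′

    ⟶*-respˡ : ∀ {k l m} → k ↭ l → l ⟶* m → k ⟶* m
    ⟶*-respˡ p (done q) = done (trans p q)
    ⟶*-respˡ p (step s r) = step (Step-respˡ p s) r

    ⟶*-trans : ∀ {k l m} → k ⟶* l → l ⟶* m → k ⟶* m
    ⟶*-trans (done p) r = ⟶*-respˡ p r
    ⟶*-trans (step s q) r = step s (⟶*-trans q r)

    ⟶*-++ : ∀ {l m} u → l ⟶* m → (l ++ u) ⟶* (m ++ u)
    ⟶*-++ u (done p) = done (++⁺ʳ u p)
    ⟶*-++ u (step (a , b , r , p , ¬ok , q) rest) =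
      step (a , b , r ++ u , ++⁺ʳ u p , ¬ok , ++⁺ʳ u q) (⟶*-++ u rest)

    clique-or-step : ∀ l → Clique l ⊎ ∃ (Step l)
    clique-or-step l with all? (λ a → all? (ok? a) l) l
    ... | yes c = inj₁ (λ a∈l b∈l → All.lookup (All.lookup c a∈l) b∈l)
    ... | no ¬c
      with a , a∈l , ¬ca ← find (¬All⇒Any¬ (λ a → all? (ok? a) l) l ¬c)
      with b , b∈l , ¬ok ← find (¬All⇒Any¬ (ok? a) l ¬ca)
      with r , p ← ∈⇒↭∷ a∈l
      with ∈-∷⁻ (∈-resp-↭ p b∈l)
    ... | inj₁ refl = contradiction ok-refl ¬ok
    ... | inj₂ b∈r with r′ , q ← ∈⇒↭∷ b∈r =
      inj₂ (_ , a , b , r′ , trans p (prep a q) , ¬ok , refl)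

    tails-step : ∀ {l l′} → Step l l′ → tails l ↭ tails l′
    tails-step (a , b , r , p , _ , q) = trans (map⁺ proj₁ p) (map⁺ proj₁ (↭-sym q))

    heads-step : ∀ {l l′} → Step l l′ → heads l ↭ heads l′
    heads-step (a , b , r , p , _ , q) =
      trans (map⁺ proj₂ p) (trans ↭-swap₂ (map⁺ proj₂ (↭-sym q)))

    SameEnds : Flow → Flow → Set
    SameEnds l m = tails l ↭ tails m × heads l ↭ heads m

    SameEnds-sym : ∀ {l m} → SameEnds l m → SameEnds m l
    SameEnds-sym (p , q) = ↭-sym p , ↭-sym q

    SameEnds-trans : ∀ {k l m} → SameEnds k l → SameEnds l m → SameEnds k m
    SameEnds-trans (p , q) (p′ , q′) = trans p p′ , trans q q′

    ⟶*-ends : ∀ {l m} → l ⟶* m → SameEnds l m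
    ⟶*-ends (done p) = map⁺ proj₁ p , map⁺ proj₂ p
    ⟶*-ends (step s r) = SameEnds-trans (tails-step s , heads-step s) (⟶*-ends r)

    normalise : ∀ l → ∃[ m ] (Clique m × l ⟶* m)
    normalise l = go l (≺-wellFounded l)
      where
      go : ∀ l → Acc _≺_ l → ∃[ m ] (Clique m × l ⟶* m)
      go l (acc rs) with clique-or-step l
      ... | inj₁ c = l , c , done refl
      ... | inj₂ (l′ , s) with m , c , r ← go l′ (rs (Step⇒≺ s)) = m , c , step s r

    clique-no-step : ∀ {l l′} → Clique l → ¬ Step l l′
    clique-no-step c (a , b , r , p , ¬ok , _) =
      ¬ok (Clique-resp-↭ p c (here refl) (there (here refl)))

    -- Both matchings on the same ends are allowed only if a tail or a head is shared, and then they
    -- consist of the same two arrows.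
    exchange : ∀ {t h t′ h′} → Ok (t , h) (t′ , h′) → Ok (t , h′) (t′ , h) →
               ∀ {r} → (t , h) ∷ (t′ , h′) ∷ r ↭ (t , h′) ∷ (t′ , h) ∷ r
    exchange p q with ok-excl p q
    ... | inj₁ refl = ↭-swap₂
    ... | inj₂ refl = refl

    exchange-clique : ∀ {X Y t h t′ h′ r} → Clique X → Clique Y →
      X ↭ (t , h) ∷ (t′ , h′) ∷ r → Y ↭ (t , h′) ∷ (t′ , h) ∷ r → X ↭ Y
    exchange-clique c d p q =
      trans p (trans (exchange (Clique-resp-↭ p c (here refl) (there (here refl)))
                               (Clique-resp-↭ q d (here refl) (there (here refl))))
                     (↭-sym q))

    -- If two tails or two heads coincide, the 3-cycle of the heads amounts to a transposition and
    -- one exchange suffices. With three distinct tails and three distinct heads, X and Y would be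
    -- complementary matchings of a hexagon.
    rotation : ∀ {t₁ t₂ t₃ h₁ h₂ h₃} →
      let X = (t₁ , h₁) ∷ (t₂ , h₂) ∷ (t₃ , h₃) ∷ []
          Y = (t₁ , h₂) ∷ (t₂ , h₃) ∷ (t₃ , h₁) ∷ []
      in Clique X → Clique Y → X ↭ Y
    rotation {t₁} {t₂} {t₃} {h₁} {h₂} {h₃} c d
      with t₁ ≟ᴬ t₂ | t₁ ≟ᴬ t₃ | t₂ ≟ᴬ t₃ | h₁ ≟ᴮ h₂ | h₁ ≟ᴮ h₃ | h₂ ≟ᴮ h₃
    ... | yes refl | _ | _ | _ | _ | _ = exchange-clique c d p132 p231
    ... | no _ | yes refl | _ | _ | _ | _ = exchange-clique c d p231 ↭-swap₂
    ... | no _ | no _ | yes refl | _ | _ | _ = exchange-clique c d refl p132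
    ... | no _ | no _ | no _ | yes refl | _ | _ = exchange-clique c d p231 p231
    ... | no _ | no _ | no _ | no _ | yes refl | _ = exchange-clique c d refl refl
    ... | no _ | no _ | no _ | no _ | no _ | yes refl = exchange-clique c d p132 p132
    ... | no n₁ | no n₂ | no n₃ | no n₄ | no n₅ | no n₆ = ⊥-elim
      (no-hexagon n₁ n₂ n₃ n₄ n₅ n₆
        (c e₁ e₂) (c e₁ e₃) (c e₂ e₃) (d e₁ e₂) (d e₁ e₃) (d e₂ e₃))
      where
      e₁ : ∀ {X : Set} {x : X} {l} → x ∈ x ∷ l
      e₁ = here refl
      e₂ : ∀ {X : Set} {x y : X} {l} → y ∈ x ∷ y ∷ l
      e₂ = there (here refl)
      e₃ : ∀ {X : Set} {x y z : X} {l} → z ∈ x ∷ y ∷ z ∷ l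
      e₃ = there (there (here refl))

    -- Over fixed tails the heads are permuted by the identity, a transposition or a 3-cycle.
    unique₃-aligned : ∀ {t₁ t₂ t₃ h₁ h₂ h₃ ks} →
      let X = (t₁ , h₁) ∷ (t₂ , h₂) ∷ (t₃ , h₃) ∷ []
          Y = zip (t₁ ∷ t₂ ∷ t₃ ∷ []) ks
      in Perm₃ h₁ h₂ h₃ ks → Clique X → Clique Y → X ↭ Y
    unique₃-aligned q123 c d = refl
    unique₃-aligned q132 c d = exchange-clique c d p231 p231
    unique₃-aligned q213 c d = exchange-clique c d refl refl
    unique₃-aligned q231 c d = rotation c d
    unique₃-aligned q312 c d = ↭-sym (rotation d c)
    unique₃-aligned q321 c d = exchange-clique c d p132 p132

    zip-ends : ∀ (l : Flow) → zip (tails l) (heads l) ≡ l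
    zip-ends [] = refl
    zip-ends (a ∷ l) = cong (a ∷_) (zip-ends l)

    align : ∀ {l m : Flow} → tails l ↭ tails m →
      ∃[ hs ] (m ↭ zip (tails l) hs × heads m ↭ hs × length hs ≡ length l)
    align {l} {m} p with m′ , eq , q ← ↭-map-inv proj₁ (↭-sym p) =
      heads m′
      , trans q (↭-reflexive (≡-trans (sym (zip-ends m′)) (cong (λ ts → zip ts (heads m′)) (sym eq))))
      , map⁺ proj₂ q
      , ≡-trans (length-map proj₂ m′)
          (≡-trans (sym (length-map proj₁ m′))
                   (≡-trans (cong length (sym eq)) (length-map proj₁ l)))

    unique₃ : ∀ {a b c Y} → let X = a ∷ b ∷ c ∷ [] in
      Clique X → Clique Y → SameEnds X Y → X ↭ Y
    unique₃ {a} {b} {c} {Y} cX cY (p , q)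
      with hs , r , s , _ ← align {a ∷ b ∷ c ∷ []} {Y} p =
      trans (unique₃-aligned (↭⇒Perm₃ (trans q s)) cX (Clique-resp-↭ r cY)) (↭-sym r)

    -- Swaps keep the length; this brings a normal form of three arrows into the shape that
    -- `unique₃` asks for.
    three : ∀ {l : Flow} {a b c : A × B} → (a ∷ b ∷ c ∷ []) ⟶* l →
      ∃[ x ] ∃[ y ] ∃[ z ] l ≡ x ∷ y ∷ z ∷ []
    three {l} s with l | ≡-trans (↭-length (proj₁ (⟶*-ends s))) (length-map proj₁ l)
    ... | x ∷ y ∷ z ∷ [] | _ = x , y , z , refl

    -- Local joinability and confluence.

    Joinable : Flow → Flow → Set
    Joinable l m = ∃[ k ] (l ⟶* k × m ⟶* k)

    Joinable-resp : ∀ {l l′ m m′} → l ↭ l′ → m ↭ m′ → Joinable l′ m′ → Joinable l m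
    Joinable-resp p q (k , r , s) = k , ⟶*-respˡ p r , ⟶*-respˡ q s

    -- The one genuine critical pair: two incompatible pairs with the arrow a in common. Both
    -- results keep the ends of the three arrows, so their normal forms agree by `unique₃`, and u is
    -- carried along.
    join-shared : ∀ {a b c u} → ¬ Ok a b → ¬ Ok a c →
      Joinable (cross a b ∷ cross b a ∷ c ∷ u) (cross a c ∷ cross c a ∷ b ∷ u)
    join-shared {a} {b} {c} {u} ¬ab ¬ac
      with m , cm , r ← normalise (cross a b ∷ cross b a ∷ c ∷ [])
      with n , cn , s ← normalise (cross a c ∷ cross c a ∷ b ∷ [])
      with x , y , z , refl ← three r =
        m ++ u , ⟶*-++ u r
        , ⟶*-trans (⟶*-++ u s) (done (++⁺ʳ u (↭-sym (unique₃ cm cn ends))))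
      where
      ends : SameEnds m n
      ends = SameEnds-trans (SameEnds-sym (⟶*-ends r))
        (SameEnds-trans (p132 , p321) (⟶*-ends s))

    join-common : ∀ {a b r d s} → ¬ Ok a b → ¬ Ok a d → a ∷ b ∷ r ↭ a ∷ d ∷ s →
      Joinable (cross a b ∷ cross b a ∷ r) (cross a d ∷ cross d a ∷ s)
    join-common {a} {b} {r} {d} {s} ¬ab ¬ad p with ∈-∷⁻ (∈-resp-↭ (↭-sym (drop-∷ p)) (here refl))
    ... | inj₁ refl = _ , done refl , done (prep _ (prep _ (↭-sym (drop-∷ (drop-∷ p)))))
    ... | inj₂ d∈r with u , r↭ ← ∈⇒↭∷ d∈r =
      Joinable-resp (prep _ (prep _ r↭))
        (prep _ (prep _ (drop-∷ (trans (↭-sym (drop-∷ p)) (trans (prep b r↭) ↭-swap₂)))))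
        (join-shared ¬ab ¬ad)

    join-disjoint : ∀ {a b c d u} → ¬ Ok a b → ¬ Ok c d →
      Joinable (cross a b ∷ cross b a ∷ c ∷ d ∷ u) (cross c d ∷ cross d c ∷ a ∷ b ∷ u)
    join-disjoint {a} {b} {c} {d} {u} ¬ab ¬cd =
      _ , step (c , d , _ , shifts (_ ∷ _ ∷ []) (c ∷ d ∷ []) , ¬cd , refl) (done refl)
      , step (a , b , _ , shifts (_ ∷ _ ∷ []) (a ∷ b ∷ []) , ¬ab , refl)
             (done (shifts (_ ∷ _ ∷ []) (_ ∷ _ ∷ [])))

    -- The two redexes share both arrows, one arrow or none; symmetry of `Ok` moves a shared arrow
    -- to the front, where `join-common` applies.
    join-pairs : ∀ {a b r c d s} → ¬ Ok a b → ¬ Ok c d → a ∷ b ∷ r ↭ c ∷ d ∷ s →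
      Joinable (cross a b ∷ cross b a ∷ r) (cross c d ∷ cross d c ∷ s)
    join-pairs ¬ab ¬cd p
      with ∈-∷⁻ (∈-resp-↭ (↭-sym p) (here refl)) | ∈-∷⁻ (∈-resp-↭ (↭-sym p) (there (here refl)))
    ... | inj₁ refl | _ = join-common ¬ab ¬cd p
    ... | _ | inj₁ refl =
      Joinable-resp refl ↭-swap₂ (join-common ¬ab (¬cd ∘ ok-sym) (trans p ↭-swap₂))
    ... | inj₂ c∈br | inj₂ d∈br with ∈-∷⁻ c∈br | ∈-∷⁻ d∈br
    ... | inj₁ refl | _ =
      Joinable-resp ↭-swap₂ refl (join-common (¬ab ∘ ok-sym) ¬cd (trans ↭-swap₂ p))
    ... | _ | inj₁ refl =
      Joinable-resp ↭-swap₂ ↭-swap₂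
        (join-common (¬ab ∘ ok-sym) (¬cd ∘ ok-sym) (trans ↭-swap₂ (trans p ↭-swap₂)))
    ... | inj₂ c∈r | inj₂ d∈r with r′ , r↭ ← ∈⇒↭∷ c∈r with ∈-∷⁻ (∈-resp-↭ r↭ d∈r)
    ... | inj₁ refl = contradiction ok-refl ¬cd
    ... | inj₂ d∈r′ with u , r′↭ ← ∈⇒↭∷ d∈r′ =
      Joinable-resp (prep _ (prep _ r↭′))
        (prep _ (prep _ (drop-∷ (drop-∷ (trans (↭-sym p)
          (trans (prep _ (prep _ r↭′)) (shifts (_ ∷ _ ∷ []) (_ ∷ _ ∷ []))))))))
        (join-disjoint ¬ab ¬cd)
      where r↭′ = trans r↭ (prep _ r′↭)

    join-steps : ∀ {l l₁ l₂} → Step l l₁ → Step l l₂ → Joinable l₁ l₂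
    join-steps (a , b , r , p , ¬ab , q) (c , d , s , p′ , ¬cd , q′) =
      Joinable-resp q q′ (join-pairs ¬ab ¬cd (trans (↭-sym p) p′))

    -- Newman's lemma by induction on `_≺_`: a common reduct of the first two steps is normalised to
    -- a clique o, which the induction hypothesis identifies with m and with n.
    confluent : ∀ l {m n} → Clique m → Clique n → l ⟶* m → l ⟶* n → m ↭ n
    confluent l = go l (≺-wellFounded l)
      where
      go : ∀ l → Acc _≺_ l → ∀ {m n} → Clique m → Clique n → l ⟶* m → l ⟶* n → m ↭ n
      go l _ cm cn (done p) (done q) = trans (↭-sym p) q
      go l _ cm cn (done p) (step s _) = contradiction (Step-respˡ (↭-sym p) s) (clique-no-step cm)
      go l _ cm cn (step s _) (done q) = contradiction (Step-respˡ (↭-sym q) s) (clique-no-step cn)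
      go l (acc rs) cm cn (step {l′ = l₁} s r) (step {l′ = l₂} s′ r′)
        with k , r₁ , r₂ ← join-steps s s′
        with o , co , r₃ ← normalise k =
          trans (go l₁ (rs (Step⇒≺ s)) cm co r (⟶*-trans r₁ r₃))
                (go l₂ (rs (Step⇒≺ s′)) co cn (⟶*-trans r₂ r₃) r′)

    -- Uniqueness of cliques with given tails and heads.

    SameNormalForm : Flow → Flow → Set
    SameNormalForm l m = ∀ {k n} → Clique k → Clique n → l ⟶* k → m ⟶* n → k ↭ n

    snf-↭ : ∀ {l m} → l ↭ m → SameNormalForm l m
    snf-↭ p ck cn r s = confluent _ ck cn r (⟶*-respˡ p s)

    snf-sym : ∀ {l m} → SameNormalForm l m → SameNormalForm m l
    snf-sym f ck cn r s = ↭-sym (f cn ck s r)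

    snf-trans : ∀ {k l m} → SameNormalForm k l → SameNormalForm l m → SameNormalForm k m
    snf-trans {l = l} f g ck cn r s with o , co , r′ ← normalise l =
      trans (f ck co r r′) (g co cn r′ s)

    snf-step : ∀ {l m} → Step l m → SameNormalForm l m
    snf-step s ck cn r r′ = confluent _ ck cn r (step s r′)

    -- One of the two directions is a step, unless both matchings are allowed; then they are the
    -- same multiset.
    snf-cross : ∀ {a b r} → SameNormalForm (a ∷ b ∷ r) (cross a b ∷ cross b a ∷ r)
    snf-cross {a} {b} {r} with ok? a b | ok? (cross a b) (cross b a)
    ... | no ¬ok | _ = snf-step (a , b , r , refl , ¬ok , refl)
    ... | yes ok | no ¬ok = snf-sym (snf-step (cross a b , cross b a , r , refl , ¬ok , refl))
    ... | yes ok | yes ok′ = snf-↭ (exchange ok ok′)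

    -- A permutation of the heads over fixed tails is a product of adjacent transpositions, each an
    -- instance of `snf-cross`. The list u collects the arrows that the recursion has passed.
    snf-zip : ∀ {hs ks} → hs ↭ ks → ∀ ts u → length hs ≡ length ts →
      SameNormalForm (zip ts hs ++ u) (zip ts ks ++ u)
    snf-zip refl ts u eq = snf-↭ refl
    snf-zip (prep h p) (t ∷ ts) u eq =
      snf-trans (snf-↭ (↭-sym (shift (t , h) (zip ts _) u)))
        (snf-trans (snf-zip p ts ((t , h) ∷ u) (suc-injective eq))
          (snf-↭ (shift (t , h) (zip ts _) u)))
    snf-zip (swap x y p) (t₁ ∷ t₂ ∷ ts) u eq =
      snf-trans (snf-↭ (↭-sym (shifts (zip ts _) ab)))
        (snf-trans (snf-zip p ts (ab ++ u) (suc-injective (suc-injective eq)))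
          (snf-trans (snf-↭ (shifts (zip ts _) ab)) snf-cross))
      where ab = (t₁ , x) ∷ (t₂ , y) ∷ []
    snf-zip (trans p q) ts u eq =
      snf-trans (snf-zip p ts u eq) (snf-zip q ts u (≡-trans (sym (↭-length p)) eq))

    -- With the tails lined up, m differs from l by a permutation of the heads, which keeps the
    -- normal form; and a clique is its own normal form.
    clique-unique : ∀ {l m} → Clique l → Clique m → SameEnds l m → l ↭ m
    clique-unique {l} {m} cl cm (p , q) = let hs , r , s , _ = align {l} {m} p in
      snf-trans
        (snf-trans (snf-↭ (↭-reflexive (sym (≡-trans (++-identityʳ _) (zip-ends l)))))
          (snf-zip (trans q s) (tails l) [] (≡-trans (length-map proj₂ l) (sym (length-map proj₁ l)))))
        (snf-↭ (trans (↭-reflexive (++-identityʳ _)) (↭-sym r)))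
        cl cm (done refl) (done refl)

-- Compatibility from six bits, and the absence of hexagons by a finite search.

module Hexagons where

  open Swaps
  open import Data.Bool using (Bool; true; false; if_then_else_; not; _∧_; _∨_; _xor_)
  open import Data.Bool using () renaming (T to IsTrue)
  open import Data.Bool.Properties using (T-≡)
  open import Function.Bundles using (Equivalence)
  open import Relation.Binary.Definitions using (tri<; tri≈; tri>)
  open import Data.Nat using (ℕ; suc; zero; _<_; _≤_; _<ᵇ_; _≡ᵇ_; _⊓_; _⊔_; s≤s; z≤n; _+_)
  open import Data.Nat.Properties
  open import Data.List using (List; []; _∷_; length; upTo)
  open import Data.Bool.ListAction using (all)
  open import Data.List.Membership.Propositional using (_∈_)
  open import Data.List.Membership.Propositional.Properties using (∈-upTo⁺)
  open import Data.List.Relation.Unary.Any using (here; there)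
  open import Data.Sum using (inj₁; inj₂)
  open import Data.Vec using (Vec; []; _∷_)
  open import Function using (_∘_)
  open import Relation.Nullary using (yes; no; contradiction)
  open import Relation.Binary.PropositionalEquality
    using (_≡_; _≢_; refl; sym; subst)
    renaming (trans to ≡-trans)

  data Kind : Set where
    thth htht thht htth tthh hhtt : Kind

  record Bits : Set where
    constructor bits
    field bit-thth bit-htht bit-thht bit-htth bit-tthh bit-hhtt : Bool
  open Bits

  -- For p < p′ and q < q′, the pair (p , q), (p′ , q′) is called straight and the pair
  -- (p , q′), (p′ , q) twisted; twist B k tells which of the two is an edge.
  -- For every type, "nests" respectively "crosses" in the theorem means twisted.
  twist : Bits → Kind → Bool
  twist B thth = bit-thth B
  twist B htht = bit-htht B
  twist B thht = bit-thht B
  twist B htth = bit-htth B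
  twist B tthh = bit-tthh B
  twist B hhtt = bit-hhtt B

  -- For unequal bits on THTH and HTHT this is condition (3); for equal ones it is (1) or (2), where
  -- THHT and HTTH take the same value as well.
  valid : Bits → Bool
  valid (bits a b c d e f) =
    if a xor b then not (c ∧ d) ∨ (e ∧ f) else not (a xor c) ∧ not (a xor d)

  -- Meant for p < p′ and q < q′ with four different positions; `kind′` sorts first.
  kind : ℕ → ℕ → ℕ → ℕ → Kind
  kind p p′ q q′ =
    if q <ᵇ p then (if q′ <ᵇ p then hhtt else (if q′ <ᵇ p′ then htht else htth))
    else (if q <ᵇ p′ then (if q′ <ᵇ p′ then thht else thth) else tthh)

  kind′ : ℕ → ℕ → ℕ → ℕ → Kind
  kind′ p p′ q q′ = kind (p ⊓ p′) (p ⊔ p′) (q ⊓ q′) (q ⊔ q′)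

  -- The inner `xor` holds for twisted pairs, whose tails and heads are ordered oppositely.
  okᵇ : Bits → ℕ → ℕ → ℕ → ℕ → Bool
  okᵇ B p q p′ q′ = not (((p <ᵇ p′) xor (q <ᵇ q′)) xor twist B (kind′ p p′ q q′))

  guard : Bool → Bool → Bool
  guard g c = if g then c else true

  infixr 3 _⇒ᵇ_
  _⇒ᵇ_ = guard

  _≢ᵇ_ : ℕ → ℕ → Bool
  x ≢ᵇ y = not (x ≡ᵇ y)

  -- A search over the positions 0, …, 5 for two cliques p₁q₁, p₂q₂, p₃q₃ and p₁q₂, p₂q₃, p₃q₁; each
  -- edge is tested as soon as its endpoints are chosen, which keeps the search small.
  hexagon₆ : Bits → (p₁ q₁ p₂ q₂ p₃ q₃ : ℕ) → Bool
  hexagon₆ B p₁ q₁ p₂ q₂ p₃ q₃ =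
    p₁ ≢ᵇ q₃ ⇒ᵇ q₁ ≢ᵇ q₃ ⇒ᵇ p₂ ≢ᵇ q₃ ⇒ᵇ q₂ ≢ᵇ q₃ ⇒ᵇ p₃ ≢ᵇ q₃ ⇒ᵇ
    okᵇ B p₁ q₁ p₃ q₃ ⇒ᵇ okᵇ B p₂ q₂ p₃ q₃ ⇒ᵇ okᵇ B p₁ q₂ p₂ q₃ ⇒ᵇ okᵇ B p₂ q₃ p₃ q₁ ⇒ᵇ false

  hexagon₅ : Bits → (p₁ q₁ p₂ q₂ p₃ : ℕ) → Bool
  hexagon₅ B p₁ q₁ p₂ q₂ p₃ =
    p₁ ≢ᵇ p₃ ⇒ᵇ q₁ ≢ᵇ p₃ ⇒ᵇ p₂ ≢ᵇ p₃ ⇒ᵇ q₂ ≢ᵇ p₃ ⇒ᵇ okᵇ B p₁ q₂ p₃ q₁ ⇒ᵇ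
    all (hexagon₆ B p₁ q₁ p₂ q₂ p₃) (upTo 6)

  hexagon₄ : Bits → (p₁ q₁ p₂ q₂ : ℕ) → Bool
  hexagon₄ B p₁ q₁ p₂ q₂ =
    p₁ ≢ᵇ q₂ ⇒ᵇ q₁ ≢ᵇ q₂ ⇒ᵇ p₂ ≢ᵇ q₂ ⇒ᵇ okᵇ B p₁ q₁ p₂ q₂ ⇒ᵇ
    all (hexagon₅ B p₁ q₁ p₂ q₂) (upTo 6)

  hexagon₃ : Bits → (p₁ q₁ p₂ : ℕ) → Bool
  hexagon₃ B p₁ q₁ p₂ = p₁ ≢ᵇ p₂ ⇒ᵇ q₁ ≢ᵇ p₂ ⇒ᵇ all (hexagon₄ B p₁ q₁ p₂) (upTo 6)

  hexagon₂ : Bits → (p₁ q₁ : ℕ) → Bool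
  hexagon₂ B p₁ q₁ = p₁ ≢ᵇ q₁ ⇒ᵇ all (hexagon₃ B p₁ q₁) (upTo 6)

  hexagon₁ : Bits → ℕ → Bool
  hexagon₁ B p₁ = all (hexagon₂ B p₁) (upTo 6)

  hexagon-free : Bits → Bool
  hexagon-free B = all (hexagon₁ B) (upTo 6)

  allVec : ∀ n → (Vec Bool n → Bool) → Bool
  allVec zero f = f []
  allVec (suc n) f = allVec n (f ∘ (false ∷_)) ∧ allVec n (f ∘ (true ∷_))

  allVec-elim : ∀ n f → allVec n f ≡ true → ∀ v → f v ≡ true
  allVec-elim zero f eq [] = eq
  allVec-elim (suc n) f eq (b ∷ v) with allVec n (f ∘ (false ∷_)) in eq₀ | b
  ... | true | false = allVec-elim n _ eq₀ v
  ... | true | true = allVec-elim n _ eq v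

  valid⇒hexagon-freeᵇ : Vec Bool 6 → Bool
  valid⇒hexagon-freeᵇ (a ∷ b ∷ c ∷ d ∷ e ∷ f ∷ []) =
    valid (bits a b c d e f) ⇒ᵇ hexagon-free (bits a b c d e f)

  guard-elim : ∀ {g c} → guard g c ≡ true → g ≡ true → c ≡ true
  guard-elim eq refl = eq

  valid⇒hexagon-free : ∀ B → valid B ≡ true → hexagon-free B ≡ true
  valid⇒hexagon-free (bits a b c d e f) =
    -- Here `refl` makes the type checker run the search for all 64 choices of the bits.
    guard-elim (allVec-elim 6 valid⇒hexagon-freeᵇ refl (a ∷ b ∷ c ∷ d ∷ e ∷ f ∷ []))

  all-elim : ∀ {X : Set} (f : X → Bool) {x xs} → all f xs ≡ true → x ∈ xs → f x ≡ true
  all-elim f {xs = y ∷ xs} eq (here refl) with f y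
  ... | true = refl
  all-elim f {xs = y ∷ xs} eq (there p) with f y
  ... | true = all-elim f eq p

  ≢⇒≢ᵇ : ∀ {x y} → x ≢ y → (x ≢ᵇ y) ≡ true
  ≢⇒≢ᵇ {x} {y} x≢y with x ≡ᵇ y in eq
  ... | false = refl
  ... | true = contradiction (≡ᵇ⇒≡ x y (subst IsTrue (sym eq) _)) x≢y

  <⇒<ᵇ≡true : ∀ {x y} → x < y → (x <ᵇ y) ≡ true
  <⇒<ᵇ≡true x<y = Equivalence.to T-≡ (<⇒<ᵇ x<y)

  ≤⇒<ᵇ≡false : ∀ {x y} → y ≤ x → (x <ᵇ y) ≡ false
  ≤⇒<ᵇ≡false {x} {y} y≤x with x <ᵇ y in eq
  ... | false = refl
  ... | true = contradiction (<ᵇ⇒< x y (subst IsTrue (sym eq) _)) (≤⇒≯ y≤x)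

  -- Compression of six positions to their ranks.

  below : ℕ → ℕ → ℕ
  below x y = if y <ᵇ x then 1 else 0

  -- Ranks among six listed positions lie in 0, ..., 5 and keep the order, and `okᵇ` depends on the
  -- order alone. So the finite search covers all positions.
  rank : List ℕ → ℕ → ℕ
  rank [] x = 0
  rank (y ∷ ys) x = below x y + rank ys x

  below-mono : ∀ {x x′} y → x ≤ x′ → below x y ≤ below x′ y
  below-mono {x} {x′} y x≤x′ with y <? x
  ... | yes y<x rewrite <⇒<ᵇ≡true y<x | <⇒<ᵇ≡true (<-≤-trans y<x x≤x′) = ≤-refl
  ... | no y≮x rewrite ≤⇒<ᵇ≡false (≮⇒≥ y≮x) = z≤n

  rank-mono : ∀ ys {x x′} → x ≤ x′ → rank ys x ≤ rank ys x′
  rank-mono [] x≤x′ = z≤n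
  rank-mono (y ∷ ys) x≤x′ = +-mono-≤ (below-mono y x≤x′) (rank-mono ys x≤x′)

  rank-strict : ∀ {ys x x′} → x ∈ ys → x < x′ → rank ys x < rank ys x′
  rank-strict {y ∷ ys} (here refl) x<x′
    rewrite ≤⇒<ᵇ≡false (≤-refl {y}) | <⇒<ᵇ≡true x<x′ = s≤s (rank-mono ys (<⇒≤ x<x′))
  rank-strict {y ∷ ys} (there p) x<x′ = +-mono-≤-< (below-mono y (<⇒≤ x<x′)) (rank-strict p x<x′)

  rank-bound : ∀ ys x → rank ys x ≤ length ys
  rank-bound [] x = z≤n
  rank-bound (y ∷ ys) x with y <ᵇ x
  ... | true = s≤s (rank-bound ys x)
  ... | false = m≤n⇒m≤1+n (rank-bound ys x)

  rank< : ∀ {ys x} → x ∈ ys → rank ys x < length ys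
  rank< {ys} {x} p = <-≤-trans (rank-strict p (n<1+n x)) (rank-bound ys (suc x))

  -- For x < y, the listed x is counted in the rank of y but not in its own; otherwise monotonicity
  -- suffices.
  rank-<ᵇ : ∀ {ys x y} → x ∈ ys → (rank ys x <ᵇ rank ys y) ≡ (x <ᵇ y)
  rank-<ᵇ {ys} {x} {y} p with x <? y
  ... | yes x<y = ≡-trans (<⇒<ᵇ≡true (rank-strict p x<y)) (sym (<⇒<ᵇ≡true x<y))
  ... | no x≮y = ≡-trans (≤⇒<ᵇ≡false (rank-mono ys (≮⇒≥ x≮y))) (sym (≤⇒<ᵇ≡false (≮⇒≥ x≮y)))

  module _ {xs : List ℕ} where
    private φ = rank xs

    ∈-⊓ : ∀ {x y} → x ∈ xs → y ∈ xs → x ⊓ y ∈ xs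
    ∈-⊓ {x} {y} x∈ y∈ with ⊓-sel x y
    ... | inj₁ eq = subst (_∈ xs) (sym eq) x∈
    ... | inj₂ eq = subst (_∈ xs) (sym eq) y∈

    ∈-⊔ : ∀ {x y} → x ∈ xs → y ∈ xs → x ⊔ y ∈ xs
    ∈-⊔ {x} {y} x∈ y∈ with ⊔-sel x y
    ... | inj₁ eq = subst (_∈ xs) (sym eq) x∈
    ... | inj₂ eq = subst (_∈ xs) (sym eq) y∈

    kind-rank : ∀ {p p′ q q′} → q ∈ xs → q′ ∈ xs → kind (φ p) (φ p′) (φ q) (φ q′) ≡ kind p p′ q q′
    kind-rank {p} {p′} {q} {q′} q∈ q′∈
      rewrite rank-<ᵇ {y = p} q∈ | rank-<ᵇ {y = p} q′∈ | rank-<ᵇ {y = p′} q∈ | rank-<ᵇ {y = p′} q′∈ = refl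

    kind′-rank : ∀ {p p′ q q′} → q ∈ xs → q′ ∈ xs → kind′ (φ p) (φ p′) (φ q) (φ q′) ≡ kind′ p p′ q q′
    kind′-rank {p} {p′} {q} {q′} q∈ q′∈
      rewrite sym (mono-≤-distrib-⊓ (rank-mono xs) p p′) | sym (mono-≤-distrib-⊔ (rank-mono xs) p p′)
            | sym (mono-≤-distrib-⊓ (rank-mono xs) q q′) | sym (mono-≤-distrib-⊔ (rank-mono xs) q q′)
      = kind-rank (∈-⊓ q∈ q′∈) (∈-⊔ q∈ q′∈)

    okᵇ-rank : ∀ B {p} p′ {q q′} → p ∈ xs → q ∈ xs → q′ ∈ xs →
      okᵇ B p q p′ q′ ≡ true → okᵇ B (φ p) (φ q) (φ p′) (φ q′) ≡ true
    okᵇ-rank B {p} p′ {q} {q′} p∈ q∈ q′∈ eq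
      rewrite kind′-rank {p} {p′} q∈ q′∈ | rank-<ᵇ {y = p′} p∈ | rank-<ᵇ {y = q′} q∈ = eq

    rank-≢ : ∀ {x y} → x ∈ xs → y ∈ xs → x ≢ y → (φ x ≢ᵇ φ y) ≡ true
    rank-≢ {x} {y} x∈ y∈ x≢y = ≢⇒≢ᵇ go
      where
      go : φ x ≢ φ y
      go eq with <-cmp x y
      ... | tri< x<y _ _ = <⇒≢ (rank-strict x∈ x<y) eq
      ... | tri≈ _ x≡y _ = x≢y x≡y
      ... | tri> _ _ y<x = <⇒≢ (rank-strict y∈ y<x) (sym eq)

  no-hexagonᵇ : ∀ B → valid B ≡ true → ∀ {p₁ p₂ p₃ q₁ q₂ q₃} →
    p₁ ≢ q₁ → p₁ ≢ q₂ → p₁ ≢ q₃ → p₂ ≢ q₁ → p₂ ≢ q₂ → p₂ ≢ q₃ → p₃ ≢ q₁ → p₃ ≢ q₂ → p₃ ≢ q₃ →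
    p₁ ≢ p₂ → p₁ ≢ p₃ → p₂ ≢ p₃ → q₁ ≢ q₂ → q₁ ≢ q₃ → q₂ ≢ q₃ →
    okᵇ B p₁ q₁ p₂ q₂ ≡ true → okᵇ B p₁ q₁ p₃ q₃ ≡ true → okᵇ B p₂ q₂ p₃ q₃ ≡ true →
    okᵇ B p₁ q₂ p₂ q₃ ≡ true → okᵇ B p₁ q₂ p₃ q₁ ≡ true → okᵇ B p₂ q₃ p₃ q₁ ≢ true
  no-hexagonᵇ B v {p₁} {p₂} {p₃} {q₁} {q₂} {q₃}
    a b c d e f g h i j k l m n o x₁₂ x₁₃ x₂₃ y₁₂ y₁₃ y₂₃ =
    false≢true s₆
    where
    xs = p₁ ∷ q₁ ∷ p₂ ∷ q₂ ∷ p₃ ∷ q₃ ∷ []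
    r = rank xs
    infixl 2 _▹_
    _▹_ : ∀ {g c} → guard g c ≡ true → g ≡ true → c ≡ true
    _▹_ = guard-elim
    false≢true : false ≢ true
    false≢true ()
    ∈₁ : p₁ ∈ xs
    ∈₁ = here refl
    ∈₂ : q₁ ∈ xs
    ∈₂ = there (here refl)
    ∈₃ : p₂ ∈ xs
    ∈₃ = there (there (here refl))
    ∈₄ : q₂ ∈ xs
    ∈₄ = there (there (there (here refl)))
    ∈₅ : p₃ ∈ xs
    ∈₅ = there (there (there (there (here refl))))
    ∈₆ : q₃ ∈ xs
    ∈₆ = there (there (there (there (there (here refl)))))
    code : ∀ {x} → x ∈ xs → rank xs x ∈ upTo 6
    code x∈ = ∈-upTo⁺ (rank< x∈)
    P₁ = code ∈₁
    Q₁ = code ∈₂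
    P₂ = code ∈₃
    Q₂ = code ∈₄
    P₃ = code ∈₅
    Q₃ = code ∈₆
    -- Each of these enters one more level of the search and discharges its guards with the
    -- inequalities and edges among the nodes chosen so far.
    s₁ = all-elim (hexagon₁ B) (valid⇒hexagon-free B v) P₁
    s₂ = all-elim (hexagon₂ B (r p₁)) s₁ Q₁ ▹ rank-≢ ∈₁ ∈₂ a
    s₃ = all-elim (hexagon₃ B (r p₁) (r q₁)) s₂ P₂ ▹ rank-≢ ∈₁ ∈₃ j ▹ rank-≢ ∈₂ ∈₃ (d ∘ sym)
    s₄ = all-elim (hexagon₄ B (r p₁) (r q₁) (r p₂)) s₃ Q₂
      ▹ rank-≢ ∈₁ ∈₄ b ▹ rank-≢ ∈₂ ∈₄ m ▹ rank-≢ ∈₃ ∈₄ e ▹ okᵇ-rank B p₂ ∈₁ ∈₂ ∈₄ x₁₂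
    s₅ = all-elim (hexagon₅ B (r p₁) (r q₁) (r p₂) (r q₂)) s₄ P₃
      ▹ rank-≢ ∈₁ ∈₅ k ▹ rank-≢ ∈₂ ∈₅ (g ∘ sym) ▹ rank-≢ ∈₃ ∈₅ l ▹ rank-≢ ∈₄ ∈₅ (h ∘ sym)
      ▹ okᵇ-rank B p₃ ∈₁ ∈₄ ∈₂ y₁₃
    s₆ = all-elim (hexagon₆ B (r p₁) (r q₁) (r p₂) (r q₂) (r p₃)) s₅ Q₃
      ▹ rank-≢ ∈₁ ∈₆ c ▹ rank-≢ ∈₂ ∈₆ n ▹ rank-≢ ∈₃ ∈₆ f ▹ rank-≢ ∈₄ ∈₆ o ▹ rank-≢ ∈₅ ∈₆ i
      ▹ okᵇ-rank B p₃ ∈₁ ∈₂ ∈₆ x₁₃ ▹ okᵇ-rank B p₃ ∈₃ ∈₄ ∈₆ x₂₃ ▹ okᵇ-rank B p₂ ∈₁ ∈₄ ∈₆ y₁₂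
      ▹ okᵇ-rank B p₃ ∈₃ ∈₆ ∈₂ y₂₃

-- A lexicographic cost that decreases under swaps.

module SwapOrder where

  open Swaps
  open Hexagons
  open import Data.Bool using (Bool; true; false; if_then_else_; not; _xor_)
  open import Data.Bool.Properties using () renaming (_≟_ to _≟ᵇ_)
  open import Data.Bool.Properties using (not-involutive)
  open import Data.Nat using (>-nonZero; ℕ; suc; _<_; _≤_; _<ᵇ_; s≤s; z≤n; _+_; _*_; _∸_)
  open import Data.Nat.Properties
  open import Data.Nat.Induction using (<-wellFounded)
  open import Data.Nat.ListAction using (sum)
  open import Data.Nat.ListAction.Properties using (sum-↭)
  open import Data.Fin using (Fin; toℕ)
  open import Data.Fin.Properties using (toℕ-injective; toℕ<n) renaming (_≟_ to _≟ᶠ_)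
  open import Data.List using (List; []; _∷_; map)
  open import Data.Bool.ListAction using (all)
  open import Data.List.Membership.Propositional using (_∈_)
  open import Data.List.Relation.Unary.Any using (here; there)
  open import Data.List.Relation.Binary.Permutation.Propositional using (_↭_; refl)
  open import Data.List.Relation.Binary.Permutation.Propositional.Properties using (map⁺)
  open import Data.Vec using (Vec; []; _∷_)
  open import Data.Product using (_×_; _,_)
  open import Data.Sum using (_⊎_; inj₁; inj₂)
  open import Data.Empty using (⊥)
  open import Data.Unit using (⊤; tt)
  open import Function using (_∘_)
  open import Induction.WellFounded using (Acc; acc; WellFounded)
  open import Relation.Binary.Definitions using (Decidable; tri<; tri≈; tri>)
  open import Relation.Nullary using (¬_; yes; no; contradiction)
  open import Relation.Nullary.Decidable using (map′)
  open import Relation.Binary.PropositionalEquality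
    using (_≡_; _≢_; refl; sym; cong; subst; subst₂)
    renaming (trans to ≡-trans)

  <ᵇ-flip : ∀ {x y} → x ≢ y → (y <ᵇ x) ≡ not (x <ᵇ y)
  <ᵇ-flip {x} {y} x≢y with <-cmp x y
  ... | tri< x<y _ _ rewrite <⇒<ᵇ≡true x<y = ≤⇒<ᵇ≡false (<⇒≤ x<y)
  ... | tri≈ _ x≡y _ = contradiction x≡y x≢y
  ... | tri> _ _ y<x rewrite ≤⇒<ᵇ≡false (<⇒≤ y<x) = <⇒<ᵇ≡true y<x

  kind′-comm : ∀ p p′ q q′ → kind′ p′ p q′ q ≡ kind′ p p′ q q′
  kind′-comm p p′ q q′ rewrite ⊓-comm p′ p | ⊔-comm p′ p | ⊓-comm q′ q | ⊔-comm q′ q = refl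

  kind′-commʳ : ∀ p p′ q q′ → kind′ p p′ q′ q ≡ kind′ p p′ q q′
  kind′-commʳ p p′ q q′ rewrite ⊓-comm q′ q | ⊔-comm q′ q = refl

  okᵇ-comm : ∀ B {p p′} {q q′} → p ≢ p′ → q ≢ q′ → okᵇ B p′ q′ p q ≡ okᵇ B p q p′ q′
  okᵇ-comm B {p} {p′} {q} {q′} p≢p′ q≢q′
    rewrite <ᵇ-flip p≢p′ | <ᵇ-flip q≢q′ | kind′-comm p p′ q q′ with p <ᵇ p′ | q <ᵇ q′
  ... | false | false = refl
  ... | false | true = refl
  ... | true | false = refl
  ... | true | true = refl

  okᵇ-cross : ∀ B p p′ {q q′} → q ≢ q′ → okᵇ B p q′ p′ q ≡ not (okᵇ B p q p′ q′)
  okᵇ-cross B p p′ {q} {q′} q≢q′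
    rewrite <ᵇ-flip q≢q′ | kind′-commʳ p p′ q q′ with p <ᵇ p′ | q <ᵇ q′
  ... | false | false = refl
  ... | false | true = sym (not-involutive _)
  ... | true | false = sym (not-involutive _)
  ... | true | true = refl

  data KindView (p p′ q q′ : ℕ) : Kind → Set where
    thth : p < q → q < p′ → p′ < q′ → KindView p p′ q q′ thth
    htht : q < p → p < q′ → q′ < p′ → KindView p p′ q q′ htht
    thht : p < q → q < q′ → q′ < p′ → KindView p p′ q q′ thht
    htth : q < p → p < p′ → p′ < q′ → KindView p p′ q q′ htth
    tthh : p < p′ → p′ < q → q < q′ → KindView p p′ q q′ tthh
    hhtt : q < q′ → q′ < p → p < p′ → KindView p p′ q q′ hhtt

  kind-view : ∀ {p p′ q q′} → p < p′ → q < q′ → p ≢ q → p ≢ q′ → p′ ≢ q → p′ ≢ q′ →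
    KindView p p′ q q′ (kind p p′ q q′)
  kind-view {p} {p′} {q} {q′} p<p′ q<q′ a b c d with <-cmp q p | <-cmp q′ p | <-cmp q p′ | <-cmp q′ p′
  ... | tri≈ _ e _ | _ | _ | _ = contradiction (sym e) a
  ... | _ | tri≈ _ e _ | _ | _ = contradiction (sym e) b
  ... | _ | _ | tri≈ _ e _ | _ = contradiction (sym e) c
  ... | _ | _ | _ | tri≈ _ e _ = contradiction (sym e) d
  ... | tri< x _ _ | tri< y _ _ | _ | _
    rewrite <⇒<ᵇ≡true x | <⇒<ᵇ≡true y = hhtt q<q′ y p<p′
  ... | tri< x _ _ | tri> _ _ y | _ | tri< z _ _
    rewrite <⇒<ᵇ≡true x | ≤⇒<ᵇ≡false (<⇒≤ y) | <⇒<ᵇ≡true z = htht x y z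
  ... | tri< x _ _ | tri> _ _ y | _ | tri> _ _ z
    rewrite <⇒<ᵇ≡true x | ≤⇒<ᵇ≡false (<⇒≤ y) | ≤⇒<ᵇ≡false (<⇒≤ z) = htth x p<p′ z
  ... | tri> _ _ x | _ | tri< y _ _ | tri< z _ _
    rewrite ≤⇒<ᵇ≡false (<⇒≤ x) | <⇒<ᵇ≡true y | <⇒<ᵇ≡true z = thht x q<q′ z
  ... | tri> _ _ x | _ | tri< y _ _ | tri> _ _ z
    rewrite ≤⇒<ᵇ≡false (<⇒≤ x) | <⇒<ᵇ≡true y | ≤⇒<ᵇ≡false (<⇒≤ z) = thth x y z
  ... | tri> _ _ x | _ | tri> _ _ y | _
    rewrite ≤⇒<ᵇ≡false (<⇒≤ x) | ≤⇒<ᵇ≡false (<⇒≤ y) = tthh p<p′ y q<q′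

  -- R and L refer to arrows pointing right (p < q) and left (q < p).  For a valid choice of bits a
  -- list of signed weights, compared lexicographically, makes every incompatible pair more
  -- expensive than its cross pair, so that swapping terminates.
  data Weight : Set where
    R1 Rq Rp D Rpq Lpq : Weight

  weightᵇ : Weight → Bool → ℕ → ℕ → ℕ
  weightᵇ R1 b p q = if b then 1 else 0
  weightᵇ Rq b p q = if b then q else 0
  weightᵇ Rp b p q = if b then p else 0
  weightᵇ D b p q = if b then q ∸ p else 0
  weightᵇ Rpq b p q = if b then p * q else 0
  weightᵇ Lpq b p q = if b then 0 else p * q

  weight : Weight → ℕ → ℕ → ℕ
  weight w p q = weightᵇ w (p <ᵇ q) p q

  data Effect : Set where
    equal smaller larger unspecified : Effect

  Holds : Effect → ℕ → ℕ → Set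
  Holds equal x y = x ≡ y
  Holds smaller x y = x < y
  Holds larger x y = y < x
  Holds unspecified x y = ⊤

  -- Compares the straight pair with the twisted pair. The value `unspecified` occurs only at kinds
  -- that an earlier weight of the list has already decided.
  effect : Weight → Kind → Effect
  effect R1 thth = larger
  effect R1 htht = smaller
  effect R1 _ = equal
  effect Rq thht = smaller
  effect Rq htth = equal
  effect Rp thht = equal
  effect Rp htth = larger
  effect D tthh = equal
  effect D hhtt = equal
  effect D _ = smaller
  effect Rpq tthh = larger
  effect Lpq hhtt = larger
  effect _ thth = unspecified
  effect _ htht = unspecified
  effect _ thht = unspecified
  effect _ htth = unspecified
  effect _ tthh = equal
  effect _ hhtt = equal

  *-rearrangement : ∀ {p p′ q q′} → p < p′ → q < q′ → p * q′ + p′ * q < p * q + p′ * q′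
  *-rearrangement {p} {p′} {q} {q′} p<p′ q<q′ =
    subst (λ x → p * q′ + x * q < p * q + x * q′) (m+[n∸m]≡n (<⇒≤ p<p′)) (begin-strict
      p * q′ + (p + d) * q       ≡⟨ cong (p * q′ +_) (*-distribʳ-+ q p d) ⟩
      p * q′ + (p * q + d * q)   ≡⟨ +-exchange (p * q′) (p * q) (d * q) ⟩
      p * q + (p * q′ + d * q)   <⟨ +-monoʳ-< (p * q) (+-monoʳ-< (p * q′) (d*q<d*q′)) ⟩
      p * q + (p * q′ + d * q′)  ≡⟨ cong (p * q +_) (sym (*-distribʳ-+ q′ p d)) ⟩
      p * q + (p + d) * q′       ∎)
    where
    open ≤-Reasoning
    d = p′ ∸ p
    d*q<d*q′ : d * q < d * q′
    d*q<d*q′ = *-monoʳ-< d {{>-nonZero (m<n⇒0<n∸m p<p′)}} q<q′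
    +-exchange : ∀ x y z → x + (y + z) ≡ y + (x + z)
    +-exchange x y z = ≡-trans (sym (+-assoc x y z)) (≡-trans (cong (_+ z) (+-comm x y)) (+-assoc y x z))

  ∸-split : ∀ {x y z} → x ≤ y → y ≤ z → z ∸ x ≡ (y ∸ x) + (z ∸ y)
  ∸-split {x} {y} {z} x≤y y≤z =
    ≡-trans (cong (_∸ x) (sym (m+[n∸m]≡n y≤z))) (+-∸-comm (z ∸ y) x≤y)

  ∸-exchange : ∀ {p p′ q q′} → p ≤ p′ → p′ ≤ q → q ≤ q′ → (q ∸ p) + (q′ ∸ p′) ≡ (q′ ∸ p) + (q ∸ p′)
  ∸-exchange {p} {p′} {q} {q′} a b c
    rewrite ∸-split (≤-trans a b) c | ∸-split b c
          | +-assoc (q ∸ p) (q′ ∸ q) (q ∸ p′) | +-comm (q′ ∸ q) (q ∸ p′) = refl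

  <+0 : ∀ {x y} → x < y → x + 0 < y + 0
  <+0 = +-monoˡ-< 0

  effect-holds : ∀ w {p p′ q q′ k} → KindView p p′ q q′ k →
    Holds (effect w k) (weight w p q + weight w p′ q′) (weight w p q′ + weight w p′ q)
  effect-holds w {p} {p′} {q} {q′} (thth a b c)
    rewrite <⇒<ᵇ≡true a | <⇒<ᵇ≡true c | <⇒<ᵇ≡true (<-trans a (<-trans b c)) | ≤⇒<ᵇ≡false (<⇒≤ b) = go w
    where
    go : ∀ w → Holds (effect w thth) (weightᵇ w true p q + weightᵇ w true p′ q′)
                                     (weightᵇ w true p q′ + weightᵇ w false p′ q)
    go R1 = ≤-refl
    go Rq = tt
    go Rp = tt
    go D rewrite ∸-split (<⇒≤ (<-trans a b)) (<⇒≤ c) | +-identityʳ ((p′ ∸ p) + (q′ ∸ p′)) =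
      +-monoˡ-< (q′ ∸ p′) (∸-monoˡ-< b (<⇒≤ a))
    go Rpq = tt
    go Lpq = tt
  effect-holds w {p} {p′} {q} {q′} (htht a b c)
    rewrite ≤⇒<ᵇ≡false (<⇒≤ a) | ≤⇒<ᵇ≡false (<⇒≤ c) | <⇒<ᵇ≡true b
          | ≤⇒<ᵇ≡false (<⇒≤ (<-trans a (<-trans b c))) = go w
    where
    go : ∀ w → Holds (effect w htht) (weightᵇ w false p q + weightᵇ w false p′ q′)
                                     (weightᵇ w true p q′ + weightᵇ w false p′ q)
    go R1 = ≤-refl
    go Rq = tt
    go Rp = tt
    go D = <+0 (m<n⇒0<n∸m b)
    go Rpq = tt
    go Lpq = tt
  effect-holds w {p} {p′} {q} {q′} (thht a b c)
    rewrite <⇒<ᵇ≡true a | ≤⇒<ᵇ≡false (<⇒≤ c) | <⇒<ᵇ≡true (<-trans a b) | ≤⇒<ᵇ≡false (<⇒≤ (<-trans b c)) = go w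
    where
    go : ∀ w → Holds (effect w thht) (weightᵇ w true p q + weightᵇ w false p′ q′)
                                     (weightᵇ w true p q′ + weightᵇ w false p′ q)
    go R1 = refl
    go Rq = <+0 b
    go Rp = refl
    go D = <+0 (∸-monoˡ-< b (<⇒≤ a))
    go Rpq = tt
    go Lpq = tt
  effect-holds w {p} {p′} {q} {q′} (htth a b c)
    rewrite ≤⇒<ᵇ≡false (<⇒≤ a) | <⇒<ᵇ≡true c | <⇒<ᵇ≡true (<-trans b c) | ≤⇒<ᵇ≡false (<⇒≤ (<-trans a b)) = go w
    where
    go : ∀ w → Holds (effect w htth) (weightᵇ w false p q + weightᵇ w true p′ q′)
                                     (weightᵇ w true p q′ + weightᵇ w false p′ q)
    go R1 = refl
    go Rq = sym (+-identityʳ q′)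
    go Rp = subst (_< p′) (sym (+-identityʳ p)) b
    go D = subst (q′ ∸ p′ <_) (sym (+-identityʳ (q′ ∸ p))) (∸-monoʳ-< b (<⇒≤ c))
    go Rpq = tt
    go Lpq = tt
  effect-holds w {p} {p′} {q} {q′} (tthh a b c)
    rewrite <⇒<ᵇ≡true (<-trans a b) | <⇒<ᵇ≡true (<-trans b c) | <⇒<ᵇ≡true (<-trans a (<-trans b c))
          | <⇒<ᵇ≡true b = go w
    where
    go : ∀ w → Holds (effect w tthh) (weightᵇ w true p q + weightᵇ w true p′ q′)
                                     (weightᵇ w true p q′ + weightᵇ w true p′ q)
    go R1 = refl
    go Rq = +-comm q q′
    go Rp = refl
    go D = ∸-exchange (<⇒≤ a) (<⇒≤ b) (<⇒≤ c)
    go Rpq = *-rearrangement a c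
    go Lpq = refl
  effect-holds w {p} {p′} {q} {q′} (hhtt a b c)
    rewrite ≤⇒<ᵇ≡false (<⇒≤ (<-trans a b)) | ≤⇒<ᵇ≡false (<⇒≤ (<-trans b c)) | ≤⇒<ᵇ≡false (<⇒≤ b)
          | ≤⇒<ᵇ≡false (<⇒≤ (<-trans a (<-trans b c))) = go w
    where
    go : ∀ w → Holds (effect w hhtt) (weightᵇ w false p q + weightᵇ w false p′ q′)
                                     (weightᵇ w false p q′ + weightᵇ w false p′ q)
    go R1 = refl
    go Rq = refl
    go Rp = refl
    go D = refl
    go Rpq = refl
    go Lpq = *-rearrangement c a

  SignedWeight : Set
  SignedWeight = Bool × Weight

  -- The sign false stands for the negated weight.
  weights : Bits → List SignedWeight
  weights (bits a b c d e f) = (if a xor b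
    then (a , R1) ∷ (not c , Rq) ∷ (d , Rp) ∷ []
    else (not a , D) ∷ []) ++ˡ ((e , Rpq) ∷ (f , Lpq) ∷ [])
    where open import Data.List using () renaming (_++_ to _++ˡ_)

  -- Here tw = true asks for the twisted pair to be the cheaper one.
  favours : List SignedWeight → Kind → Bool → Bool
  favours [] k tw = false
  favours ((s , w) ∷ ws) k tw with effect w k
  ... | equal = favours ws k tw
  ... | smaller = s xor tw
  ... | larger = not (s xor tw)
  ... | unspecified = false

  kinds : List Kind
  kinds = thth ∷ htht ∷ thht ∷ htth ∷ tthh ∷ hhtt ∷ []

  ∈-kinds : ∀ k → k ∈ kinds
  ∈-kinds thth = here refl
  ∈-kinds htht = there (here refl)
  ∈-kinds thht = there (there (here refl))
  ∈-kinds htth = there (there (there (here refl)))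
  ∈-kinds tthh = there (there (there (there (here refl))))
  ∈-kinds hhtt = there (there (there (there (there (here refl)))))

  favours-twist : Bits → Kind → Bool
  favours-twist B k = favours (weights B) k (twist B k)

  valid⇒favoursᵇ : Vec Bool 6 → Bool
  valid⇒favoursᵇ (a ∷ b ∷ c ∷ d ∷ e ∷ f ∷ []) =
    guard (valid (bits a b c d e f)) (all (favours-twist (bits a b c d e f)) kinds)

  -- For unequal bits, `R1` settles THTH and HTHT in opposite ways; then `Rq` settles THHT, `Rp`
  -- HTTH, `Rpq` TTHH and `Lpq` HHTT, each with the sign that its bit prescribes. For equal bits,
  -- `D` prefers the straight pair in all four mixed types, or the twisted one after negation.
  valid⇒favours : ∀ B → valid B ≡ true → ∀ k → favours (weights B) k (twist B k) ≡ true
  valid⇒favours B@(bits a b c d e f) v k =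
    all-elim (favours-twist B)
      (guard-elim (allVec-elim 6 valid⇒favoursᵇ refl (a ∷ b ∷ c ∷ d ∷ e ∷ f ∷ [])) v) (∈-kinds k)

  LexLess : ∀ {X : Set} → List (X → ℕ) → X → X → Set
  LexLess [] x y = ⊥
  LexLess (g ∷ gs) x y = g x < g y ⊎ (g x ≡ g y × LexLess gs x y)

  LexLess-wellFounded : ∀ {X : Set} (gs : List (X → ℕ)) → WellFounded (LexLess gs)
  LexLess-wellFounded [] x = acc λ ()
  LexLess-wellFounded {X} (g ∷ gs) x = go (<-wellFounded (g x)) x refl (LexLess-wellFounded gs x)
    where
    go : ∀ {m} → Acc _<_ m → ∀ x → g x ≡ m → Acc (LexLess gs) x → Acc (LexLess (g ∷ gs)) x
    go′ : ∀ {m} → Acc _<_ m → ∀ x → g x ≡ m → Acc (LexLess gs) x →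
      ∀ {y} → LexLess (g ∷ gs) y x → Acc (LexLess (g ∷ gs)) y
    go a x eq b = acc (go′ a x eq b)
    go′ (acc rs) x refl _ {y} (inj₁ y<x) = go (rs y<x) y refl (LexLess-wellFounded gs y)
    go′ a x refl (acc ss) {y} (inj₂ (y≡x , y≺x)) = go a y y≡x (ss y≺x)

  module _ {X : Set} where

    total : (X → ℕ) → List X → ℕ
    total g l = sum (map g l)

    pair-total : (X → ℕ) → X × X → ℕ
    pair-total g (x , y) = g x + g y

    total-↭∷∷ : ∀ g {l x y r} → l ↭ x ∷ y ∷ r → total g l ≡ pair-total g (x , y) + total g r
    total-↭∷∷ g {l} {x} {y} {r} p = ≡-trans (sum-↭ (map⁺ g p)) (sym (+-assoc (g x) (g y) (total g r)))

    -- The remainder r contributes equally to both totals, so the two swapped arrows decide the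
    -- comparison.
    LexLess-total : ∀ gs {l l′ x y x′ y′ r} → l′ ↭ x′ ∷ y′ ∷ r → l ↭ x ∷ y ∷ r →
      LexLess (map pair-total gs) (x′ , y′) (x , y) → LexLess (map total gs) l′ l
    LexLess-total (g ∷ gs) {r = r} p q (inj₁ lt) =
      inj₁ (subst₂ _<_ (sym (total-↭∷∷ g p)) (sym (total-↭∷∷ g q)) (+-monoˡ-< (total g r) lt))
    LexLess-total (g ∷ gs) {r = r} p q (inj₂ (eq , lt)) =
      inj₂ ( ≡-trans (total-↭∷∷ g p) (≡-trans (cong (_+ total g r) eq) (sym (total-↭∷∷ g q)))
           , LexLess-total gs p q lt)

  ∸-pair : ∀ {c x y} → x ≤ c → y ≤ c → (c ∸ x) + (c ∸ y) ≡ (c + c) ∸ (x + y)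
  ∸-pair {c} {x} {y} x≤c y≤c =
    ≡-trans (sym (+-∸-comm (c ∸ y) x≤c))
      (≡-trans (cong (_∸ x) (sym (+-∸-assoc c y≤c)))
        (≡-trans (∸-+-assoc (c + c) y x) (cong ((c + c) ∸_) (+-comm y x))))

  -- Placing the node v as a tail before v as a head makes all positions distinct, so that
  -- compatibility is defined for all pairs of arrows, and not only for admissible ones.
  module _ {N : ℕ} where

    P Q : Fin N → ℕ
    P t = 2 * toℕ t
    Q h = suc (2 * toℕ h)

    P-injective : ∀ {t t′} → P t ≡ P t′ → t ≡ t′
    P-injective eq = toℕ-injective (*-cancelˡ-≡ _ _ 2 eq)

    Q-injective : ∀ {h h′} → Q h ≡ Q h′ → h ≡ h′
    Q-injective eq = P-injective (suc-injective eq)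

    P≢Q : ∀ t h → P t ≢ Q h
    P≢Q t h = even≢odd (toℕ t) (toℕ h)

  module Order (N : ℕ) (B : Bits) where

    Node² : Set
    Node² = Fin N × Fin N

    -- The test `okᵇ` is meaningful only for different tails and different heads; arrows with a
    -- common tail or head are declared compatible, as permissibility demands.
    data Ok : Node² → Node² → Set where
      same-tail : ∀ {t h h′} → Ok (t , h) (t , h′)
      same-head : ∀ {t t′ h} → Ok (t , h) (t′ , h)
      compatible : ∀ {t h t′ h′} → okᵇ B (P t) (Q h) (P t′) (Q h′) ≡ true → Ok (t , h) (t′ , h′)

    -- Positions are at most 2N + 1, and this square dominates every weight. Hence the truncated
    -- subtraction in `signed` is exact and reverses comparisons.
    bound : ℕ
    bound = suc (2 * N) * suc (2 * N)

    signed : SignedWeight → Node² → ℕ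
    signed (true , w) (t , h) = weight w (P t) (Q h)
    signed (false , w) (t , h) = bound ∸ weight w (P t) (Q h)

    weight≤bound : ∀ w (t h : Fin N) → weight w (P t) (Q h) ≤ bound
    weight≤bound w t h = go w (P t <ᵇ Q h)
      where
      p≤ : P t ≤ suc (2 * N)
      p≤ = m≤n⇒m≤1+n (*-monoʳ-≤ 2 (<⇒≤ (toℕ<n t)))
      q≤ : Q h ≤ suc (2 * N)
      q≤ = s≤s (*-monoʳ-≤ 2 (<⇒≤ (toℕ<n h)))
      linear : ∀ {x} → x ≤ suc (2 * N) → x ≤ bound
      linear x≤ = ≤-trans x≤ (m≤m+n _ _)
      go : ∀ w b → weightᵇ w b (P t) (Q h) ≤ bound
      go R1 true = s≤s z≤n
      go Rq true = linear q≤
      go Rp true = linear p≤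
      go D true = linear (≤-trans (m∸n≤m (Q h) (P t)) q≤)
      go Rpq true = *-mono-≤ p≤ q≤
      go Lpq true = z≤n
      go R1 false = z≤n
      go Rq false = z≤n
      go Rp false = z≤n
      go D false = z≤n
      go Rpq false = z≤n
      go Lpq false = *-mono-≤ p≤ q≤

    favoured : Bool → Node² × Node² → Node² × Node² → Node² × Node²
    favoured tw straight twisted = if tw then twisted else straight

    LexPair : List SignedWeight → Node² × Node² → Node² × Node² → Set
    LexPair ws = LexLess (map pair-total (map signed ws))

    negated-total : ∀ w a b → pair-total (signed (false , w)) (a , b)
                  ≡ (bound + bound) ∸ pair-total (signed (true , w)) (a , b)
    negated-total w (t , h) (t′ , h′) = ∸-pair (weight≤bound w t h) (weight≤bound w t′ h′)

    total≤bound : ∀ w a b → pair-total (signed (true , w)) (a , b) ≤ bound + bound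
    total≤bound w (t , h) (t′ , h′) = +-mono-≤ (weight≤bound w t h) (weight≤bound w t′ h′)

    -- Both sides consist of two arrows, so both totals are subtracted from the same constant.
    negate-< : ∀ w ((a , b) (c , d) : Node² × Node²) →
      pair-total (signed (true , w)) (a , b) < pair-total (signed (true , w)) (c , d) →
      pair-total (signed (false , w)) (c , d) < pair-total (signed (false , w)) (a , b)
    negate-< w (a , b) (c , d) lt =
      subst₂ _<_ (sym (negated-total w c d)) (sym (negated-total w a b)) (∸-monoʳ-< lt (total≤bound w c d))

    negate-≡ : ∀ w ((a , b) (c , d) : Node² × Node²) →
      pair-total (signed (true , w)) (a , b) ≡ pair-total (signed (true , w)) (c , d) →
      pair-total (signed (false , w)) (a , b) ≡ pair-total (signed (false , w)) (c , d)
    negate-≡ w (a , b) (c , d) eq =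
      ≡-trans (negated-total w a b) (≡-trans (cong ((bound + bound) ∸_) eq) (sym (negated-total w c d)))

    module _ (t t′ h h′ : Fin N) (t<t′ : P t < P t′) (h<h′ : Q h < Q h′) where
      private
        straight = (t , h) , (t′ , h′)
        twisted = (t , h′) , (t′ , h)
        k = kind (P t) (P t′) (Q h) (Q h′)
        view : KindView (P t) (P t′) (Q h) (Q h′) k
        view = kind-view t<t′ h<h′ (P≢Q t h) (P≢Q t h′) (P≢Q t′ h) (P≢Q t′ h′)

      -- `favours` only consults the table of effects. Here each entry becomes a comparison of
      -- actual totals, so that the finite check on kinds yields the order for all positions.
      favours-sound : ∀ ws tw → favours ws k tw ≡ true →
        LexPair ws (favoured tw straight twisted) (favoured (not tw) straight twisted)
      favours-sound ((s , w) ∷ ws) tw eq with effect w k | effect-holds w view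
      favours-sound ((true , w) ∷ ws) true eq | equal | e = inj₂ (sym e , favours-sound ws true eq)
      favours-sound ((true , w) ∷ ws) false eq | equal | e = inj₂ (e , favours-sound ws false eq)
      favours-sound ((false , w) ∷ ws) true eq | equal | e =
        inj₂ (negate-≡ w twisted straight (sym e) , favours-sound ws true eq)
      favours-sound ((false , w) ∷ ws) false eq | equal | e =
        inj₂ (negate-≡ w straight twisted e , favours-sound ws false eq)
      favours-sound ((true , w) ∷ ws) false eq | smaller | e = inj₁ e
      favours-sound ((false , w) ∷ ws) true eq | smaller | e = inj₁ (negate-< w straight twisted e)
      favours-sound ((true , w) ∷ ws) true eq | larger | e = inj₁ e
      favours-sound ((false , w) ∷ ws) false eq | larger | e = inj₁ (negate-< w twisted straight e)

      kind′-sorted : kind′ (P t) (P t′) (Q h) (Q h′) ≡ k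
      kind′-sorted
        rewrite m≤n⇒m⊓n≡m (<⇒≤ t<t′) | m≤n⇒m⊔n≡n (<⇒≤ t<t′)
              | m≤n⇒m⊓n≡m (<⇒≤ h<h′) | m≤n⇒m⊔n≡n (<⇒≤ h<h′) = refl

      okᵇ-straight : okᵇ B (P t) (Q h) (P t′) (Q h′) ≡ not (twist B k)
      okᵇ-straight rewrite kind′-sorted | <⇒<ᵇ≡true t<t′ | <⇒<ᵇ≡true h<h′ = refl

      okᵇ-twisted : okᵇ B (P t) (Q h′) (P t′) (Q h) ≡ twist B k
      okᵇ-twisted = ≡-trans (okᵇ-cross B (P t) (P t′) (<⇒≢ h<h′)) (≡-trans (cong not okᵇ-straight) (not-involutive _))

    LexPair-swap : ∀ ws a b c d → LexPair ws (a , b) (c , d) → LexPair ws (b , a) (d , c)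
    LexPair-swap (w ∷ ws) a b c d (inj₁ lt) =
      inj₁ (subst₂ _<_ (+-comm (signed w a) (signed w b)) (+-comm (signed w c) (signed w d)) lt)
    LexPair-swap (w ∷ ws) a b c d (inj₂ (eq , lt)) =
      inj₂ ( ≡-trans (+-comm (signed w b) (signed w a)) (≡-trans eq (+-comm (signed w c) (signed w d)))
           , LexPair-swap ws a b c d lt)

    P-cong : ∀ {t h t′ h′} → P t ≡ P t′ → Ok (t , h) (t′ , h′)
    P-cong {t} {h} {t′} eq with refl ← P-injective {t = t} {t′} eq = same-tail

    Q-cong : ∀ {t h t′ h′} → Q h ≡ Q h′ → Ok (t , h) (t′ , h′)
    Q-cong {h = h} {h′ = h′} eq with refl ← Q-injective {h = h} {h′} eq = same-head

    Ok-sym : ∀ {a b} → Ok a b → Ok b a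
    Ok-sym same-tail = same-tail
    Ok-sym same-head = same-head
    Ok-sym (compatible {t} {h} {t′} {h′} ok) with t ≟ᶠ t′ | h ≟ᶠ h′
    ... | yes refl | _ = same-tail
    ... | no _ | yes refl = same-head
    ... | no t≢ | no h≢ =
      compatible (≡-trans (okᵇ-comm B {P t} {P t′} {Q h} {Q h′} (t≢ ∘ P-injective) (h≢ ∘ Q-injective)) ok)

    Ok-distinct : ∀ {t h t′ h′} → t ≢ t′ → h ≢ h′ → Ok (t , h) (t′ , h′) →
      okᵇ B (P t) (Q h) (P t′) (Q h′) ≡ true
    Ok-distinct t≢ h≢ same-tail = contradiction refl t≢
    Ok-distinct t≢ h≢ same-head = contradiction refl h≢
    Ok-distinct t≢ h≢ (compatible ok) = ok

    Ok? : Decidable Ok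
    Ok? (t , h) (t′ , h′) with t ≟ᶠ t′ | h ≟ᶠ h′
    ... | yes refl | _ = yes same-tail
    ... | no _ | yes refl = yes same-head
    ... | no t≢ | no h≢ = map′ compatible (Ok-distinct t≢ h≢) (_ ≟ᵇ true)

    Ok-total : ∀ a b → Ok a b ⊎ Ok (cross a b) (cross b a)
    Ok-total (t , h) (t′ , h′) with h ≟ᶠ h′ | okᵇ B (P t) (Q h) (P t′) (Q h′) in eq
    ... | yes refl | _ = inj₁ same-head
    ... | no _ | true = inj₁ (compatible eq)
    ... | no h≢ | false =
      inj₂ (compatible (≡-trans (okᵇ-cross B (P t) (P t′) (h≢ ∘ Q-injective)) (cong not eq)))

    Ok-excl : ∀ {t h t′ h′} → Ok (t , h) (t′ , h′) → Ok (t , h′) (t′ , h) → t ≡ t′ ⊎ h ≡ h′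
    Ok-excl same-tail _ = inj₁ refl
    Ok-excl same-head _ = inj₂ refl
    Ok-excl (compatible _) same-tail = inj₁ refl
    Ok-excl (compatible _) same-head = inj₂ refl
    Ok-excl {t} {h} {t′} {h′} (compatible ok) (compatible ok′) with h ≟ᶠ h′
    ... | yes e = inj₂ e
    ... | no h≢ = contradiction
      (≡-trans (sym ok′) (≡-trans (okᵇ-cross B (P t) (P t′) (h≢ ∘ Q-injective)) (cong not ok))) λ ()

    module _ (v : valid B ≡ true) where

      twist-favoured : ∀ t t′ h h′ → P t < P t′ → Q h < Q h′ →
        let k = kind (P t) (P t′) (Q h) (Q h′)
            straight = (t , h) , (t′ , h′)
            twisted = (t , h′) , (t′ , h)
        in LexPair (weights B) (favoured (twist B k) straight twisted)
                               (favoured (not (twist B k)) straight twisted)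
      twist-favoured t t′ h h′ t<t′ h<h′ =
        favours-sound t t′ h h′ t<t′ h<h′ (weights B) _ (valid⇒favours B v _)

      -- An incompatible pair is the matching that `twist` rejects, whichever of h and h′ is
      -- smaller, so the cross pair is the favoured one.
      cross-favoured-< : ∀ {t h t′ h′} → P t < P t′ → ¬ Ok (t , h) (t′ , h′) →
        LexPair (weights B) ((t , h′) , (t′ , h)) ((t , h) , (t′ , h′))
      cross-favoured-< {t} {h} {t′} {h′} t<t′ ¬ok with <-cmp (Q h) (Q h′)
      ... | tri≈ _ e _ = contradiction (Q-cong e) ¬ok
      ... | tri< h<h′ _ _ with twist B (kind (P t) (P t′) (Q h) (Q h′)) in eq | twist-favoured t t′ h h′ t<t′ h<h′
      ...   | true | lex = lex
      ...   | false | _ = contradiction (compatible (≡-trans (okᵇ-straight t t′ h h′ t<t′ h<h′) (cong not eq))) ¬ok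
      cross-favoured-< {t} {h} {t′} {h′} t<t′ ¬ok | tri> _ _ h′<h
        with twist B (kind (P t) (P t′) (Q h′) (Q h)) in eq | twist-favoured t t′ h′ h t<t′ h′<h
      ...   | false | lex = lex
      ...   | true | _ = contradiction (compatible (≡-trans (okᵇ-twisted t t′ h′ h t<t′ h′<h) eq)) ¬ok

      cross-favoured : ∀ a b → ¬ Ok a b → LexPair (weights B) (cross a b , cross b a) (a , b)
      cross-favoured (t , h) (t′ , h′) ¬ok with <-cmp (P t) (P t′)
      ... | tri≈ _ e _ = contradiction (P-cong e) ¬ok
      ... | tri< t<t′ _ _ = cross-favoured-< t<t′ ¬ok
      ... | tri> _ _ t′<t = LexPair-swap (weights B) _ _ _ _ (cross-favoured-< t′<t (¬ok ∘ Ok-sym))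

      swapSystem : SwapSystem (Fin N) (Fin N)
      swapSystem = record
        { _≟ᴬ_ = _≟ᶠ_
        ; _≟ᴮ_ = _≟ᶠ_
        ; Ok = Ok
        ; ok? = Ok?
        ; ok-sym = Ok-sym
        ; ok-tail = same-tail
        ; ok-head = same-head
        ; ok-total = Ok-total
        ; ok-excl = Ok-excl
        ; no-hexagon = λ {t₁} {t₂} {t₃} {h₁} {h₂} {h₃} t₁₂ t₁₃ t₂₃ h₁₂ h₁₃ h₂₃ x₁₂ x₁₃ x₂₃ y₁₂ y₁₃ y₂₃ →
            no-hexagonᵇ B v (P≢Q t₁ h₁) (P≢Q t₁ h₂) (P≢Q t₁ h₃) (P≢Q t₂ h₁) (P≢Q t₂ h₂) (P≢Q t₂ h₃)
              (P≢Q t₃ h₁) (P≢Q t₃ h₂) (P≢Q t₃ h₃)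
              (t₁₂ ∘ P-injective) (t₁₃ ∘ P-injective) (t₂₃ ∘ P-injective)
              (h₁₂ ∘ Q-injective) (h₁₃ ∘ Q-injective) (h₂₃ ∘ Q-injective)
              (Ok-distinct t₁₂ h₁₂ x₁₂) (Ok-distinct t₁₃ h₁₃ x₁₃) (Ok-distinct t₂₃ h₂₃ x₂₃)
              (Ok-distinct t₁₂ h₂₃ y₁₂) (Ok-distinct t₁₃ (h₁₂ ∘ sym) y₁₃)
              (Ok-distinct t₂₃ (h₁₃ ∘ sym) y₂₃)
        ; _≺_ = LexLess (map total (map signed (weights B)))
        ; ≺-wellFounded = LexLess-wellFounded _
        ; ≺-swap = λ {_} {_} {a} {b} p ¬ok q →
            LexLess-total (map signed (weights B)) q p (cross-favoured a b ¬ok)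
        }

-- Rational weights as multiplicities: points as barycentres of multisets of arrows.

module Barycentres where

  open import Data.Nat as ℕ using (ℕ; zero; suc)
  import Data.Nat.Properties as ℕₚ
  open import Data.Integer as ℤ using (-[1+_])
  import Data.Integer.Properties as ℤₚ
  open import Data.Rational as ℚ
    using (ℚ; mkℚ; 0ℚ; 1ℚ; _+_; _*_; -_; 1/_; Positive; positive; nonNegative; ↥_; ↧ₙ_)
    renaming (_≤_ to _≤ℚ_; _<_ to _<ℚ_)
  import Data.Rational.Properties as ℚₚ
  open import Data.Rational.Solver using (module +-*-Solver)
  import Data.Rational.Unnormalised as ℚᵘ
  import Data.Rational.Unnormalised.Properties as ℚᵘₚ
  open import Data.List using (List; []; _∷_; map; length; _++_; replicate)
  open import Data.List.Properties using (length-map; length-replicate; length-++)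
  open import Data.List.Membership.Propositional using (_∈_)
  open import Data.List.Membership.Propositional.Properties using (∈-++⁻)
  open import Data.List.Relation.Unary.Any using (here; there)
  open import Data.List.Relation.Binary.Subset.Propositional using (_⊆_)
  open import Data.List.Relation.Unary.All.Properties using (replicate⁺)
  open import Data.List.Relation.Unary.All as All using (All; []; _∷_)
  open import Data.Product using (_×_; _,_; ∃-syntax)
  open import Data.Sum using (_⊎_; inj₁; inj₂)
  open import Relation.Nullary using (contradiction)
  open import Relation.Binary.PropositionalEquality
  open +-*-Solver using (solve; _:+_; _:*_; :-_; _:=_; con)

  ι : ℕ → ℚ
  ι zero = 0ℚ
  ι (suc k) = 1ℚ + ι k

  ι-+ : ∀ m n → ι (m ℕ.+ n) ≡ ι m + ι n
  ι-+ zero n = sym (ℚₚ.+-identityˡ (ι n))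
  ι-+ (suc m) n = trans (cong (1ℚ +_) (ι-+ m n)) (sym (ℚₚ.+-assoc 1ℚ (ι m) (ι n)))

  ι-* : ∀ m n → ι (m ℕ.* n) ≡ ι m * ι n
  ι-* zero n = sym (ℚₚ.*-zeroˡ (ι n))
  ι-* (suc m) n = trans (ι-+ n (m ℕ.* n)) (trans (cong (ι n +_) (ι-* m n))
    (solve 2 (λ x y → y :+ x :* y := (con 1ℚ :+ x) :* y) refl (ι m) (ι n)))

  ι-nonNeg : ∀ k → 0ℚ ≤ℚ ι k
  ι-nonNeg zero = ℚₚ.≤-refl
  ι-nonNeg (suc k) = ℚₚ.≤-trans (ι-nonNeg k)
    (subst (_≤ℚ 1ℚ + ι k) (ℚₚ.+-identityˡ (ι k)) (ℚₚ.+-monoˡ-≤ (ι k) (ℚₚ.nonNegative⁻¹ 1ℚ)))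

  ι-pos : ∀ k → 0ℚ <ℚ ι (suc k)
  ι-pos k = ℚₚ.<-≤-trans (ℚₚ.positive⁻¹ 1ℚ)
    (subst (_≤ℚ 1ℚ + ι k) (ℚₚ.+-identityʳ 1ℚ) (ℚₚ.+-monoʳ-≤ 1ℚ (ι-nonNeg k)))

  ι-injective : ∀ {m n} → ι m ≡ ι n → m ≡ n
  ι-injective {zero} {zero} eq = refl
  ι-injective {zero} {suc n} eq = contradiction eq (ℚₚ.<⇒≢ (ι-pos n))
  ι-injective {suc m} {zero} eq = contradiction (sym eq) (ℚₚ.<⇒≢ (ι-pos m))
  ι-injective {suc m} {suc n} eq = cong suc (ι-injective (ℚ-cancel eq))
    where
    ℚ-cancel : 1ℚ + ι m ≡ 1ℚ + ι n → ι m ≡ ι n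
    ℚ-cancel e = trans (shift (ι m)) (trans (cong (- 1ℚ +_) e) (sym (shift (ι n))))
      where
      shift : ∀ x → x ≡ - 1ℚ + (1ℚ + x)
      shift = solve 1 (λ x → x := :- con 1ℚ :+ (con 1ℚ :+ x)) refl

  -- Addition in ℚ renormalises fractions, so equations about denominators are checked on
  -- unnormalised ones.
  toℚᵘ-ι : ∀ k → ℚ.toℚᵘ (ι k) ℚᵘ.≃ ℚᵘ.mkℚᵘ (ℤ.+ k) 0
  toℚᵘ-ι zero = ℚᵘ.*≡* refl
  toℚᵘ-ι (suc k) = ℚᵘₚ.≃-trans (ℚₚ.toℚᵘ-homo-+ 1ℚ (ι k))
    (ℚᵘₚ.≃-trans (ℚᵘₚ.+-congʳ ℚᵘ.1ℚᵘ (toℚᵘ-ι k))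
      (ℚᵘ.*≡* (cong (ℤ._* ℤ.+ 1) (cong₂ ℤ._+_ {ℤ.+ 1} refl (ℤₚ.*-identityʳ (ℤ.+ k))))))

  denominator-clears : ∀ w n → ↥ w ≡ ℤ.+ n → ι (↧ₙ w) * w ≡ ι n
  denominator-clears w@(mkℚ (ℤ.+ n) d c) n refl = ℚₚ.toℚᵘ-injective
    (ℚᵘₚ.≃-trans (ℚₚ.toℚᵘ-homo-* (ι (suc d)) w)
      (ℚᵘₚ.≃-trans (ℚᵘₚ.*-congʳ {ℚ.toℚᵘ w} (toℚᵘ-ι (suc d)))
        (ℚᵘₚ.≃-trans (ℚᵘ.*≡* (trans (ℤₚ.*-identityʳ _)
            (trans (ℤₚ.*-comm (ℤ.+ suc d) (ℤ.+ n))
              (cong (λ z → ℤ.+ n ℤ.* ℤ.+ suc z) (sym (ℕₚ.+-identityʳ d))))))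
          (ℚᵘₚ.≃-sym (toℚᵘ-ι n)))))

  -- The equation D w = p - q in natural numbers. Affine dependences have weights of both signs,
  -- hence the part q; by disjointness p = q forces both to vanish.
  record Entry (D : ℕ) (w : ℚ) (p q : ℕ) : Set where
    constructor mkEntry
    field
      scaled : ι D * w + ι q ≡ ι p
      disjoint : p ≡ 0 ⊎ q ≡ 0

  -- D ws = ps − qs, where ps and qs have disjoint supports.
  data Scaled (D : ℕ) : List ℚ → List ℕ → List ℕ → Set where
    [] : Scaled D [] [] []
    _∷_ : ∀ {w p q ws ps qs} → Entry D w p q → Scaled D ws ps qs → Scaled D (w ∷ ws) (p ∷ ps) (q ∷ qs)

  entry : ∀ w → ∃[ p ] ∃[ q ] Entry (↧ₙ w) w p q
  entry w@(mkℚ (ℤ.+ n) d c) = n , 0 ,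
    mkEntry (trans (ℚₚ.+-identityʳ _) (denominator-clears w n refl)) (inj₂ refl)
  entry w@(mkℚ -[1+ n ] d c) = 0 , suc n , mkEntry
    (trans (cong (ι (suc d) * w +_) (sym (denominator-clears (- w) (suc n) refl)))
      (solve 2 (λ x y → x :* y :+ x :* (:- y) := con 0ℚ) refl (ι (suc d)) w)) (inj₁ refl)

  Entry-scale : ∀ m {D w p q} → Entry D w p q → Entry (m ℕ.* D) w (m ℕ.* p) (m ℕ.* q)
  Entry-scale m {D} {w} {p} {q} (mkEntry eq z) = mkEntry eq′ (zero-scale z)
    where
    zero-scale : p ≡ 0 ⊎ q ≡ 0 → m ℕ.* p ≡ 0 ⊎ m ℕ.* q ≡ 0
    zero-scale (inj₁ refl) = inj₁ (ℕₚ.*-zeroʳ m)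
    zero-scale (inj₂ refl) = inj₂ (ℕₚ.*-zeroʳ m)
    eq′ : ι (m ℕ.* D) * w + ι (m ℕ.* q) ≡ ι (m ℕ.* p)
    eq′ rewrite ι-* m D | ι-* m q | ι-* m p =
      trans (solve 4 (λ m D w q → m :* D :* w :+ m :* q := m :* (D :* w :+ q)) refl (ι m) (ι D) w (ι q))
            (cong (ι m *_) eq)

  Scaled-scale : ∀ m {D ws ps qs} → Scaled D ws ps qs →
    Scaled (m ℕ.* D) ws (map (m ℕ.*_) ps) (map (m ℕ.*_) qs)
  Scaled-scale m [] = []
  Scaled-scale m (e ∷ s) = Entry-scale m e ∷ Scaled-scale m s

  clear-denominators : ∀ ws → ∃[ D ] ∃[ ps ] ∃[ qs ] Scaled (suc D) ws ps qs
  clear-denominators [] = 0 , [] , [] , []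
  clear-denominators (w ∷ ws) with entry w | clear-denominators ws
  ... | p , q , e | D , ps , qs , s =
    _ , _ , _ , subst (λ d → Entry d w (suc D ℕ.* p) (suc D ℕ.* q)) (ℕₚ.*-comm (suc D) (↧ₙ w)) (Entry-scale (suc D) e)
                ∷ Scaled-scale (↧ₙ w) s

  expand : ∀ {X : Set} → List ℕ → List X → List X
  expand (p ∷ ps) (a ∷ F) = replicate p a ++ expand ps F
  expand _ _ = []

  +-nonNeg-zero : ∀ {x y} → 0ℚ ≤ℚ x → 0ℚ ≤ℚ y → x + y ≡ 0ℚ → y ≡ 0ℚ
  +-nonNeg-zero {x} {y} 0≤x 0≤y eq = ℚₚ.≤-antisym
    (subst₂ _≤ℚ_ (ℚₚ.+-identityˡ y) eq (ℚₚ.+-monoˡ-≤ y 0≤x)) 0≤y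

  ι-*-nonNeg : ∀ D {w} → 0ℚ ≤ℚ w → 0ℚ ≤ℚ ι D * w
  ι-*-nonNeg D {w} 0≤w = subst (_≤ℚ ι D * w) (ℚₚ.*-zeroʳ (ι D))
    (ℚₚ.*-monoˡ-≤-nonNeg (ι D) {{nonNegative (ι-nonNeg D)}} 0≤w)

  nonNeg-entry : ∀ {D w p q} → 0ℚ ≤ℚ w → Entry D w p q → q ≡ 0
  nonNeg-entry _ (mkEntry _ (inj₂ eq)) = eq
  nonNeg-entry {D} {q = q} 0≤w (mkEntry e (inj₁ refl)) =
    ι-injective (+-nonNeg-zero (ι-*-nonNeg D 0≤w) (ι-nonNeg q) e)

  reciprocal : ∀ m → m ≢ 0 → ∃[ r ] (0ℚ ≤ℚ r × ι m * r ≡ 1ℚ)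
  reciprocal zero m≢0 = contradiction refl m≢0
  reciprocal (suc m) _ = 1/ι , ℚₚ.<⇒≤ (ℚₚ.positive⁻¹ 1/ι {{ℚₚ.1/pos⇒pos (ι (suc m)) {{pos}}}})
    , ℚₚ.*-inverseʳ (ι (suc m)) {{nz}}
    where
    pos : Positive (ι (suc m))
    pos = positive (ι-pos m)
    nz = ℚₚ.pos⇒nonZero (ι (suc m)) {{pos}}
    1/ι = (1/ ι (suc m)) {{nz}}

  module _ {n : ℕ} where

    S : List (Arrow n) → Point n
    S [] k = 0ℚ
    S (a ∷ l) k = vert a k + S l k

    S-++ : ∀ l m k → S (l ++ m) k ≡ S l k + S m k
    S-++ [] m k = sym (ℚₚ.+-identityˡ (S m k))
    S-++ (a ∷ l) m k = trans (cong (vert a k +_) (S-++ l m k)) (sym (ℚₚ.+-assoc (vert a k) (S l k) (S m k)))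

    S-replicate : ∀ p a k → S (replicate p a) k ≡ ι p * vert a k
    S-replicate zero a k = sym (ℚₚ.*-zeroˡ (vert a k))
    S-replicate (suc p) a k = trans (cong (vert a k +_) (S-replicate p a k))
      (solve 2 (λ v p → v :+ p :* v := (con 1ℚ :+ p) :* v) refl (vert a k) (ι p))

    lincomb-expand : ∀ {D ws ps qs} → Scaled D ws ps qs → ∀ F → length ws ≡ length F → ∀ k →
      ι D * lincomb ws (map vert F) k + S (expand qs F) k ≡ S (expand ps F) k
    lincomb-expand {D} [] [] eq k = trans (ℚₚ.+-identityʳ _) (ℚₚ.*-zeroʳ (ι D))
    lincomb-expand {D} (_∷_ {w} {p} {q} {ws} {ps} {qs} (mkEntry e _) s) (a ∷ F) eq k
      rewrite S-++ (replicate q a) (expand qs F) k | S-++ (replicate p a) (expand ps F) k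
            | S-replicate q a k | S-replicate p a k
            | sym (lincomb-expand s F (ℕₚ.suc-injective eq) k) | sym e =
      solve 6 (λ D w v L q s → D :* (w :* v :+ L) :+ (q :* v :+ s) := (D :* w :+ q) :* v :+ (D :* L :+ s))
        refl (ι D) w (vert a k) (lincomb ws (map vert F) k) (ι q) (S (expand qs F) k)

    sum-expand : ∀ {D ws ps qs} → Scaled D ws ps qs → ∀ (F : List (Arrow n)) → length ws ≡ length F →
      ι D * sumℚ ws + ι (length (expand qs F)) ≡ ι (length (expand ps F))
    sum-expand {D} [] [] eq = trans (ℚₚ.+-identityʳ _) (ℚₚ.*-zeroʳ (ι D))
    sum-expand {D} (_∷_ {w} {p} {q} {ws} {ps} {qs} (mkEntry e _) s) (a ∷ F) eq
      rewrite length-++ (replicate q a) {expand qs F} | length-++ (replicate p a) {expand ps F}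
            | length-replicate q {a} | length-replicate p {a}
            | ι-+ q (length (expand qs F)) | ι-+ p (length (expand ps F))
            | sym (sum-expand s F (ℕₚ.suc-injective eq)) | sym e =
      solve 5 (λ D w L q s → D :* (w :+ L) :+ (q :+ s) := (D :* w :+ q) :+ (D :* L :+ s))
        refl (ι D) w (sumℚ ws) (ι q) (ι (length (expand qs F)))

    expand-⊆ : ∀ ps (F : List (Arrow n)) → expand ps F ⊆ F
    expand-⊆ [] F ()
    expand-⊆ (p ∷ ps) [] ()
    expand-⊆ (p ∷ ps) (a ∷ F) x∈ with ∈-++⁻ (replicate p a) x∈
    ... | inj₁ x∈a = here (∈-replicate p x∈a)
      where
      ∈-replicate : ∀ {x} p → x ∈ replicate p a → x ≡ a
      ∈-replicate (suc p) (here eq) = eq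
      ∈-replicate (suc p) (there y) = ∈-replicate p y
    ... | inj₂ x∈F = there (expand-⊆ ps F x∈F)

    nonNeg-expand : ∀ {D ws ps qs} → Scaled D ws ps qs → All (0ℚ ≤ℚ_) ws → ∀ F → expand {Arrow n} qs F ≡ []
    nonNeg-expand [] _ F = refl
    nonNeg-expand (_ ∷ _) _ [] = refl
    nonNeg-expand {D} (_∷_ {w} {p} {q} e s) (0≤w ∷ 0≤ws) (a ∷ F)
      with refl ← nonNeg-entry 0≤w e = nonNeg-expand s 0≤ws F

    Barycentre : List (Arrow n) → Point n → Set
    Barycentre l x = ∀ k → ι (length l) * x k ≡ S l k

    NonEmpty : List (Arrow n) → Set
    NonEmpty l = length l ≢ 0

    -- Nonnegative weights have no negative part, and as they sum to 1, the length of the expanded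
    -- list is exactly the common denominator.
    hull⇒barycentre : ∀ F {x} → hull F x → ∃[ l ] (l ⊆ F × NonEmpty l × Barycentre l x)
    hull⇒barycentre F {x} (ws , len , 0≤ws , sum≡1 , x≡) with clear-denominators ws
    ... | D , ps , qs , s = l , expand-⊆ ps F , nonEmpty , barycentre
      where
      l = expand ps F
      len′ : length ws ≡ length F
      len′ = trans len (length-map vert F)
      ι-length : ι (suc D) ≡ ι (length l)
      ι-length = begin
        ι (suc D)                                            ≡⟨ sym (ℚₚ.*-identityʳ _) ⟩
        ι (suc D) * 1ℚ                                       ≡⟨ cong (ι (suc D) *_) (sym sum≡1) ⟩
        ι (suc D) * sumℚ ws                                  ≡⟨ sym (ℚₚ.+-identityʳ _) ⟩
        ι (suc D) * sumℚ ws + ι (length {A = Arrow n} [])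
          ≡⟨ cong (λ m → ι (suc D) * sumℚ ws + ι (length m)) (sym (nonNeg-expand s 0≤ws F)) ⟩
        ι (suc D) * sumℚ ws + ι (length (expand qs F))       ≡⟨ sum-expand s F len′ ⟩
        ι (length l)                                         ∎
        where open ≡-Reasoning
      nonEmpty : NonEmpty l
      nonEmpty eq = contradiction (ι-injective {suc D} {0} (trans ι-length (cong ι eq))) λ ()
      barycentre : Barycentre l x
      barycentre k = begin
        ι (length l) * x k                                      ≡⟨ cong₂ _*_ (sym ι-length) (x≡ k) ⟩
        ι (suc D) * lincomb ws (map vert F) k                   ≡⟨ sym (ℚₚ.+-identityʳ _) ⟩
        ι (suc D) * lincomb ws (map vert F) k + S [] k
          ≡⟨ cong (λ m → ι (suc D) * lincomb ws (map vert F) k + S m k) (sym (nonNeg-expand s 0≤ws F)) ⟩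
        ι (suc D) * lincomb ws (map vert F) k + S (expand qs F) k ≡⟨ lincomb-expand s F len′ k ⟩
        S l k                                                   ∎
        where open ≡-Reasoning

    module _ (r : ℚ) where

      lincomb-replicate : ∀ l k → lincomb (replicate (length l) r) (map vert l) k ≡ r * S l k
      lincomb-replicate [] k = sym (ℚₚ.*-zeroʳ r)
      lincomb-replicate (a ∷ l) k = trans (cong (r * vert a k +_) (lincomb-replicate l k))
        (sym (ℚₚ.*-distribˡ-+ r (vert a k) (S l k)))

      sum-replicate : ∀ m → sumℚ (replicate m r) ≡ ι m * r
      sum-replicate zero = sym (ℚₚ.*-zeroˡ r)
      sum-replicate (suc m) = trans (cong (r +_) (sum-replicate m))
        (solve 2 (λ r m → r :+ m :* r := (con 1ℚ :+ m) :* r) refl r (ι m))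

    -- Every entry gets the weight 1 / length; the copies of a repeated arrow add up.
    barycentre⇒hull : ∀ l {x} → NonEmpty l → Barycentre l x → hull l x
    barycentre⇒hull l {x} l≢[] bary with r , 0≤r , inv ← reciprocal (length l) l≢[] =
      replicate (length l) r
      , trans (length-replicate (length l)) (sym (length-map vert l))
      , replicate⁺ (length l) 0≤r
      , trans (sum-replicate r (length l)) inv
      , λ k → begin
          x k                       ≡⟨ sym (ℚₚ.*-identityˡ (x k)) ⟩
          1ℚ * x k                  ≡⟨ cong (_* x k) (sym inv) ⟩
          ι (length l) * r * x k    ≡⟨ solve 3 (λ m r x → m :* r :* x := r :* (m :* x)) refl (ι (length l)) r (x k) ⟩
          r * (ι (length l) * x k)  ≡⟨ cong (r *_) (bary k) ⟩
          r * S l k                 ≡⟨ sym (lincomb-replicate r l k) ⟩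
          lincomb (replicate (length l) r) (map vert l) k ∎
      where
      open ≡-Reasoning

    -- Admissibility without the sets I and J.
    Alternating : List (Arrow n) → Set
    Alternating l = ∀ {a b} → a ∈ l → b ∈ l → tail a ≢ head b

-- Recovering tails and heads from a point; linear functionals on arrows.

module Endpoints where

  open Swaps using (∈⇒↭∷; ∈-∷⁻)
  open Barycentres
  open import Data.Bool using (if_then_else_)
  open import Data.Nat as ℕ using (ℕ; zero; suc)
  import Data.Nat.Properties as ℕₚ
  open import Data.Nat.ListAction using (sum)
  open import Data.Nat.ListAction.Properties using (sum-↭)
  open import Data.Fin using (Fin; _≟_)
  open import Data.Rational as ℚ using (ℚ; 0ℚ; 1ℚ; _+_; _*_; -_) renaming (_≤_ to _≤ℚ_)
  import Data.Rational.Properties as ℚₚ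
  open import Data.Rational.Solver using (module +-*-Solver)
  open import Data.List using (List; []; _∷_; map; length; _++_; foldr; allFin)
  open import Data.List.Properties using (length-++; map-injective)
  open import Data.List.Membership.Propositional using (_∈_)
  open import Data.List.Membership.Propositional.Properties using (∈-++⁻; ∈-map⁻; ∈-allFin)
  open import Data.List.Relation.Unary.Any as Any using (here; there)
  open import Data.List.Relation.Binary.Subset.Propositional using (_⊆_)
  open import Data.List.Relation.Unary.All as All using (All; []; _∷_)
  open import Data.List.Relation.Unary.AllPairs using ([]; _∷_)
  open import Data.List.Relation.Unary.Unique.Propositional using (Unique)
  open import Data.List.Relation.Unary.Unique.Propositional.Properties using (allFin⁺)
  open import Data.List.Relation.Binary.Permutation.Propositional
    using (_↭_; refl; prep; ↭-sym; ↭-reflexive)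
    renaming (trans to ↭-trans)
  open import Data.List.Relation.Binary.Permutation.Propositional.Properties using (map⁺; ↭-map-inv)
  open import Data.Product using (_×_; _,_; proj₁; proj₂; ∃-syntax)
  open import Data.Sum using (_⊎_; inj₁; inj₂)
  open import Data.Empty using (⊥-elim-irr)
  open import Function using (_∘_)
  open import Relation.Binary.Definitions using (tri<; tri≈; tri>)
  open import Relation.Nullary using (¬_; yes; no; contradiction; does)
  open import Relation.Binary.PropositionalEquality
  open +-*-Solver using (solve; _:+_; _:*_; :-_; _:=_; con)

  private
    variable
      n : ℕ

  tail≢head : (a : Arrow n) → tail a ≢ head a
  tail≢head (arr t h t≢h) t≡h = ⊥-elim-irr (t≢h t≡h)

  pr : Arrow n → Node n × Node n
  pr a = tail a , head a

  pr-injective : ∀ {a b : Arrow n} → pr a ≡ pr b → a ≡ b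
  pr-injective {a = arr t h _} {arr .t .h _} refl = refl

  flow : List (Arrow n) → List (Node n × Node n)
  flow = map pr

  indicator : Fin n → Fin n → ℕ
  indicator k x = if does (k ≟ x) then 1 else 0

  count : Fin n → List (Fin n) → ℕ
  count k xs = sum (map (indicator k) xs)

  count-↭ : ∀ (k : Fin n) {xs ys} → xs ↭ ys → count k xs ≡ count k ys
  count-↭ k p = sum-↭ (map⁺ (indicator k) p)

  count>0⇒∈ : ∀ (k : Fin n) xs → count k xs ≢ 0 → k ∈ xs
  count>0⇒∈ k [] c≢0 = contradiction refl c≢0
  count>0⇒∈ k (x ∷ xs) c≢0 with k ≟ x
  ... | yes k≡x = here k≡x
  ... | no _ = there (count>0⇒∈ k xs c≢0)

  ∈⇒count>0 : ∀ {k : Fin n} {xs} → k ∈ xs → count k xs ≢ 0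
  ∈⇒count>0 {k = k} {x ∷ xs} k∈ eq with k ≟ x
  ∈⇒count>0 {k = k} {x ∷ xs} k∈ () | yes _
  ... | no k≢x with k∈
  ...   | here k≡x = k≢x k≡x
  ...   | there k∈xs = ∈⇒count>0 k∈xs eq

  counts⇒↭ : ∀ (xs ys : List (Fin n)) → (∀ k → count k xs ≡ count k ys) → xs ↭ ys
  counts⇒↭ [] [] _ = refl
  counts⇒↭ [] (y ∷ ys) eq = contradiction (sym (eq y)) (∈⇒count>0 {xs = y ∷ ys} (here refl))
  counts⇒↭ (x ∷ xs) ys eq
    with zs , p ← ∈⇒↭∷ (count>0⇒∈ x ys (λ c≡0 → ∈⇒count>0 {xs = x ∷ xs} (here refl) (trans (eq x) c≡0))) =
    ↭-trans (prep x (counts⇒↭ xs zs λ k → ℕₚ.+-cancelˡ-≡ (indicator k x) _ _ (trans (eq k) (count-↭ k p))))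
            (↭-sym p)

  vert-indicator : ∀ (a : Arrow n) k → vert a k + ι (indicator k (tail a)) ≡ ι (indicator k (head a))
  vert-indicator a k with k ≟ head a | k ≟ tail a
  ... | yes refl | yes k≡t = contradiction (sym k≡t) (tail≢head a)
  ... | yes _ | no _ = refl
  ... | no _ | yes _ = refl
  ... | no _ | no _ = refl

  S-count : ∀ (l : List (Arrow n)) k → S l k + ι (count k (map tail l)) ≡ ι (count k (map head l))
  S-count [] k = refl
  S-count (a ∷ l) k
    rewrite ι-+ (indicator k (tail a)) (count k (map tail l)) | ι-+ (indicator k (head a)) (count k (map head l))
          | sym (vert-indicator a k) | sym (S-count l k) =
    solve 4 (λ v s i c → (v :+ s) :+ (i :+ c) := (v :+ i) :+ (s :+ c)) refl
      (vert a k) (S l k) (ι (indicator k (tail a))) (ι (count k (map tail l)))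

  +-cancelʳ : ∀ {x y} z → x + z ≡ y + z → x ≡ y
  +-cancelʳ {x} {y} z eq = trans (lemma x z) (trans (cong (_+ - z) eq) (sym (lemma y z)))
    where
    lemma : ∀ x z → x ≡ x + z + - z
    lemma = solve 2 (λ x z → x := x :+ z :+ :- z) refl

  S-ends : ∀ (l m : List (Arrow n)) → map tail l ↭ map tail m → map head l ↭ map head m → ∀ k → S l k ≡ S m k
  S-ends l m p q k = +-cancelʳ (ι (count k (map tail l)))
    (trans (S-count l k) (trans (cong ι (count-↭ k q))
      (trans (sym (S-count m k)) (cong (λ c → S m k + ι c) (sym (count-↭ k p))))))

  alternating-count : ∀ (l : List (Arrow n)) → Alternating l → ∀ k →
    count k (map tail l) ≡ 0 ⊎ count k (map head l) ≡ 0
  alternating-count l alt k with count k (map tail l) ℕₚ.≟ 0 | count k (map head l) ℕₚ.≟ 0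
  ... | yes e | _ = inj₁ e
  ... | no _ | yes e = inj₂ e
  ... | no t≢0 | no h≢0
    with a , a∈ , refl ← ∈-map⁻ tail (count>0⇒∈ k (map tail l) t≢0)
    with b , b∈ , e ← ∈-map⁻ head (count>0⇒∈ k (map head l) h≢0) = contradiction e (alt a∈ b∈)

  counts-cancel : ∀ {a b c d} → a ℕ.+ d ≡ c ℕ.+ b → b ≡ 0 ⊎ a ≡ 0 → d ≡ 0 ⊎ c ≡ 0 → b ≡ d × a ≡ c
  counts-cancel {a} {c = c} eq (inj₁ refl) (inj₁ refl) =
    refl , trans (sym (ℕₚ.+-identityʳ a)) (trans eq (ℕₚ.+-identityʳ c))
  counts-cancel {a} {d = d} eq (inj₁ refl) (inj₂ refl) =
    sym (ℕₚ.m+n≡0⇒n≡0 a eq) , ℕₚ.m+n≡0⇒m≡0 a eq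
  counts-cancel {b = b} {c = c} eq (inj₂ refl) (inj₁ refl) =
    ℕₚ.m+n≡0⇒n≡0 c (sym eq) , sym (ℕₚ.m+n≡0⇒m≡0 c (sym eq))
  counts-cancel eq (inj₂ refl) (inj₂ refl) = sym eq , refl

  module _ (l m : List (Arrow n)) (alt-l : Alternating l) (alt-m : Alternating m)
           (eq : ∀ k → S l k ≡ S m k) where

    -- The sums give only the difference of heads and tails at k. As l and m alternate, one of the
    -- two counts vanishes in each list, and the difference determines both.
    ends-counts : ∀ k → count k (map tail l) ≡ count k (map tail m) × count k (map head l) ≡ count k (map head m)
    ends-counts k = counts-cancel (ι-injective ι-eq) (alternating-count l alt-l k) (alternating-count m alt-m k)
      where
      ι-eq : ι (count k (map head l) ℕ.+ count k (map tail m)) ≡ ι (count k (map head m) ℕ.+ count k (map tail l))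
      ι-eq rewrite ι-+ (count k (map head l)) (count k (map tail m))
                 | ι-+ (count k (map head m)) (count k (map tail l))
                 | sym (S-count l k) | sym (S-count m k) | eq k =
        solve 3 (λ s t t′ → s :+ t :+ t′ := s :+ t′ :+ t) refl
          (S m k) (ι (count k (map tail l))) (ι (count k (map tail m)))

    tails-↭ : map tail l ↭ map tail m
    tails-↭ = counts⇒↭ _ _ (proj₁ ∘ ends-counts)

    heads-↭ : map head l ↭ map head m
    heads-↭ = counts⇒↭ _ _ (proj₂ ∘ ends-counts)

  flow-↭⁻ : ∀ {l m : List (Arrow n)} → flow l ↭ flow m → l ↭ m
  flow-↭⁻ {l = l} p with l′ , eq , q ← ↭-map-inv pr p =
    ↭-trans q (↭-reflexive (map-injective pr-injective (sym eq)))

  -- Two multisets with the same barycentre may differ in size; repeating each as often as the other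
  -- has entries equalises their sums.
  repeat : ∀ {X : Set} → ℕ → List X → List X
  repeat zero l = []
  repeat (suc m) l = l ++ repeat m l

  repeat-⊆ : ∀ {X : Set} m (l : List X) → repeat m l ⊆ l
  repeat-⊆ (suc m) l x∈ with ∈-++⁻ l x∈
  ... | inj₁ x∈l = x∈l
  ... | inj₂ x∈r = repeat-⊆ m l x∈r

  length-repeat : ∀ {X : Set} m (l : List X) → length (repeat m l) ≡ m ℕ.* length l
  length-repeat zero l = refl
  length-repeat (suc m) l = trans (length-++ l) (cong (length l ℕ.+_) (length-repeat m l))

  S-repeat : ∀ m (l : List (Arrow n)) k → S (repeat m l) k ≡ ι m * S l k
  S-repeat zero l k = sym (ℚₚ.*-zeroˡ (S l k))
  S-repeat (suc m) l k = trans (S-++ l (repeat m l) k) (trans (cong (S l k +_) (S-repeat m l k))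
    (solve 2 (λ s m → s :+ m :* s := (con 1ℚ :+ m) :* s) refl (S l k) (ι m)))

  barycentre-repeat : ∀ m (l : List (Arrow n)) {x} → Barycentre l x → Barycentre (repeat m l) x
  barycentre-repeat m l {x} bary k
    rewrite length-repeat m l | ι-* m (length l) | S-repeat m l k | sym (bary k) = ℚₚ.*-assoc (ι m) (ι (length l)) (x k)

  repeat-S : ∀ (l m : List (Arrow n)) {x} → Barycentre l x → Barycentre m x → ∀ k →
    S (repeat (length m) l) k ≡ S (repeat (length l) m) k
  repeat-S l m {x} bl bm k rewrite S-repeat (length m) l k | S-repeat (length l) m k | sym (bl k) | sym (bm k) =
    solve 3 (λ a b x → a :* (b :* x) := b :* (a :* x)) refl (ι (length m)) (ι (length l)) (x k)

  NonEmpty⇒∈ : ∀ (l : List (Arrow n)) → NonEmpty l → ∃[ a ] a ∈ l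
  NonEmpty⇒∈ [] ne = contradiction refl ne
  NonEmpty⇒∈ (a ∷ l) ne = a , here refl

  -- This is `dot` with the list of nodes as a parameter, for induction.
  dotOn : List (Node n) → Point n → Point n → ℚ
  dotOn ks c x = foldr (λ k acc → c k * x k + acc) 0ℚ ks

  module _ (c : Point n) where

    dotOn-zero : ∀ ks → dotOn ks c (λ _ → 0ℚ) ≡ 0ℚ
    dotOn-zero [] = refl
    dotOn-zero (k ∷ ks) = trans (cong₂ _+_ (ℚₚ.*-zeroʳ (c k)) (dotOn-zero ks)) refl

    dotOn-cong : ∀ ks {x y : Point n} → (∀ k → x k ≡ y k) → dotOn ks c x ≡ dotOn ks c y
    dotOn-cong [] eq = refl
    dotOn-cong (k ∷ ks) eq = cong₂ (λ u v → c k * u + v) (eq k) (dotOn-cong ks eq)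

    dotOn-+ : ∀ ks (x y : Point n) → dotOn ks c (λ k → x k + y k) ≡ dotOn ks c x + dotOn ks c y
    dotOn-+ [] x y = refl
    dotOn-+ (k ∷ ks) x y = trans (cong (c k * (x k + y k) +_) (dotOn-+ ks x y))
      (solve 5 (λ c x y a b → c :* (x :+ y) :+ (a :+ b) := (c :* x :+ a) :+ (c :* y :+ b)) refl
        (c k) (x k) (y k) (dotOn ks c x) (dotOn ks c y))

    dotOn-* : ∀ ks r (x : Point n) → dotOn ks c (λ k → r * x k) ≡ r * dotOn ks c x
    dotOn-* [] r x = sym (ℚₚ.*-zeroʳ r)
    dotOn-* (k ∷ ks) r x = trans (cong (c k * (r * x k) +_) (dotOn-* ks r x))
      (solve 4 (λ c r x a → c :* (r :* x) :+ r :* a := r :* (c :* x :+ a)) refl (c k) r (x k) (dotOn ks c x))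

    dotOn-∉ : ∀ ks {h} → ¬ h ∈ ks → dotOn ks c (λ k → ι (indicator k h)) ≡ 0ℚ
    dotOn-∉ [] h∉ = refl
    dotOn-∉ (k ∷ ks) {h} h∉ with k ≟ h
    ... | yes refl = contradiction (here refl) h∉
    ... | no _ = trans (cong₂ _+_ (ℚₚ.*-zeroʳ (c k)) (dotOn-∉ ks (h∉ ∘ there))) refl

    dotOn-indicator : ∀ {ks h} → Unique ks → h ∈ ks → dotOn ks c (λ k → ι (indicator k h)) ≡ c h
    dotOn-indicator {k ∷ ks} {h} (k∉ ∷ u) h∈ with k ≟ h
    ... | yes refl = trans (cong₂ _+_ (ℚₚ.*-identityʳ (c k)) (dotOn-∉ ks (λ k∈ → All.lookup k∉ k∈ refl)))
                           (ℚₚ.+-identityʳ (c k))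
    ... | no k≢h = trans (cong₂ _+_ (ℚₚ.*-zeroʳ (c k)) (dotOn-indicator u h∈ks)) (ℚₚ.+-identityˡ (c h))
      where
      h∈ks : h ∈ ks
      h∈ks with ∈-∷⁻ h∈
      ... | inj₁ refl = contradiction refl k≢h
      ... | inj₂ p = p

    dot-vert : ∀ a → dot c (vert a) + c (tail a) ≡ c (head a)
    dot-vert a = begin
      dot c (vert a) + c (tail a)
        ≡⟨ cong (dot c (vert a) +_) (sym (dotOn-indicator (allFin⁺ (suc n)) (∈-allFin (tail a)))) ⟩
      dot c (vert a) + dot c (λ k → ι (indicator k (tail a)))
        ≡⟨ sym (dotOn-+ (allFin (suc n)) (vert a) _) ⟩
      dot c (λ k → vert a k + ι (indicator k (tail a)))
        ≡⟨ dotOn-cong (allFin (suc n)) (vert-indicator a) ⟩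
      dot c (λ k → ι (indicator k (head a)))
        ≡⟨ dotOn-indicator (allFin⁺ (suc n)) (∈-allFin (head a)) ⟩
      c (head a) ∎
      where open ≡-Reasoning

    dotSum : List (Arrow n) → ℚ
    dotSum l = sumℚ (map (λ a → dot c (vert a)) l)

    dot-S : ∀ l → dot c (S l) ≡ dotSum l
    dot-S [] = dotOn-zero (allFin (suc n))
    dot-S (a ∷ l) = trans (dotOn-+ (allFin (suc n)) (vert a) (S l)) (cong (dot c (vert a) +_) (dot-S l))

    dot-barycentre : ∀ l {x} → Barycentre l x → ι (length l) * dot c x ≡ dotSum l
    dot-barycentre l {x} bary = trans (sym (dotOn-* (allFin (suc n)) (ι (length l)) x))
      (trans (dotOn-cong (allFin (suc n)) bary) (dot-S l))

    dotSum-const : ∀ l {M} → (∀ {a} → a ∈ l → dot c (vert a) ≡ M) → dotSum l ≡ ι (length l) * M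
    dotSum-const [] {M} eq = sym (ℚₚ.*-zeroˡ M)
    dotSum-const (a ∷ l) {M} eq = trans (cong₂ _+_ (eq (here refl)) (dotSum-const l (eq ∘ there)))
      (solve 2 (λ M k → M :+ k :* M := (con 1ℚ :+ k) :* M) refl M (ι (length l)))

    dotSum-≤ : ∀ l {M} → (∀ a → dot c (vert a) ≤ℚ M) → dotSum l ≤ℚ ι (length l) * M
    dotSum-≤ [] {M} _ = ℚₚ.≤-reflexive (sym (ℚₚ.*-zeroˡ M))
    dotSum-≤ (a ∷ l) {M} le = ℚₚ.≤-trans (ℚₚ.+-mono-≤ (le a) (dotSum-≤ l le)) (ℚₚ.≤-reflexive
      (solve 2 (λ M k → M :+ k :* M := (con 1ℚ :+ k) :* M) refl M (ι (length l))))

    -- A single value below M would leave the whole sum strictly below its bound.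
    dotSum-max : ∀ l {M} → (∀ a → dot c (vert a) ≤ℚ M) → dotSum l ≡ ι (length l) * M →
      ∀ {a} → a ∈ l → dot c (vert a) ≡ M
    dotSum-max (b ∷ l) {M} le eq a∈ with ℚₚ.<-cmp (dot c (vert b)) M
    ... | tri< b<M _ _ = contradiction (trans eq split) (ℚₚ.<⇒≢ (ℚₚ.+-mono-<-≤ b<M (dotSum-≤ l le)))
      where
      split : ι (suc (length l)) * M ≡ M + ι (length l) * M
      split = solve 2 (λ M k → (con 1ℚ :+ k) :* M := M :+ k :* M) refl M (ι (length l))
    ... | tri> _ _ M<b = contradiction (ℚₚ.<-≤-trans M<b (le b)) (ℚₚ.<-irrefl refl)
    ... | tri≈ _ b≡M _ with ∈-∷⁻ a∈
    ...   | inj₁ refl = b≡M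
    ...   | inj₂ a∈l = dotSum-max l le (+-cancelʳ M rest) a∈l
      where
      rest : dotSum l + M ≡ ι (length l) * M + M
      rest = trans (ℚₚ.+-comm (dotSum l) M) (trans (cong (_+ dotSum l) (sym b≡M)) (trans eq
        (solve 2 (λ M k → (con 1ℚ :+ k) :* M := k :* M :+ M) refl M (ι (length l)))))

  *-cancelˡ : ∀ m {x y} → m ≢ 0 → ι m * x ≡ ι m * y → x ≡ y
  *-cancelˡ m {x} {y} m≢0 eq with r , _ , inv ← reciprocal m m≢0 = trans (lemma x) (trans (cong (r *_) eq) (sym (lemma y)))
    where
    lemma : ∀ z → z ≡ r * (ι m * z)
    lemma z = trans (sym (ℚₚ.*-identityˡ z)) (trans (cong (_* z) (sym inv))
      (solve 3 (λ m r z → m :* r :* z := r :* (m :* z)) refl (ι m) r z))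

-- The boundary of the root polytope, and triangulations from unique normal forms.

module Triangulation where

  open Swaps
  open Barycentres
  open Endpoints
  open import Data.Bool using (if_then_else_)
  open import Data.Nat as ℕ using (ℕ; zero; suc)
  import Data.Nat.Properties as ℕₚ
  open import Data.Fin using (_≟_)
  open import Data.Rational as ℚ using (0ℚ; 1ℚ; _+_; _*_; -_) renaming (_≤_ to _≤ℚ_; _<_ to _<ℚ_)
  import Data.Rational.Properties as ℚₚ
  open import Data.Rational.Solver using (module +-*-Solver)
  open import Data.List using (List; []; _∷_; map; length; _++_; replicate)
  open import Data.List.Properties using (length-map; map-∘)
  open import Data.List.Membership.Propositional using (_∈_; find; lose)
  open import Data.List.Membership.Propositional.Properties using (∈-map⁺; ∈-map⁻)
  open import Data.List.Relation.Unary.Any as Any using (here; there; any?)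
  open import Data.List.Relation.Binary.Subset.Propositional using (_⊆_)
  open import Data.List.Relation.Unary.All as All using (All; []; _∷_)
  open import Data.List.Relation.Unary.AllPairs using ([]; _∷_)
  open import Data.List.Relation.Unary.Unique.Propositional using (Unique)
  open import Data.List.Relation.Binary.Permutation.Propositional using (_↭_; refl; ↭-sym)
  open import Data.List.Relation.Binary.Permutation.Propositional.Properties
    using (∈-resp-↭; ↭-length)
  open import Data.Product using (_×_; _,_; proj₁; proj₂; ∃-syntax)
  open import Data.Sum using (_⊎_; inj₁; inj₂)
  open import Data.Empty using (⊥-elim)
  open import Function using (_∘_)
  open import Relation.Nullary using (¬_; yes; no; contradiction; does)
  open import Relation.Binary.PropositionalEquality
  open +-*-Solver using (solve; _:+_; _:*_; :-_; _:=_; con)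

  private
    variable
      n : ℕ

  reversed : Arrow n → Arrow n
  reversed a = arr (head a) (tail a) (tail≢head a ∘ sym)

  dot-vert′ : ∀ (c : Point n) (a : Arrow n) → dot c (vert a) ≡ c (head a) + - c (tail a)
  dot-vert′ c a = +-cancelʳ (c (tail a)) (trans (dot-vert c a)
    (solve 2 (λ h t → h := h :+ :- t :+ t) refl (c (head a)) (c (tail a))))

  -1≤1 : - 1ℚ ≤ℚ 1ℚ
  -1≤1 = ℚₚ.≤-trans (ℚₚ.nonPositive⁻¹ (- 1ℚ)) (ℚₚ.nonNegative⁻¹ 1ℚ)

  module _ (l : List (Arrow n)) where

    isHead? : (k : Node n) → _
    isHead? k = any? (λ a → k ≟ head a) l

    -- A supporting functional for alternating l: no arrow exceeds the value 2, the arrows of l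
    -- attain it, and their reverses have -2. Nodes outside l are put on the side of the tails.
    separator : Point n
    separator k = if does (isHead? k) then 1ℚ else - 1ℚ

    separator-head : ∀ {a} → a ∈ l → separator (head a) ≡ 1ℚ
    separator-head {a} a∈ with isHead? (head a)
    ... | yes _ = refl
    ... | no ¬head = contradiction (lose a∈ refl) ¬head

    separator-tail : Alternating l → ∀ {a} → a ∈ l → separator (tail a) ≡ - 1ℚ
    separator-tail alt {a} a∈ with isHead? (tail a)
    ... | no _ = refl
    ... | yes h with b , b∈ , eq ← find h = contradiction eq (alt a∈ b∈)

    separator≤1 : ∀ k → separator k ≤ℚ 1ℚ
    separator≤1 k with isHead? k
    ... | yes _ = ℚₚ.≤-refl
    ... | no _ = -1≤1

    -1≤separator : ∀ k → - 1ℚ ≤ℚ separator k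
    -1≤separator k with isHead? k
    ... | yes _ = -1≤1
    ... | no _ = ℚₚ.≤-refl

    separator-max : ∀ a → dot separator (vert a) ≤ℚ 1ℚ + 1ℚ
    separator-max a = subst (_≤ℚ 1ℚ + 1ℚ) (sym (dot-vert′ separator a))
      (ℚₚ.+-mono-≤ (separator≤1 (head a)) (ℚₚ.neg-antimono-≤ (-1≤separator (tail a))))

    separator-attains : Alternating l → ∀ {a} → a ∈ l → dot separator (vert a) ≡ 1ℚ + 1ℚ
    separator-attains alt {a} a∈ = trans (dot-vert′ separator a)
      (cong₂ (λ x y → x + - y) (separator-head a∈) (separator-tail alt a∈))

    separator-reversed : Alternating l → ∀ {a} → a ∈ l → dot separator (vert (reversed a)) ≡ - 1ℚ + - 1ℚ
    separator-reversed alt {a} a∈ = trans (dot-vert′ separator (reversed a))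
      (cong₂ (λ x y → x + - y) (separator-tail alt a∈) (separator-head a∈))

    barycentre⇒boundary : ∀ {x} → NonEmpty l → Alternating l → Barycentre l x → InBoundary x
    barycentre⇒boundary {x} ne alt bary =
      (l , barycentre⇒hull l ne bary) , separator
      , (λ a → subst (dot separator (vert a) ≤ℚ_) (sym dot-x) (separator-max a))
      , reversed a₀
      , subst₂ _<ℚ_ (sym (separator-reversed alt a₀∈)) (sym dot-x)
          (ℚₚ.<-trans (ℚₚ.negative⁻¹ (- 1ℚ + - 1ℚ)) (ℚₚ.positive⁻¹ (1ℚ + 1ℚ)))
      where
      a₀ = proj₁ (NonEmpty⇒∈ l ne)
      a₀∈ = proj₂ (NonEmpty⇒∈ l ne)
      dot-x : dot separator x ≡ 1ℚ + 1ℚ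
      dot-x = *-cancelˡ (length l) ne
        (trans (dot-barycentre separator l bary) (dotSum-const separator l (separator-attains alt)))

  -- All arrows of l attain the maximum M > 0 of c. If `tail a₁` were `head a₂`, the composite arrow
  -- from `tail a₂` to `head a₁` would have the value 2M > M, or the two arrows would be opposite
  -- and 2M = 0.
  boundary⇒alternating : ∀ {x : Point n} → InBoundary x → ∃[ l ] (NonEmpty l × Alternating l × Barycentre l x)
  boundary⇒alternating {x = x} ((As , h) , c , max , b , b<M)
    with l , _ , ne , bary ← hull⇒barycentre As h = l , ne , alternating , bary
    where
    M = dot c x
    attained : ∀ {a} → a ∈ l → c (head a) + - c (tail a) ≡ M
    attained {a} a∈ = trans (sym (dot-vert′ c a)) (dotSum-max c l max (sym (dot-barycentre c l bary)) a∈)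
    max′ : ∀ a → c (head a) + - c (tail a) ≤ℚ M
    max′ a = subst (_≤ℚ M) (dot-vert′ c a) (max a)
    -- The values of b and of its reverse cancel; both are at most M, and that of b is strictly
    -- smaller.
    0<2M : 0ℚ <ℚ M + M
    0<2M = subst (_<ℚ M + M)
      (solve 2 (λ h t → (h :+ :- t) :+ (t :+ :- h) := con 0ℚ) refl (c (head b)) (c (tail b)))
      (ℚₚ.+-mono-<-≤ (subst (_<ℚ M) (dot-vert′ c b) b<M) (max′ (reversed b)))
    M≤0⇒⊥ : ¬ M + M ≤ℚ M
    M≤0⇒⊥ le = ℚₚ.<-irrefl refl (ℚₚ.<-≤-trans 0<2M (ℚₚ.≤-trans le M≤0))
      where
      M≤0 : M ≤ℚ 0ℚ
      M≤0 = subst₂ _≤ℚ_ (solve 1 (λ m → m :+ m :+ :- m := m) refl M) (ℚₚ.+-inverseʳ M)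
        (ℚₚ.+-monoˡ-≤ (- M) le)
    alternating : Alternating l
    alternating {a₁} {a₂} a₁∈ a₂∈ t₁≡h₂ = M≤0⇒⊥ (subst (_≤ℚ M) sum≡ (helper (tail a₂ ≟ head a₁)))
      where
      sum≡ : c (head a₁) + - c (tail a₂) ≡ M + M
      sum≡ = trans (solve 3 (λ h m t → h :+ :- t := (h :+ :- m) :+ (m :+ :- t)) refl
                     (c (head a₁)) (c (tail a₁)) (c (tail a₂)))
               (cong₂ _+_ (attained a₁∈)
                 (trans (cong (λ k → c k + - c (tail a₂)) t₁≡h₂) (attained a₂∈)))
      helper : Relation.Nullary.Dec (tail a₂ ≡ head a₁) → c (head a₁) + - c (tail a₂) ≤ℚ M
      helper (no t≢h) = max′ (arr (tail a₂) (head a₁) t≢h)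
      helper (yes t≡h) = ⊥-elim (ℚₚ.<-irrefl (sym 2M≡0) 0<2M)
        where
        2M≡0 : M + M ≡ 0ℚ
        2M≡0 = trans (sym sum≡) (trans (cong (λ k → c (head a₁) + - c k) t≡h) (ℚₚ.+-inverseʳ (c (head a₁))))

  -- With a in neither remainder, a copy of a on one side needs a copy on the other, which
  -- disjointness of p and q forbids.
  replicate-∉ : ∀ {X : Set} {a : X} p {q l m} → ¬ a ∈ l → p ≡ 0 ⊎ q ≡ 0 →
    replicate p a ++ l ↭ replicate q a ++ m → ¬ a ∈ m → p ≡ 0 × q ≡ 0
  replicate-∉ {a = a} zero {zero} _ _ _ _ = refl , refl
  replicate-∉ {a = a} zero {suc q} a∉l _ p _ = contradiction (∈-resp-↭ (↭-sym p) (here refl)) a∉l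
  replicate-∉ (suc p) {q} a∉l (inj₂ refl) r a∉m = contradiction (∈-resp-↭ r (here refl)) a∉m

  module Geometry {n : ℕ} (Δ : SimplicialComplex n) (sys : SwapSystem (Node n) (Node n)) where
    open SwapSystem sys using (Ok)
    open Rewriting sys

    -- Together the three hypotheses say that the faces are exactly the alternating cliques.
    module _ (face⇒alternating : ∀ {F} → Face Δ F → Alternating F)
             (face⇒ok : ∀ {F a b} → Face Δ F → a ∈ F → b ∈ F → Ok (pr a) (pr b))
             (clique⇒face : ∀ {F} → Alternating F → Clique (flow F) → Face Δ F) where

      face-clique : ∀ {F l} → Face Δ F → l ⊆ F → Clique (flow l)
      face-clique face l⊆F a∈ b∈
        with _ , a∈l , refl ← ∈-map⁻ pr a∈ | _ , b∈l , refl ← ∈-map⁻ pr b∈ =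
        face⇒ok face (l⊆F a∈l) (l⊆F b∈l)

      face-alternating : ∀ {F l} → Face Δ F → l ⊆ F → Alternating l
      face-alternating face l⊆F a∈ b∈ = face⇒alternating face (l⊆F a∈) (l⊆F b∈)

      -- The common source of affine independence and of the intersection property: equal sums give
      -- equal ends by alternation, and cliques with equal ends coincide.
      faces-unique : ∀ {F G l m} → Face Δ F → Face Δ G → l ⊆ F → m ⊆ G →
        (∀ k → S l k ≡ S m k) → l ↭ m
      faces-unique {l = l} {m} faceF faceG l⊆F m⊆G eq = flow-↭⁻ (clique-unique
        (face-clique faceF l⊆F) (face-clique faceG m⊆G)
        ( subst₂ _↭_ (map-∘ l) (map-∘ m) (tails-↭ l m alt-l alt-m eq)
        , subst₂ _↭_ (map-∘ l) (map-∘ m) (heads-↭ l m alt-l alt-m eq)))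
        where
        alt-l = face-alternating faceF l⊆F
        alt-m = face-alternating faceG m⊆G

      expand-zero : ∀ {D ws ps qs} → Scaled (suc D) ws ps qs → ∀ (F : List (Arrow n)) → Unique F →
        length ws ≡ length F → expand ps F ↭ expand qs F → All (_≡ 0ℚ) ws
      expand-zero [] F u len p = []
      expand-zero {D} (_∷_ {w} {p} {q} {ws} {ps} {qs} (mkEntry e z) s) (a ∷ F) (a∉ ∷ u) len r
        with refl , refl ← replicate-∉ p {q} (λ a∈ → All.lookup a∉ (expand-⊆ ps F a∈) refl) z r
                                             (λ a∈ → All.lookup a∉ (expand-⊆ qs F a∈) refl) =
        *-cancelˡ (suc D) (λ ()) (trans (sym (ℚₚ.+-identityʳ _)) (trans e (sym (ℚₚ.*-zeroʳ (ι (suc D))))))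
        ∷ expand-zero s F u (ℕₚ.suc-injective len) r

      -- A dependence splits into a positive and a negative multiset on the same face with equal
      -- sums. They coincide, yet their supports are disjoint, so both are empty.
      affinely-independent : ∀ F → Face Δ F → Unique F → AffIndep (map vert F)
      affinely-independent F face u ws len _ lincomb≡0 with D , ps , qs , s ← clear-denominators ws =
        expand-zero s F u len′ (↭-sym (faces-unique face face (expand-⊆ qs F) (expand-⊆ ps F) S-eq))
        where
        len′ : length ws ≡ length F
        len′ = trans len (length-map vert F)
        S-eq : ∀ k → S (expand qs F) k ≡ S (expand ps F) k
        S-eq k = begin
          S (expand qs F) k                                              ≡⟨ sym (ℚₚ.+-identityˡ _) ⟩
          0ℚ + S (expand qs F) k
            ≡⟨ cong (_+ S (expand qs F) k) (sym (ℚₚ.*-zeroʳ (ι (suc D)))) ⟩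
          ι (suc D) * 0ℚ + S (expand qs F) k
            ≡⟨ cong (λ y → ι (suc D) * y + S (expand qs F) k) (sym (lincomb≡0 k)) ⟩
          ι (suc D) * lincomb ws (map vert F) k + S (expand qs F) k      ≡⟨ lincomb-expand s F len′ k ⟩
          S (expand ps F) k                                              ∎
          where open ≡-Reasoning

      -- Repeated to equal sums, the multisets that represent x on F and on G are the same, so their
      -- support lies in both faces.
      intersection : ∀ F G → Face Δ F → Face Δ G → ∀ x → hull F x → hull G x →
        ∃[ K ] (K ⊆ F × K ⊆ G × hull K x)
      intersection F G faceF faceG x hF hG
        with l , l⊆F , l≢ , bl ← hull⇒barycentre F hF | m , m⊆G , m≢ , bm ← hull⇒barycentre G hG =
        K , K⊆F , repeat⊆G ∘ ∈-resp-↭ K↭ , barycentre⇒hull K K≢[] (barycentre-repeat (length m) l bl)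
        where
        K = repeat (length m) l
        K⊆F : K ⊆ F
        K⊆F = l⊆F ∘ repeat-⊆ (length m) l
        repeat⊆G : repeat (length l) m ⊆ G
        repeat⊆G = m⊆G ∘ repeat-⊆ (length l) m
        K↭ : K ↭ repeat (length l) m
        K↭ = faces-unique faceF faceG K⊆F repeat⊆G (repeat-S l m bl bm)
        K≢[] : NonEmpty K
        K≢[] eq with ℕₚ.m*n≡0⇒m≡0∨n≡0 (length m) (trans (sym (length-repeat (length m) l)) eq)
        ... | inj₁ e = m≢ e
        ... | inj₂ e = l≢ e

      in-boundary : ∀ F → Face Δ F → ∀ x → hull F x → InBoundary x
      in-boundary F face x h with l , l⊆F , ne , bary ← hull⇒barycentre F h =
        barycentre⇒boundary l ne (face-alternating face l⊆F) bary

      arrows : ∀ (m : List (Node n × Node n)) → (∀ {a} → a ∈ m → proj₁ a ≢ proj₂ a) → ∃[ l ] flow l ≡ m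
      arrows [] _ = [] , refl
      arrows (a ∷ m) distinct with l , eq ← arrows m (distinct ∘ there) =
        arr (proj₁ a) (proj₂ a) (distinct (here refl)) ∷ l , cong (a ∷_) eq

      -- Swaps work on mere pairs of nodes but keep the ends, hence alternation. In particular no
      -- loop arises, so the result can be read as arrows again.
      alternating-ends : ∀ {l : List (Arrow n)} {m : List (Node n × Node n)} →
        Alternating l → tails (flow l) ↭ tails m → heads (flow l) ↭ heads m →
        ∀ {a b} → a ∈ m → b ∈ m → proj₁ a ≢ proj₂ b
      alternating-ends {l} alt p q a∈ b∈ eq
        with _ , c∈ , refl ← ∈-map⁻ proj₁ (∈-resp-↭ (↭-sym p) (∈-map⁺ proj₁ a∈))
           | _ , d∈ , eq′ ← ∈-map⁻ proj₂ (∈-resp-↭ (↭-sym q) (∈-map⁺ proj₂ b∈))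
        with _ , c∈l , refl ← ∈-map⁻ pr c∈ | _ , d∈l , refl ← ∈-map⁻ pr d∈ = alt c∈l d∈l (trans eq eq′)

      clique-covers : ∀ {x} l F → NonEmpty l → Alternating l → Barycentre l x →
        Clique (flow F) → SameEnds (flow l) (flow F) → Face Δ F × hull F x
      clique-covers {x} l F l≢ alt bary clique (p , q) =
        clique⇒face (λ a∈ b∈ → alternating-ends {l} alt p q (∈-map⁺ pr a∈) (∈-map⁺ pr b∈)) clique
        , barycentre⇒hull F (λ e → l≢ (trans len e)) λ k →
            trans (cong (λ z → ι z * x k) (sym len)) (trans (bary k) (S-ends l F p′ q′ k))
        where
        p′ : map tail l ↭ map tail F
        p′ = subst₂ _↭_ (sym (map-∘ l)) (sym (map-∘ F)) p
        q′ : map head l ↭ map head F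
        q′ = subst₂ _↭_ (sym (map-∘ l)) (sym (map-∘ F)) q
        len : length l ≡ length F
        len = trans (sym (length-map tail l)) (trans (↭-length p′) (length-map tail F))

      -- Swapping keeps the ends and with them the barycentre, so a normal form of any alternating
      -- multiset for x spans a face through x.
      covering : ∀ x → InBoundary x → ∃[ F ] (Face Δ F × hull F x)
      covering x bd =
        let l , l≢ , alt , bary = boundary⇒alternating bd
            m , cm , l⟶m = normalise (flow l)
            ends = ⟶*-ends l⟶m
            F , eq = arrows m (λ a∈ → alternating-ends {l} alt (proj₁ ends) (proj₂ ends) a∈ a∈)
        in F , clique-covers l F l≢ alt bary
                 (λ {a} {b} a∈ b∈ → cm (subst (a ∈_) eq a∈) (subst (b ∈_) eq b∈))
                 (subst (SameEnds (flow l)) (sym eq) ends)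

      triangulation : RepresentsTriangulation Δ
      triangulation = affinely-independent , intersection , in-boundary , covering

-- Reading the six bits off a uniform flag complex.

module EdgeTypes where

  open Swaps
  open Hexagons
  open SwapOrder
  open Barycentres
  open Endpoints
  open import Data.Bool using (Bool; true; false)
  open import Data.Nat as ℕ using (ℕ; zero; suc)
  import Data.Nat.Properties as ℕₚ
  open import Data.Fin as Fin using (Fin; zero; suc; _<_; _≟_; #_)
  open import Data.Fin.Properties using (<-cmp; <-trans; <-irrefl; <-asym)
  open import Data.Fin.Subset using () renaming (_∈_ to _∈ˢ_)
  open import Data.Fin.Subset.Properties using (x∈p∩q⁺)
  open import Data.List.Membership.Propositional using (_∈_)
  open import Data.List.Relation.Unary.Any using (here; there)
  open import Data.List.Relation.Unary.All as All using (All)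
  open import Data.Product using (_×_; _,_; proj₁; proj₂; ∃-syntax)
  open import Data.Sum using (inj₁; inj₂)
  open import Function using (_∘_)
  open import Function.Bundles using (_⇔_; mk⇔; Equivalence)
  open import Relation.Binary.Definitions using (tri<; tri≈; tri>)
  open import Relation.Nullary using (¬_; yes; no; contradiction)
  open import Relation.Binary.PropositionalEquality

  private
    variable
      n : ℕ

  Mono : (Fin 4 → Node n) → Set
  Mono p = ∀ {k l} → k < l → p k < p l

  mono-reflects-≡ : {p : Fin 4 → Node n} → Mono p → ∀ {k l} → p k ≡ p l → k ≡ l
  mono-reflects-≡ mono {k} {l} eq with <-cmp k l
  ... | tri< k<l _ _ = contradiction (mono k<l) (<-irrefl eq)
  ... | tri≈ _ k≡l _ = k≡l
  ... | tri> _ _ l<k = contradiction (mono l<k) (<-irrefl (sym eq))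

  mono-reflects-< : {p : Fin 4 → Node n} → Mono p → ∀ {k l} → p k < p l → k < l
  mono-reflects-< mono {k} {l} pk<pl with <-cmp k l
  ... | tri< k<l _ _ = k<l
  ... | tri≈ _ refl _ = contradiction pk<pl (<-irrefl refl)
  ... | tri> _ _ l<k = contradiction pk<pl (<-asym (mono l<k))

  -- Increasing quadruples are interchangeable, whatever roles π assigns to their places; this is
  -- the form in which uniformity gets applied.
  mono-order-type : {p p′ : Fin 4 → Node n} → Mono p → Mono p′ → (π : Fin 4 → Fin 4) →
    SameOrderType (p ∘ π) (p′ ∘ π)
  mono-order-type {p = p} {p′} m m′ π k l =
    mk⇔ (cong p′ ∘ mono-reflects-≡ m) (cong p ∘ mono-reflects-≡ m′)
    , mk⇔ (m′ ∘ mono-reflects-< m) (m ∘ mono-reflects-< m′)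

  SameOrderType-resp : {x x′ y y′ : Fin 4 → Node n} → (∀ k → x k ≡ x′ k) → (∀ k → y k ≡ y′ k) →
    SameOrderType x y → SameOrderType x′ y′
  SameOrderType-resp e f s k l rewrite sym (e k) | sym (e l) | sym (f k) | sym (f l) = s k l

  fin₄ : {X : Set} → X → X → X → X → Fin 4 → X
  fin₄ w x y z zero = w
  fin₄ w x y z (suc zero) = x
  fin₄ w x y z (suc (suc zero)) = y
  fin₄ w x y z (suc (suc (suc zero))) = z

  chain-mono : {p : Fin 4 → Node n} → p (# 0) < p (# 1) → p (# 1) < p (# 2) → p (# 2) < p (# 3) → Mono p
  chain-mono a b c {zero} {suc zero} _ = a
  chain-mono a b c {zero} {suc (suc zero)} _ = <-trans a b
  chain-mono a b c {zero} {suc (suc (suc zero))} _ = <-trans a (<-trans b c)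
  chain-mono a b c {suc zero} {suc (suc zero)} _ = b
  chain-mono a b c {suc zero} {suc (suc (suc zero))} _ = <-trans b c
  chain-mono a b c {suc (suc zero)} {suc (suc (suc zero))} _ = c
  chain-mono a b c {_} {zero} ()
  chain-mono a b c {suc _} {suc zero} (ℕ.s≤s ())
  chain-mono a b c {suc (suc _)} {suc (suc zero)} (ℕ.s≤s (ℕ.s≤s ()))
  chain-mono a b c {suc (suc (suc zero))} {suc (suc (suc zero))} (ℕ.s≤s (ℕ.s≤s (ℕ.s≤s ())))

  record Places : Set where
    constructor places
    field τ₀ τ₁ η₀ η₁ : Fin 4

  -- The positions of the two tails and of the two heads in the word of each type.
  place : Kind → Places
  place thth = places (# 0) (# 2) (# 1) (# 3)
  place htht = places (# 1) (# 3) (# 0) (# 2)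
  place thht = places (# 0) (# 3) (# 1) (# 2)
  place htth = places (# 1) (# 2) (# 0) (# 3)
  place tthh = places (# 0) (# 1) (# 2) (# 3)
  place hhtt = places (# 2) (# 3) (# 0) (# 1)

  Separate : Places → Set
  Separate (places τ₀ τ₁ η₀ η₁) =
    (τ₀ ≢ η₀ × τ₀ ≢ η₁ × τ₁ ≢ η₀ × τ₁ ≢ η₁) × τ₀ ≢ τ₁ × η₀ ≢ η₁

  place-separate : ∀ κ → Separate (place κ)
  place-separate thth = ((λ ()) , (λ ()) , (λ ()) , (λ ())) , (λ ()) , (λ ())
  place-separate htht = ((λ ()) , (λ ()) , (λ ()) , (λ ())) , (λ ()) , (λ ())
  place-separate thht = ((λ ()) , (λ ()) , (λ ()) , (λ ())) , (λ ()) , (λ ())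
  place-separate htth = ((λ ()) , (λ ()) , (λ ()) , (λ ())) , (λ ()) , (λ ())
  place-separate tthh = ((λ ()) , (λ ()) , (λ ()) , (λ ())) , (λ ()) , (λ ())
  place-separate hhtt = ((λ ()) , (λ ()) , (λ ()) , (λ ())) , (λ ()) , (λ ())

  kind-bits : (Kind → Bool) → Bits
  kind-bits f = bits (f thth) (f htht) (f thht) (f htth) (f tthh) (f hhtt)

  twist-kind-bits : ∀ f k → twist (kind-bits f) k ≡ f k
  twist-kind-bits f thth = refl
  twist-kind-bits f htht = refl
  twist-kind-bits f thht = refl
  twist-kind-bits f htth = refl
  twist-kind-bits f tthh = refl
  twist-kind-bits f hhtt = refl

  placed : ∀ {N} {t t′ h h′ : Fin (suc N)} {κ} →
    KindView (P t) (P t′) (Q h) (Q h′) κ → t ≢ h → t ≢ h′ → t′ ≢ h → t′ ≢ h′ →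
    ∃[ p ] (Mono {N} p × (let places τ₀ τ₁ η₀ η₁ = place κ in
      p τ₀ ≡ t × p τ₁ ≡ t′ × p η₀ ≡ h × p η₁ ≡ h′))
  placed {N} {t} {t′} {h} {h′} view t≢h t≢h′ t′≢h t′≢h′ = go view
    where
    tt : ∀ {x y : Fin (suc N)} → P x ℕ.< P y → x < y
    tt lt = ℕₚ.*-cancelˡ-< 2 _ _ lt
    hh : ∀ {x y : Fin (suc N)} → Q x ℕ.< Q y → x < y
    hh lt = ℕₚ.*-cancelˡ-< 2 _ _ (ℕ.s≤s⁻¹ lt)
    ht : ∀ {x y : Fin (suc N)} → Q x ℕ.< P y → x < y
    ht lt = ℕₚ.*-cancelˡ-< 2 _ _ (ℕₚ.<-trans (ℕₚ.n<1+n _) lt)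
    -- P x < Q y holds for x = y too, so distinctness of the nodes enters here.
    th : ∀ {x y : Fin (suc N)} → x ≢ y → P x ℕ.< Q y → x < y
    th {x} {y} x≢y lt with <-cmp x y
    ... | tri< x<y _ _ = x<y
    ... | tri≈ _ x≡y _ = contradiction x≡y x≢y
    ... | tri> _ _ y<x = contradiction (ℕₚ.<-≤-trans lt Qy≤Px) (ℕₚ.<-irrefl refl)
      where
      Qy≤Px : Q y ℕ.≤ P x
      Qy≤Px = ℕₚ.*-monoʳ-< 2 y<x
    go : ∀ {κ} → KindView (P t) (P t′) (Q h) (Q h′) κ →
      ∃[ p ] (Mono {N} p × (let places τ₀ τ₁ η₀ η₁ = place κ in
        p τ₀ ≡ t × p τ₁ ≡ t′ × p η₀ ≡ h × p η₁ ≡ h′))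
    go (thth a b c) = fin₄ t h t′ h′ , chain-mono (th t≢h a) (ht b) (th t′≢h′ c) , refl , refl , refl , refl
    go (htht a b c) = fin₄ h t h′ t′ , chain-mono (ht a) (th t≢h′ b) (ht c) , refl , refl , refl , refl
    go (thht a b c) = fin₄ t h h′ t′ , chain-mono (th t≢h a) (hh b) (ht c) , refl , refl , refl , refl
    go (htth a b c) = fin₄ h t t′ h′ , chain-mono (ht a) (tt b) (th t′≢h′ c) , refl , refl , refl , refl
    go (tthh a b c) = fin₄ t t′ h h′ , chain-mono (tt a) (th t′≢h b) (hh c) , refl , refl , refl , refl
    go (hhtt a b c) = fin₄ h h′ t t′ , chain-mono (hh a) (ht b) (tt c) , refl , refl , refl , refl

  module Edges {n : ℕ} (Δ : SimplicialComplex n) (perm : IsPermissible Δ) (uf : IsUniformFlag Δ)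
               (base : Fin 4 → Node n) (base-mono : Mono base) where

    -- Quantifying over the irrelevant distinctness proofs lets edges be named by nodes alone; for a
    -- loop the statement is vacuous.
    E : Node n → Node n → Node n → Node n → Set
    E t h t′ h′ = ∀ .(d : t ≢ h) .(d′ : t′ ≢ h′) → Edge Δ (arr t h d) (arr t′ h′ d′)

    edge-sym : ∀ {a b} → Edge Δ a b → Edge Δ b a
    edge-sym = down-closed Δ λ { (here e) → there (here e) ; (there (here e)) → here e }

    E-sym : ∀ {t h t′ h′} → E t h t′ h′ → E t′ h′ t h
    E-sym e d d′ = edge-sym (e d′ d)

    exactly-one : ∀ {t t′ h h′} → t ≢ t′ → h ≢ h′ → t ≢ h → t ≢ h′ → t′ ≢ h → t′ ≢ h′ →
      ExactlyOne (E t h t′ h′) (E t h′ t′ h)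
    exactly-one {t} {t′} {h} {h′} tt hh a b c d
      with proj₁ (proj₂ (proj₂ (proj₂ perm))) t t′ h h′ tt hh a b c d
    ... | inj₁ (e , ¬e) = inj₁ ((λ _ _ → e) , λ f → ¬e (f b c))
    ... | inj₂ (¬e , e) = inj₂ ((λ f → ¬e (f a d)) , λ _ _ → e)

    transfer : ∀ {p p′} → Mono p → Mono p′ → ∀ {i j k l} → i ≢ j → k ≢ l →
      E (p i) (p j) (p k) (p l) → E (p′ i) (p′ j) (p′ k) (p′ l)
    transfer {p} {p′} m m′ {i} {j} {k} {l} i≢j k≢l e d d′ = Equivalence.to
      -- `quad` lists both tails before both heads, hence the order i, k, j, l.
      (proj₂ uf _ _ _ _ (SameOrderType-resp eq eq′ (mono-order-type m m′ (fin₄ i k j l))))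
      (e (i≢j ∘ mono-reflects-≡ m) (k≢l ∘ mono-reflects-≡ m))
      where
      eq : ∀ x → p (fin₄ i k j l x) ≡ quad (arr (p i) (p j) _) (arr (p k) (p l) _) x
      eq zero = refl
      eq (suc zero) = refl
      eq (suc (suc zero)) = refl
      eq (suc (suc (suc zero))) = refl
      eq′ : ∀ x → p′ (fin₄ i k j l x) ≡ quad (arr (p′ i) (p′ j) _) (arr (p′ k) (p′ l) _) x
      eq′ zero = refl
      eq′ (suc zero) = refl
      eq′ (suc (suc zero)) = refl
      eq′ (suc (suc (suc zero))) = refl

    Straight Twisted : Places → (Fin 4 → Node n) → Set
    Straight (places τ₀ τ₁ η₀ η₁) p = E (p τ₀) (p η₀) (p τ₁) (p η₁)
    Twisted (places τ₀ τ₁ η₀ η₁) p = E (p τ₀) (p η₁) (p τ₁) (p η₀)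

    one-of : ∀ pl p → Separate pl → Mono p → ExactlyOne (Straight pl p) (Twisted pl p)
    one-of pl p ((a , b , c , d) , tt , hh) m =
      exactly-one (tt ∘ mono-reflects-≡ m) (hh ∘ mono-reflects-≡ m) (a ∘ mono-reflects-≡ m)
        (b ∘ mono-reflects-≡ m) (c ∘ mono-reflects-≡ m) (d ∘ mono-reflects-≡ m)

    Decided : Bool → Set → Set → Set
    Decided false A C = A × ¬ C
    Decided true A C = ¬ A × C

    second : ∀ {A C} → ExactlyOne A C → Bool
    second (inj₁ _) = false
    second (inj₂ _) = true

    second-decided : ∀ {A C} (x : ExactlyOne A C) → Decided (second x) A C
    second-decided (inj₁ x) = x
    second-decided (inj₂ x) = x

    Decided-map : ∀ b {A A′ C C′} → (A → A′) → (A′ → A) → (C → C′) → (C′ → C) →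
      Decided b A C → Decided b A′ C′
    Decided-map false f f⁻ g g⁻ (a , ¬c) = f a , ¬c ∘ g⁻
    Decided-map true f f⁻ g g⁻ (¬a , c) = ¬a ∘ f⁻ , g c

    base-one-of : ∀ κ → ExactlyOne (Straight (place κ) base) (Twisted (place κ) base)
    base-one-of κ = one-of (place κ) base (place-separate κ) base-mono

    -- The bits are read at the single quadruple `base`; `decided` carries them to every increasing
    -- quadruple by uniformity.
    B : Bits
    B = kind-bits (second ∘ base-one-of)

    decided : ∀ κ {p} → Mono p → Decided (twist B κ) (Straight (place κ) p) (Twisted (place κ) p)
    decided κ m rewrite twist-kind-bits (second ∘ base-one-of) κ =
      let ((a , b , c , d) , _) = place-separate κ in
      Decided-map (second (base-one-of κ))
        (transfer base-mono m a d) (transfer m base-mono a d)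
        (transfer base-mono m b c) (transfer m base-mono b c)
        (second-decided (base-one-of κ))

    open Order (suc n) B

    decided-sorted : ∀ {t t′ h h′} → t < t′ → h < h′ → t ≢ h → t ≢ h′ → t′ ≢ h → t′ ≢ h′ →
      Decided (twist B (kind (P t) (P t′) (Q h) (Q h′))) (E t h t′ h′) (E t h′ t′ h)
    decided-sorted {t} {t′} {h} {h′} t<t′ h<h′ a b c d
      with p , m , e₁ , e₂ , e₃ , e₄ ← placed
        (kind-view (ℕₚ.*-monoʳ-< 2 t<t′) (ℕ.s≤s (ℕₚ.*-monoʳ-< 2 h<h′)) (P≢Q t h) (P≢Q t h′) (P≢Q t′ h) (P≢Q t′ h′))
        a b c d = relabel e₁ e₂ e₃ e₄ (decided (kind (P t) (P t′) (Q h) (Q h′)) m)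
      where
      relabel : ∀ {b x y z w t t′ h h′} → x ≡ t → y ≡ t′ → z ≡ h → w ≡ h′ →
        Decided b (E x z y w) (E x w y z) → Decided b (E t h t′ h′) (E t h′ t′ h)
      relabel refl refl refl refl x = x

    E⇔ok-sorted : ∀ {t t′ h h′} → t < t′ → h < h′ → t ≢ h → t ≢ h′ → t′ ≢ h → t′ ≢ h′ →
      (E t h t′ h′ ⇔ okᵇ B (P t) (Q h) (P t′) (Q h′) ≡ true)
      × (E t h′ t′ h ⇔ okᵇ B (P t) (Q h′) (P t′) (Q h) ≡ true)
    E⇔ok-sorted {t} {t′} {h} {h′} t<t′ h<h′ a b c d
      rewrite okᵇ-straight t t′ h h′ (ℕₚ.*-monoʳ-< 2 t<t′) (ℕ.s≤s (ℕₚ.*-monoʳ-< 2 h<h′))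
            | okᵇ-twisted t t′ h h′ (ℕₚ.*-monoʳ-< 2 t<t′) (ℕ.s≤s (ℕₚ.*-monoʳ-< 2 h<h′))
      with twist B (kind (P t) (P t′) (Q h) (Q h′)) | decided-sorted t<t′ h<h′ a b c d
    ... | false | s , ¬t = mk⇔ (λ _ → refl) (λ _ → s) , mk⇔ (λ t → contradiction t ¬t) λ ()
    ... | true | ¬s , t = mk⇔ (λ s → contradiction s ¬s) (λ ()) , mk⇔ (λ _ → refl) (λ _ → t)

    E⇔ok-< : ∀ {t t′ h h′} → t < t′ → h ≢ h′ → t ≢ h → t ≢ h′ → t′ ≢ h → t′ ≢ h′ →
      E t h t′ h′ ⇔ okᵇ B (P t) (Q h) (P t′) (Q h′) ≡ true
    E⇔ok-< {h = h} {h′} t<t′ h≢h′ a b c d with <-cmp h h′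
    ... | tri< h<h′ _ _ = proj₁ (E⇔ok-sorted t<t′ h<h′ a b c d)
    ... | tri≈ _ h≡h′ _ = contradiction h≡h′ h≢h′
    ... | tri> _ _ h′<h = proj₂ (E⇔ok-sorted t<t′ h′<h b a d c)

    E⇔ok : ∀ {t t′ h h′} → t ≢ t′ → h ≢ h′ → t ≢ h → t ≢ h′ → t′ ≢ h → t′ ≢ h′ →
      E t h t′ h′ ⇔ okᵇ B (P t) (Q h) (P t′) (Q h′) ≡ true
    E⇔ok {t} {t′} {h} {h′} t≢t′ h≢h′ a b c d with <-cmp t t′
    ... | tri< t<t′ _ _ = E⇔ok-< t<t′ h≢h′ a b c d
    ... | tri≈ _ t≡t′ _ = contradiction t≡t′ t≢t′
    ... | tri> _ _ t′<t = mk⇔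
      (λ e → trans (sym comm) (Equivalence.to swapped (E-sym e)))
      (λ ok → E-sym (Equivalence.from swapped (trans comm ok)))
      where
      swapped = E⇔ok-< t′<t (h≢h′ ∘ sym) d c b a
      comm : okᵇ B (P t′) (Q h′) (P t) (Q h) ≡ okᵇ B (P t) (Q h) (P t′) (Q h′)
      comm = okᵇ-comm B {P t} {P t′} {Q h} {Q h′} (t≢t′ ∘ P-injective) (h≢h′ ∘ Q-injective)

    edge⇒ok : ∀ {a b} → tail a ≢ head b → tail b ≢ head a → Edge Δ a b → Ok (pr a) (pr b)
    edge⇒ok {a} {b} ab ba e with tail a ≟ tail b | head a ≟ head b
    ... | yes refl | _ = same-tail
    ... | no _ | yes refl = same-head
    ... | no tt | no hh =
      compatible (Equivalence.to (E⇔ok tt hh (tail≢head a) ab ba (tail≢head b)) (λ _ _ → e))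

    -- Arrows with a common tail or head form an edge by permissibility; for four distinct ends the
    -- bits decide.
    ok⇒edge : ∀ {a b} → a ≢ b → tail a ≢ head b → tail b ≢ head a → Ok (pr a) (pr b) → Edge Δ a b
    ok⇒edge {a} {b} a≢b ab ba ok with tail a ≟ tail b | head a ≟ head b
    ... | yes refl | yes refl = contradiction refl a≢b
    ... | yes refl | no hh = proj₁ (proj₁ (proj₂ (proj₂ perm)) (tail a) (head a) (head b) (tail≢head a) ab hh)
    ... | no tt | yes refl = proj₂ (proj₁ (proj₂ (proj₂ perm)) (head a) (tail a) (tail b)
                               (tail≢head a ∘ sym) (ba ∘ sym) tt)
    ... | no tt | no hh = Equivalence.from (E⇔ok tt hh (tail≢head a) ab ba (tail≢head b))
                            (Ok-distinct tt hh ok) _ _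

    face⇒alternating : ∀ {F} → Face Δ F → Alternating F
    face⇒alternating {F} face a∈ b∈ eq with I , J , I∩J , all ← proj₁ perm F face =
      I∩J (_ , x∈p∩q⁺ ( proj₁ (All.lookup all a∈)
                      , subst (_∈ˢ J) (sym eq) (proj₂ (All.lookup all b∈))))

    face⇒ok : ∀ {F a b} → Face Δ F → a ∈ F → b ∈ F → Ok (pr a) (pr b)
    face⇒ok {F} {a} {b} face a∈ b∈ = edge⇒ok {a} {b} (alt a∈ b∈) (alt b∈ a∈)
      (down-closed Δ (λ { (here refl) → a∈ ; (there (here refl)) → b∈ }) face)
      where
      alt : Alternating F
      alt = face⇒alternating face

    clique⇒face : ∀ {F} → Alternating F → (∀ {a b} → a ∈ F → b ∈ F → Ok (pr a) (pr b)) → Face Δ F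
    clique⇒face {F} alt ok = proj₁ uf F λ a∈ b∈ a≢b → ok⇒edge a≢b (alt a∈ b∈) (alt b∈ a∈) (ok a∈ b∈)

-- The three conditions as conditions on the bits.

module Conditions where

  open Swaps
  open Hexagons
  open SwapOrder
  open Barycentres
  open Endpoints
  open Triangulation
  open EdgeTypes
  open import Data.Bool using (true; false; not; _∧_; _∨_)
  open import Data.Nat as ℕ using (ℕ; zero; suc; z≤n; s≤s)
  import Data.Nat.Properties as ℕₚ
  open import Data.Fin as Fin using (Fin; zero; suc; _≟_; _<?_; #_)
  open import Data.Fin.Properties using () renaming (all? to allFin?; any? to anyFin?)
  open import Data.Vec using (lookup)
  open import Data.Product using (_×_; _,_; ∃; ∃-syntax)
  open import Data.Sum using (_⊎_; inj₁; inj₂)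
  open import Function using (_∘_)
  open import Function.Bundles using (_⇔_; mk⇔; Equivalence)
  open import Relation.Nullary using (¬_; Dec; contradiction; ¬?; True; toWitness)
  open import Relation.Nullary.Decidable using (_×-dec_; _⊎-dec_; _→-dec_)
  open import Relation.Binary.PropositionalEquality

  private
    variable
      n : ℕ

  word : Kind → Word
  word thth = THTH
  word htht = HTHT
  word thht = THHT
  word htth = HTTH
  word tthh = TTHH
  word hhtt = HHTT

  Shape : Kind → Arrow n → Arrow n → (Fin 4 → Node n) → Set
  Shape thht = Crosses
  Shape htth = Crosses
  Shape _ = Nests

  oriented : Label → Node n → Node n → Node n × Node n
  oriented T x y = x , y
  oriented H x y = y , x

  -- The label at one end fixes the direction of c: pointing the other way, a tail of one arrow
  -- would be the head of another.
  orient : ∀ (a b c : Arrow n) → tail a ≢ head c → tail b ≢ head c → tail c ≢ head a → tail c ≢ head b →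
    ∀ L {x y} → HasLabel a b x L → Joins c x y → pr c ≡ oriented L x y
  orient a b c _ _ _ _ T _ (inj₁ (refl , refl)) = refl
  orient a b c ac _ _ _ T (inj₁ e) (inj₂ (_ , f)) = contradiction (sym (trans f e)) ac
  orient a b c _ bc _ _ T (inj₂ e) (inj₂ (_ , f)) = contradiction (sym (trans f e)) bc
  orient a b c _ _ ca _ H (inj₁ e) (inj₁ (f , _)) = contradiction (trans f e) ca
  orient a b c _ _ _ cb H (inj₂ e) (inj₁ (f , _)) = contradiction (trans f e) cb
  orient a b c _ _ _ _ H _ (inj₂ (refl , refl)) = refl

  fourDistinct? : (a b : Arrow n) → Dec (FourDistinct a b)
  fourDistinct? a b = allFin? λ k → allFin? λ l → ¬? (k ≟ l) →-dec ¬? (quad a b k ≟ quad a b l)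

  isEnumeration? : ∀ a b (p : Fin 4 → Node n) → Dec (IsEnumeration a b p)
  isEnumeration? a b p = fourDistinct? a b ×-dec (_ <? _) ×-dec (_ <? _) ×-dec (_ <? _)
    ×-dec allFin? λ k → anyFin? λ l → quad a b l ≟ p k

  hasLabel? : ∀ (a b : Arrow n) x L → Dec (HasLabel a b x L)
  hasLabel? a b x T = (x ≟ tail a) ⊎-dec (x ≟ tail b)
  hasLabel? a b x H = (x ≟ head a) ⊎-dec (x ≟ head b)

  hasType? : ∀ a b (p : Fin 4 → Node n) W → Dec (HasType a b p W)
  hasType? a b p W = allFin? λ k → hasLabel? a b (p k) (lookup W k)

  joins? : ∀ (a : Arrow n) x y → Dec (Joins a x y)
  joins? a x y = ((tail a ≟ x) ×-dec (head a ≟ y)) ⊎-dec ((tail a ≟ y) ×-dec (head a ≟ x))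

  shape? : ∀ κ a b (p : Fin 4 → Node n) → Dec (Shape κ a b p)
  shape? {n} κ a b p = go κ
    where
    nests? : Dec (Nests a b p)
    nests? = (joins? a _ _ ×-dec joins? b _ _) ⊎-dec (joins? a _ _ ×-dec joins? b _ _)
    crosses? : Dec (Crosses a b p)
    crosses? = (joins? a _ _ ×-dec joins? b _ _) ⊎-dec (joins? a _ _ ×-dec joins? b _ _)
    go : ∀ κ → Dec (Shape κ a b p)
    go thth = nests?
    go htht = nests?
    go thht = crosses?
    go htth = crosses?
    go tthh = nests?
    go hhtt = nests?

  module _ {m : ℕ} where
    base : Fin 4 → Node (5 ℕ.+ m)
    base = fin₄ (# 0) (# 1) (# 2) (# 3)

    base-mono : Mono base
    base-mono = chain-mono (s≤s z≤n) (s≤s (s≤s z≤n)) (s≤s (s≤s (s≤s z≤n)))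

    IsWitness : Kind → Set
    IsWitness κ = ∃[ a ] ∃[ b ] (IsEnumeration a b base × HasType a b base (word κ) × Shape κ a b base)

    witnessed : ∀ κ a b {_ : True (isEnumeration? a b base ×-dec hasType? a b base (word κ) ×-dec shape? κ a b base)} →
      IsWitness κ
    witnessed κ a b {t} = a , b , toWitness t

    -- Without an actual pair of each type, `Pairs` and `¬Pairs` could both hold vacuously.
    witness : ∀ κ → IsWitness κ
    witness thth = witnessed thth (arr (# 0) (# 3) λ ()) (arr (# 2) (# 1) λ ())
    witness htht = witnessed htht (arr (# 1) (# 2) λ ()) (arr (# 3) (# 0) λ ())
    witness thht = witnessed thht (arr (# 0) (# 2) λ ()) (arr (# 3) (# 1) λ ())
    witness htth = witnessed htth (arr (# 1) (# 3) λ ()) (arr (# 2) (# 0) λ ())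
    witness tthh = witnessed tthh (arr (# 0) (# 3) λ ()) (arr (# 1) (# 2) λ ())
    witness hhtt = witnessed hhtt (arr (# 2) (# 1) λ ()) (arr (# 3) (# 0) λ ())

  next : Fin 3 → Fin 3
  next zero = suc zero
  next (suc zero) = suc (suc zero)
  next (suc (suc zero)) = zero

  -- `R₀ i` and `R₁ i` stand for node i of a 3-cycle being joined to the first or to the second of
  -- two nodes of the other role. One instance of `R₁` spreads around the cycle and leaves no place
  -- for `R₀`.
  module _ (R₀ R₁ : Fin 3 → Set) (either : ∀ i → R₀ i ⊎ R₁ i) (exclusive : ∀ i → R₁ i → ¬ R₀ (next i)) where

    private
      advance : ∀ i → R₁ i → R₁ (next i)
      advance i r with either (next i)
      ... | inj₁ r₀ = contradiction r₀ (exclusive i r)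
      ... | inj₂ r₁ = r₁

      spread : ∀ i j → R₁ i → R₁ j
      spread zero zero r = r
      spread zero (suc zero) r = advance _ r
      spread zero (suc (suc zero)) r = advance _ (advance _ r)
      spread (suc zero) zero r = advance _ (advance _ r)
      spread (suc zero) (suc zero) r = r
      spread (suc zero) (suc (suc zero)) r = advance _ r
      spread (suc (suc zero)) zero r = advance _ r
      spread (suc (suc zero)) (suc zero) r = advance _ (advance _ r)
      spread (suc (suc zero)) (suc (suc zero)) r = r

    no-cycle : ∃ R₁ → ¬ ∃ R₀
    no-cycle (i , r₁) (zero , r₀) = exclusive _ (spread i (suc (suc zero)) r₁) r₀
    no-cycle (i , r₁) (suc zero , r₀) = exclusive _ (spread i zero r₁) r₀
    no-cycle (i , r₁) (suc (suc zero) , r₀) = exclusive _ (spread i (suc zero) r₁) r₀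

  fin₃ : {X : Set} → X → X → X → Fin 3 → X
  fin₃ x y z zero = x
  fin₃ x y z (suc zero) = y
  fin₃ x y z (suc (suc zero)) = z

  module TypeConditions {m : ℕ} (Δ : SimplicialComplex (5 ℕ.+ m))
                    (perm : IsPermissible Δ) (uf : IsUniformFlag Δ) where
    open Edges {5 ℕ.+ m} Δ perm uf (base {m}) (base-mono {m})
    open Order (6 ℕ.+ m) B

    Pairs ¬Pairs : Kind → Set
    Pairs κ = ∀ a b p → IsEnumeration a b p → HasType a b p (word κ) → Shape κ a b p → Edge Δ a b
    ¬Pairs κ = ∀ a b p → IsEnumeration a b p → HasType a b p (word κ) → Shape κ a b p → ¬ Edge Δ a b

    edge⇔E : ∀ {a b x y z w} → pr a ≡ (x , y) → pr b ≡ (z , w) → Edge Δ a b ⇔ E x y z w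
    edge⇔E {a} {b} refl refl = mk⇔ to from
      where
      to : Edge Δ a b → E (tail a) (head a) (tail b) (head b)
      to e _ _ = e
      from : E (tail a) (head a) (tail b) (head b) → Edge Δ a b
      from e = e (tail≢head a) (tail≢head b)

    edge⇔E′ : ∀ {a b x y z w} → pr a ≡ (x , y) → pr b ≡ (z , w) → Edge Δ a b ⇔ E z w x y
    edge⇔E′ e f = mk⇔ (E-sym ∘ Equivalence.to (edge⇔E e f)) (Equivalence.from (edge⇔E e f) ∘ E-sym)

    -- Once the labels orient both arrows, the nesting or crossing position is the twisted matching.
    -- The two halves of each shape differ by exchanging a and b.
    shape-edge : ∀ κ {a b p} → IsEnumeration a b p → HasType a b p (word κ) → Shape κ a b p →
      Edge Δ a b ⇔ Twisted (place κ) p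
    shape-edge κ {a} {b} {p} (distinct , _) type shape = go κ type shape
      where
      orient-a : ∀ L {x y} → HasLabel a b x L → Joins a x y → pr a ≡ oriented L x y
      orient-a = orient a b a (distinct (# 0) (# 2) λ ()) (distinct (# 1) (# 2) λ ())
                              (distinct (# 0) (# 2) λ ()) (distinct (# 0) (# 3) λ ())
      orient-b : ∀ L {x y} → HasLabel a b x L → Joins b x y → pr b ≡ oriented L x y
      orient-b = orient a b b (distinct (# 0) (# 3) λ ()) (distinct (# 1) (# 3) λ ())
                              (distinct (# 1) (# 2) λ ()) (distinct (# 1) (# 3) λ ())
      go : ∀ κ → HasType a b p (word κ) → Shape κ a b p → Edge Δ a b ⇔ Twisted (place κ) p
      go thth t (inj₁ (i , j)) = edge⇔E (orient-a T (t (# 0)) i) (orient-b H (t (# 1)) j)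
      go thth t (inj₂ (i , j)) = edge⇔E′ (orient-a H (t (# 1)) i) (orient-b T (t (# 0)) j)
      go htht t (inj₁ (i , j)) = edge⇔E′ (orient-a H (t (# 0)) i) (orient-b T (t (# 1)) j)
      go htht t (inj₂ (i , j)) = edge⇔E (orient-a T (t (# 1)) i) (orient-b H (t (# 0)) j)
      go thht t (inj₁ (i , j)) = edge⇔E (orient-a T (t (# 0)) i) (orient-b H (t (# 1)) j)
      go thht t (inj₂ (i , j)) = edge⇔E′ (orient-a H (t (# 1)) i) (orient-b T (t (# 0)) j)
      go htth t (inj₁ (i , j)) = edge⇔E′ (orient-a H (t (# 0)) i) (orient-b T (t (# 1)) j)
      go htth t (inj₂ (i , j)) = edge⇔E (orient-a T (t (# 1)) i) (orient-b H (t (# 0)) j)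
      go tthh t (inj₁ (i , j)) = edge⇔E (orient-a T (t (# 0)) i) (orient-b T (t (# 1)) j)
      go tthh t (inj₂ (i , j)) = edge⇔E′ (orient-a T (t (# 1)) i) (orient-b T (t (# 0)) j)
      go hhtt t (inj₁ (i , j)) = edge⇔E′ (orient-a H (t (# 0)) i) (orient-b H (t (# 1)) j)
      go hhtt t (inj₂ (i , j)) = edge⇔E (orient-a H (t (# 1)) i) (orient-b H (t (# 0)) j)

    enumeration-mono : ∀ {a b : Arrow (5 ℕ.+ m)} {p} → IsEnumeration a b p → Mono p
    enumeration-mono (_ , x , y , z , _) = chain-mono x y z

    decided-true : ∀ {b A C} → b ≡ true → Decided b A C → C
    decided-true refl (_ , c) = c

    decided-false : ∀ {b A C} → b ≡ false → Decided b A C → ¬ C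
    decided-false refl (_ , ¬c) = ¬c

    twist⇒pairs : ∀ κ → twist B κ ≡ true → Pairs κ
    twist⇒pairs κ eq a b p en ty sh = Equivalence.from (shape-edge κ {a} {b} {p} en ty sh)
      (decided-true eq (decided κ (enumeration-mono {a} {b} en)))

    ¬twist⇒¬pairs : ∀ κ → twist B κ ≡ false → ¬Pairs κ
    ¬twist⇒¬pairs κ eq a b p en ty sh e =
      decided-false eq (decided κ (enumeration-mono {a} {b} en))
        (Equivalence.to (shape-edge κ {a} {b} {p} en ty sh) e)

    pairs-exclusive : ∀ κ → Pairs κ → ¬ ¬Pairs κ
    pairs-exclusive κ ps ¬ps with a , b , en , ty , sh ← witness κ = ¬ps a b base en ty sh (ps a b base en ty sh)

    pairs⇒twist : ∀ κ → Pairs κ → twist B κ ≡ true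
    pairs⇒twist κ ps with twist B κ in eq
    ... | true = refl
    ... | false = contradiction (¬twist⇒¬pairs κ eq) (pairs-exclusive κ ps)

    ¬pairs⇒¬twist : ∀ κ → ¬Pairs κ → twist B κ ≡ false
    ¬pairs⇒¬twist κ ¬ps with twist B κ in eq
    ... | false = refl
    ... | true = contradiction ¬ps (pairs-exclusive κ (twist⇒pairs κ eq))

    false≢true : ∀ {x} → x ≡ false → x ≢ true
    false≢true refl ()

    ¬twist⇒¬Pairs : ∀ κ → twist B κ ≡ false → ¬ Pairs κ
    ¬twist⇒¬Pairs κ eq ps = false≢true eq (pairs⇒twist κ ps)

    twist⇒¬¬Pairs : ∀ κ → twist B κ ≡ true → ¬ ¬Pairs κ
    twist⇒¬¬Pairs κ eq ¬ps = false≢true (¬pairs⇒¬twist κ ¬ps) eq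

    -- The bits B of Δ do not reduce, so they are matched on through an equal b.
    valid⇒conditions : ∀ b → B ≡ b → valid b ≡ true →
      ExactlyOne3 (Condition1 Δ) (Condition2 Δ) (Condition3 Δ)
    valid⇒conditions b eq = go b (λ κ → cong (λ b → twist b κ) eq)
      where
      go : ∀ b → (∀ κ → twist B κ ≡ twist b κ) → valid b ≡ true →
        ExactlyOne3 (Condition1 Δ) (Condition2 Δ) (Condition3 Δ)
      go (bits false false false false e f) tw _ = inj₁
        ( (¬twist⇒¬pairs thth (tw thth) , ¬twist⇒¬pairs htht (tw htht)
          , ¬twist⇒¬pairs htth (tw htth) , ¬twist⇒¬pairs thht (tw thht))
        , (λ (ps , _) → ¬twist⇒¬Pairs thth (tw thth) ps)
        , λ { (inj₁ (ps , _) , _) → ¬twist⇒¬Pairs thth (tw thth) ps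
            ; (inj₂ (_ , ps) , _) → ¬twist⇒¬Pairs htht (tw htht) ps })
      go (bits true true true true e f) tw _ = inj₂ (inj₁
        ( (λ (¬ps , _) → twist⇒¬¬Pairs thth (tw thth) ¬ps)
        , (twist⇒pairs thth (tw thth) , twist⇒pairs htht (tw htht)
          , twist⇒pairs htth (tw htth) , twist⇒pairs thht (tw thht))
        , λ { (inj₁ (_ , ¬ps) , _) → ¬ps (twist⇒pairs htht (tw htht))
            ; (inj₂ (¬ps , _) , _) → ¬ps (twist⇒pairs thth (tw thth)) }))
      go (bits true false c d e f) tw v = inj₂ (inj₂
        ( (λ (¬ps , _) → twist⇒¬¬Pairs thth (tw thth) ¬ps)
        , (λ (_ , ps , _) → ¬twist⇒¬Pairs htht (tw htht) ps)
        , inj₁ (twist⇒pairs thth (tw thth) , ¬twist⇒¬Pairs htht (tw htht))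
        , nest c d e f (tw thht) (tw htth) (tw tthh) (tw hhtt) v))
        where
        nest : ∀ c d e f → twist B thht ≡ c → twist B htth ≡ d → twist B tthh ≡ e → twist B hhtt ≡ f →
          valid (bits true false c d e f) ≡ true → Pairs thht × Pairs htth → Pairs tthh × Pairs hhtt
        nest false d e f x y z w v (ps , _) = contradiction ps (¬twist⇒¬Pairs thht x)
        nest true false e f x y z w v (_ , ps) = contradiction ps (¬twist⇒¬Pairs htth y)
        nest true true true true x y z w v _ = twist⇒pairs tthh z , twist⇒pairs hhtt w
      go (bits false true c d e f) tw v = inj₂ (inj₂
        ( (λ (_ , ¬ps , _) → twist⇒¬¬Pairs htht (tw htht) ¬ps)
        , (λ (ps , _) → ¬twist⇒¬Pairs thth (tw thth) ps)
        , inj₂ (¬twist⇒¬Pairs thth (tw thth) , twist⇒pairs htht (tw htht))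
        , nest c d e f (tw thht) (tw htth) (tw tthh) (tw hhtt) v))
        where
        nest : ∀ c d e f → twist B thht ≡ c → twist B htth ≡ d → twist B tthh ≡ e → twist B hhtt ≡ f →
          valid (bits false true c d e f) ≡ true → Pairs thht × Pairs htth → Pairs tthh × Pairs hhtt
        nest false d e f x y z w v (ps , _) = contradiction ps (¬twist⇒¬Pairs thht x)
        nest true false e f x y z w v (_ , ps) = contradiction ps (¬twist⇒¬Pairs htth y)
        nest true true true true x y z w v _ = twist⇒pairs tthh z , twist⇒pairs hhtt w

    conditions⇒valid : ExactlyOne3 (Condition1 Δ) (Condition2 Δ) (Condition3 Δ) → valid B ≡ true
    conditions⇒valid (inj₁ ((a , b , d , c) , _))
      rewrite ¬pairs⇒¬twist thth a | ¬pairs⇒¬twist htht b | ¬pairs⇒¬twist thht c | ¬pairs⇒¬twist htth d = refl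
    conditions⇒valid (inj₂ (inj₁ (_ , (a , b , d , c) , _)))
      rewrite pairs⇒twist thth a | pairs⇒twist htht b | pairs⇒twist thht c | pairs⇒twist htth d = refl
    conditions⇒valid (inj₂ (inj₂ (_ , _ , one , nest))) = condition3 one
      where
      e∧f : ∀ c d → twist B thht ≡ c → twist B htth ≡ d → not (c ∧ d) ∨ (twist B tthh ∧ twist B hhtt) ≡ true
      e∧f false d _ _ = refl
      e∧f true false _ _ = refl
      e∧f true true c d with e , f ← nest (twist⇒pairs thht c , twist⇒pairs htth d)
        rewrite pairs⇒twist tthh e | pairs⇒twist hhtt f = refl
      valid-≢ : ∀ a → twist B thth ≡ a → twist B htht ≡ not a → valid B ≡ true
      valid-≢ false a b rewrite a | b = e∧f _ _ refl refl
      valid-≢ true a b rewrite a | b = e∧f _ _ refl refl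
      ¬pairs⇒false : ∀ κ → ¬ Pairs κ → twist B κ ≡ false
      ¬pairs⇒false κ ¬ps with twist B κ in eq
      ... | false = refl
      ... | true = contradiction (twist⇒pairs κ eq) ¬ps
      condition3 : ExactlyOne (Pairs thth) (Pairs htht) → valid B ≡ true
      condition3 (inj₁ (a , ¬b)) = valid-≢ true (pairs⇒twist thth a) (¬pairs⇒false htht ¬b)
      condition3 (inj₂ (¬a , b)) = valid-≢ false (¬pairs⇒false thth ¬a) (pairs⇒twist htht b)

-- Bits that are not valid do not come from a triangulation.

module Necessity where

  open Swaps
  open Hexagons
  open SwapOrder
  open Barycentres
  open Endpoints
  open Triangulation
  open EdgeTypes
  open Conditions
  open import Data.Bool using (true; false)
  open import Data.Nat as ℕ using (ℕ; zero; suc; z≤n; s≤s)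
  import Data.Nat.Properties as ℕₚ
  open import Data.Fin as Fin using (Fin; zero; suc; _≟_; #_)
  open import Data.Fin.Properties using () renaming (all? to allFin?)
  open import Data.Rational using (_*_)
  open import Data.Rational.Properties using (*-assoc; *-identityˡ)
  open import Data.List using (List; []; _∷_; map; length)
  open import Data.List.Membership.Propositional using (_∈_)
  open import Data.List.Membership.Propositional.Properties using (∈-map⁺; ∈-map⁻; ∈-++⁺ˡ)
  open import Data.List.Relation.Unary.Any using (here; there)
  open import Data.List.Relation.Binary.Subset.Propositional using (_⊆_)
  open import Data.List.Relation.Unary.All as All using (All; []; _∷_; all?)
  open import Data.List.Relation.Unary.AllPairs as AllPairs using ([]; _∷_; allPairs?)
  open import Data.List.Relation.Unary.Unique.Propositional using (Unique)
  open import Data.List.Relation.Binary.Permutation.Propositional using (_↭_; ↭-sym)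
  open import Data.List.Relation.Binary.Permutation.Propositional.Properties using (∈-resp-↭)
  open import Data.Vec using (lookup)
  open import Data.Product using (_×_; _,_; proj₁; proj₂; ∃; ∃-syntax)
  open import Data.Sum using (_⊎_; inj₁; inj₂)
  open import Data.Empty using (⊥; ⊥-elim)
  open import Function.Bundles using (Equivalence)
  open import Relation.Nullary using (¬_; Dec; contradiction; ¬?; True; toWitness)
  open import Relation.Nullary.Decidable using (_×-dec_)
  open import Relation.Binary.PropositionalEquality

  -- Since L alternates, its barycentre lies on the boundary and hence in a face. A multiset l on
  -- that face represents the same point, and alternation of both lists gives it the same sets of
  -- tails and heads.
  covered : ∀ {n} {Δ : SimplicialComplex n} → RepresentsTriangulation Δ → ∀ L → NonEmpty L → Alternating L →
    (∀ {F} → Face Δ F → Alternating F) →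
    ∃[ l ] ((∀ {a b} → a ∈ l → b ∈ l → Edge Δ a b)
          × (∀ {t} → t ∈ map tail L → ∃[ a ] (a ∈ l × tail a ≡ t × head a ∈ map head L))
          × (∀ {h} → h ∈ map head L → ∃[ a ] (a ∈ l × head a ≡ h × tail a ∈ map tail L)))
  covered {n} {Δ} (_ , _ , _ , cover) L L≢[] alt face-alt =
    let r , _ , inv = reciprocal (length L) L≢[]
        bary : Barycentre L (λ k → r * S L k)
        bary k = trans (sym (*-assoc (ι (length L)) r (S L k)))
                       (trans (cong (_* S L k) inv) (*-identityˡ (S L k)))
        F , face , hF = cover _ (barycentre⇒boundary L L≢[] alt bary)
        l , l⊆F , l≢[] , bary′ = hull⇒barycentre F hF
    in l , ends L l L≢[] l≢[] alt (λ a∈ b∈ → face-alt face (l⊆F a∈) (l⊆F b∈)) face l⊆F (repeat-S L l bary bary′)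
    where
    ∈-repeat : ∀ {X : Set} {x : X} m l → m ≢ 0 → x ∈ l → x ∈ repeat m l
    ∈-repeat zero l m≢0 _ = contradiction refl m≢0
    ∈-repeat (suc m) l _ x∈ = ∈-++⁺ˡ x∈
    ends : ∀ L l {F} → NonEmpty L → NonEmpty l → Alternating L → Alternating l → Face Δ F → l ⊆ F →
      (∀ k → S (repeat (length l) L) k ≡ S (repeat (length L) l) k) →
      (∀ {a b} → a ∈ l → b ∈ l → Edge Δ a b)
          × (∀ {t} → t ∈ map tail L → ∃[ a ] (a ∈ l × tail a ≡ t × head a ∈ map head L))
          × (∀ {h} → h ∈ map head L → ∃[ a ] (a ∈ l × head a ≡ h × tail a ∈ map tail L))
    ends L l {F} L≢[] l≢[] alt alt-l face l⊆F eq = edge , tail-of , head-of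
      where
      edge : ∀ {a b} → a ∈ l → b ∈ l → Edge Δ a b
      edge a∈ b∈ = down-closed Δ (λ { (here refl) → l⊆F a∈ ; (there (here refl)) → l⊆F b∈ }) face
      K = repeat (length l) L
      K′ = repeat (length L) l
      alt-K : Alternating K
      alt-K a∈ b∈ = alt (repeat-⊆ (length l) L a∈) (repeat-⊆ (length l) L b∈)
      alt-K′ : Alternating K′
      alt-K′ a∈ b∈ = alt-l (repeat-⊆ (length L) l a∈) (repeat-⊆ (length L) l b∈)
      tails≈ : map tail K ↭ map tail K′
      tails≈ = tails-↭ K K′ alt-K alt-K′ eq
      heads≈ : map head K ↭ map head K′
      heads≈ = heads-↭ K K′ alt-K alt-K′ eq
      into : (f : Arrow n → Node n) → map f K ↭ map f K′ → ∀ {x} → x ∈ map f L → ∃[ a ] (a ∈ l × f a ≡ x)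
      into f p x∈ =
        let c , c∈ , x≡ = ∈-map⁻ f x∈
            a , a∈ , fc≡ = ∈-map⁻ f (∈-resp-↭ p (∈-map⁺ f (∈-repeat (length l) L l≢[] c∈)))
        in a , repeat-⊆ (length L) l a∈ , trans (sym fc≡) (sym x≡)
      back : (f : Arrow n → Node n) → map f K ↭ map f K′ → ∀ {a} → a ∈ l → f a ∈ map f L
      back f p {a} a∈ =
        let c , c∈ , fa≡ = ∈-map⁻ f (∈-resp-↭ (↭-sym p) (∈-map⁺ f (∈-repeat (length L) l L≢[] a∈)))
        in subst (_∈ map f L) (sym fa≡) (∈-map⁺ f (repeat-⊆ (length l) L c∈))
      tail-of : ∀ {t} → t ∈ map tail L → ∃[ a ] (a ∈ l × tail a ≡ t × head a ∈ map head L)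
      tail-of t∈ = let a , a∈ , e = into tail tails≈ t∈ in a , a∈ , e , back head heads≈ a∈
      head-of : ∀ {h} → h ∈ map head L → ∃[ a ] (a ∈ l × head a ≡ h × tail a ∈ map tail L)
      head-of h∈ = let a , a∈ , e = into head heads≈ h∈ in a , a∈ , e , back tail tails≈ a∈

  module Converse {m : ℕ} (Δ : SimplicialComplex (5 ℕ.+ m))
                  (perm : IsPermissible Δ) (uf : IsUniformFlag Δ) where
    private
      n : ℕ
      n = 5 ℕ.+ m

    open Edges {n} Δ perm uf (base {m}) (base-mono {m})
    open Order (suc n) B

    edge⇒E : ∀ {a b t h t′ h′} → tail a ≡ t → head a ≡ h → tail b ≡ t′ → head b ≡ h′ → Edge Δ a b → E t h t′ h′
    edge⇒E refl refl refl refl e _ _ = e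

    not-both : ∀ {t t′ h h′} → t ≢ t′ → h ≢ h′ → t ≢ h → t ≢ h′ → t′ ≢ h → t′ ≢ h′ →
      E t h t′ h′ → ¬ E t h′ t′ h
    not-both tt hh a b c d e e′ with exactly-one tt hh a b c d
    ... | inj₁ (_ , ¬e′) = ¬e′ e′
    ... | inj₂ (¬e , _) = ¬e e

    private
      list₃ : {X : Set} → (Fin 3 → X) → List X
      list₃ f = f zero ∷ f (suc zero) ∷ f (suc (suc zero)) ∷ []

      ∈-list₃ : ∀ {X : Set} (f : Fin 3 → X) i → f i ∈ list₃ f
      ∈-list₃ f zero = here refl
      ∈-list₃ f (suc zero) = there (here refl)
      ∈-list₃ f (suc (suc zero)) = there (there (here refl))

      list₃-∈ : ∀ {X : Set} (f : Fin 3 → X) {x} → x ∈ list₃ f → ∃[ i ] x ≡ f i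
      list₃-∈ f (here e) = zero , e
      list₃-∈ f (there (here e)) = suc zero , e
      list₃-∈ f (there (there (here e))) = suc (suc zero) , e

    -- By `cyc`, t cannot feed the head after one that t′ feeds. Yet each head is fed by t or t′ and
    -- both tails occur, which `no-cycle` refutes.
    cyclic-heads : ∀ (t t′ : Node n) (h : Fin 3 → Node n) → t ≢ t′ → (∀ i → h i ≢ h (next i)) →
      (t≢ : ∀ i → t ≢ h i) (t′≢ : ∀ i → t′ ≢ h i) → (∀ i → E t (h i) t′ (h (next i))) →
      ¬ RepresentsTriangulation Δ
    cyclic-heads t t′ h tt′ hh t≢ t′≢ cyc rep =
      let l , edge , tail-of , head-of = covered {Δ = Δ} rep L (λ ()) alt face⇒alternating
      in conclude l edge tail-of head-of
      where
      L : List (Arrow n)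
      -- Only the ends count: all three heads and both tails have to occur.
      L = arr t (h zero) (t≢ _) ∷ arr t (h (suc zero)) (t≢ _) ∷ arr t′ (h (suc (suc zero))) (t′≢ _) ∷ []
      tail-cases : ∀ {x} → x ∈ map tail L → x ≡ t ⊎ x ≡ t′
      tail-cases (here e) = inj₁ e
      tail-cases (there (here e)) = inj₁ e
      tail-cases (there (there (here e))) = inj₂ e
      alt : Alternating L
      alt a∈ b∈ eq with tail-cases (∈-map⁺ tail a∈) | list₃-∈ h (∈-map⁺ head b∈)
      ... | inj₁ e | i , f = t≢ i (trans (sym e) (trans eq f))
      ... | inj₂ e | i , f = t′≢ i (trans (sym e) (trans eq f))
      conclude : ∀ l → (∀ {a b} → a ∈ l → b ∈ l → Edge Δ a b) →
        (∀ {t} → t ∈ map tail L → ∃[ a ] (a ∈ l × tail a ≡ t × head a ∈ map head L)) →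
        (∀ {h} → h ∈ map head L → ∃[ a ] (a ∈ l × head a ≡ h × tail a ∈ map tail L)) → ⊥
      conclude l edge tail-of head-of = no-cycle (Feeds t) (Feeds t′) either exclusive
        (occurs (there (there (here refl)))) (occurs (here refl))
        where
        Feeds : Node n → Fin 3 → Set
        Feeds s i = ∃[ a ] (a ∈ l × tail a ≡ s × head a ≡ h i)
        either : ∀ i → Feeds t i ⊎ Feeds t′ i
        either i with head-of (∈-list₃ h i)
        ... | a , a∈ , e , t∈ with tail-cases t∈
        ...   | inj₁ f = inj₁ (a , a∈ , f , e)
        ...   | inj₂ f = inj₂ (a , a∈ , f , e)
        occurs : ∀ {s} → s ∈ map tail L → ∃ (Feeds s)
        occurs s∈ = let a , a∈ , e , h∈ = tail-of s∈ ; i , f = list₃-∈ h h∈ in i , a , a∈ , e , f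
        exclusive : ∀ i → Feeds t′ i → ¬ Feeds t (next i)
        exclusive i (a , a∈ , ta , ha) (b , b∈ , tb , hb) =
          not-both tt′ (hh i) (t≢ i) (t≢ (next i)) (t′≢ i) (t′≢ (next i)) (cyc i)
            (edge⇒E tb hb ta ha (edge b∈ a∈))

    -- The mirror image of `cyclic-heads` under reversal of all arrows.
    cyclic-tails : ∀ (h h′ : Node n) (t : Fin 3 → Node n) → h ≢ h′ → (∀ i → t i ≢ t (next i)) →
      (≢h : ∀ i → t i ≢ h) (≢h′ : ∀ i → t i ≢ h′) → (∀ i → E (t i) h (t (next i)) h′) →
      ¬ RepresentsTriangulation Δ
    cyclic-tails h h′ t hh′ tt ≢h ≢h′ cyc rep =
      let l , edge , tail-of , head-of = covered {Δ = Δ} rep L (λ ()) alt face⇒alternating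
      in conclude l edge tail-of head-of
      where
      L : List (Arrow n)
      L = arr (t zero) h (≢h _) ∷ arr (t (suc zero)) h (≢h _) ∷ arr (t (suc (suc zero))) h′ (≢h′ _) ∷ []
      head-cases : ∀ {x} → x ∈ map head L → x ≡ h ⊎ x ≡ h′
      head-cases (here e) = inj₁ e
      head-cases (there (here e)) = inj₁ e
      head-cases (there (there (here e))) = inj₂ e
      alt : Alternating L
      alt a∈ b∈ eq with list₃-∈ t (∈-map⁺ tail a∈) | head-cases (∈-map⁺ head b∈)
      ... | i , f | inj₁ e = ≢h i (trans (sym f) (trans eq e))
      ... | i , f | inj₂ e = ≢h′ i (trans (sym f) (trans eq e))
      conclude : ∀ l → (∀ {a b} → a ∈ l → b ∈ l → Edge Δ a b) →
        (∀ {t} → t ∈ map tail L → ∃[ a ] (a ∈ l × tail a ≡ t × head a ∈ map head L)) →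
        (∀ {h} → h ∈ map head L → ∃[ a ] (a ∈ l × head a ≡ h × tail a ∈ map tail L)) → ⊥
      conclude l edge tail-of head-of = no-cycle (Feeds h) (Feeds h′) either exclusive
        (occurs (there (there (here refl)))) (occurs (here refl))
        where
        Feeds : Node n → Fin 3 → Set
        Feeds s i = ∃[ a ] (a ∈ l × head a ≡ s × tail a ≡ t i)
        either : ∀ i → Feeds h i ⊎ Feeds h′ i
        either i with tail-of (∈-list₃ t i)
        ... | a , a∈ , e , h∈ with head-cases h∈
        ...   | inj₁ f = inj₁ (a , a∈ , f , e)
        ...   | inj₂ f = inj₂ (a , a∈ , f , e)
        occurs : ∀ {s} → s ∈ map head L → ∃ (Feeds s)
        occurs s∈ = let a , a∈ , e , t∈ = head-of s∈ ; i , f = list₃-∈ t t∈ in i , a , a∈ , e , f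
        exclusive : ∀ i → Feeds h′ i → ¬ Feeds h (next i)
        exclusive i (a , a∈ , ha , ta) (b , b∈ , hb , tb) =
          not-both (tt i) hh′ (≢h i) (≢h′ i) (≢h (next i)) (≢h′ (next i)) (cyc i)
            (edge⇒E ta ha tb hb (edge a∈ b∈))

    Apart : List (Node n × Node n) → Set
    Apart ps = All (λ a → All (λ c → proj₁ a ≢ proj₂ c) ps) ps

    apart? : ∀ ps → Dec (Apart ps)
    apart? ps = all? (λ a → all? (λ c → ¬? (proj₁ a ≟ proj₂ c)) ps) ps

    Compatible : Bits → List (Node n × Node n) → Set
    Compatible b ps = All (λ a → All (Order.Ok (suc n) b a) ps) ps

    compatible? : ∀ b ps → Dec (Compatible b ps)
    compatible? b ps = all? (λ a → all? (Order.Ok? (suc n) b a) ps) ps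

    unique? : ∀ (xs : List (Node n)) → Dec (Unique xs)
    unique? = allPairs? (λ x y → ¬? (x ≟ y))

    -- The union of two complementary matchings, listed along the closed walk.
    hexagon : (t₀ h₀ t₁ h₁ t₂ h₂ : Node n) → List (Node n × Node n)
    hexagon t₀ h₀ t₁ h₁ t₂ h₂ =
      (t₀ , h₀) ∷ (t₁ , h₀) ∷ (t₁ , h₁) ∷ (t₂ , h₁) ∷ (t₂ , h₂) ∷ (t₀ , h₂) ∷ []

    -- If the six arrows were pairwise compatible, flagness would make them a face, whose graph is a
    -- 6-cycle.
    hexagon-incompatible : ∀ {b} → B ≡ b → ∀ t₀ h₀ t₁ h₁ t₂ h₂ →
      Unique (t₀ ∷ h₀ ∷ t₁ ∷ h₁ ∷ t₂ ∷ h₂ ∷ []) → Apart (hexagon t₀ h₀ t₁ h₁ t₂ h₂) →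
      ¬ Compatible b (hexagon t₀ h₀ t₁ h₁ t₂ h₂)
    hexagon-incompatible B≡b t₀ h₀ t₁ h₁ t₂ h₂ unique alternating clique =
        proj₁ (proj₂ perm) F (clique⇒face alt ok) (t₀ ∷ h₀ ∷ t₁ ∷ h₁ ∷ t₂ ∷ h₂ ∷ [])
          (unique , s≤s (s≤s (s≤s z≤n))
          , ((_ , f₀ , inj₁ (refl , refl)) , (_ , f₁ , inj₂ (refl , refl)) , (_ , f₂ , inj₁ (refl , refl))
            , (_ , f₃ , inj₂ (refl , refl)) , (_ , f₄ , inj₁ (refl , refl)) , _)
          , (_ , f₅ , inj₂ (refl , refl)))
        where
        pairs : List (Node n × Node n)
        pairs = hexagon t₀ h₀ t₁ h₁ t₂ h₂
        apart : ∀ {a c} → a ∈ pairs → c ∈ pairs → proj₁ a ≢ proj₂ c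
        apart a∈ c∈ = All.lookup (All.lookup alternating a∈) c∈
        F : List (Arrow n)
        F = arr t₀ h₀ (apart (here refl) (here refl))
          ∷ arr t₁ h₀ (apart (there (here refl)) (here refl))
          ∷ arr t₁ h₁ (apart (there (here refl)) (there (there (here refl))))
          ∷ arr t₂ h₁ (apart (there (there (there (here refl)))) (there (there (here refl))))
          ∷ arr t₂ h₂ (apart (there (there (there (here refl)))) (there (there (there (there (here refl))))))
          ∷ arr t₀ h₂ (apart (here refl) (there (there (there (there (here refl))))))
          ∷ []
        alt : Alternating F
        alt a∈ c∈ = apart (∈-map⁺ pr a∈) (∈-map⁺ pr c∈)
        ok : ∀ {a c} → a ∈ F → c ∈ F → Ok (pr a) (pr c)
        ok {a} {c} a∈ c∈ = subst (λ b → Order.Ok (suc n) b (pr a) (pr c)) (sym B≡b)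
          (All.lookup (All.lookup clique (∈-map⁺ pr a∈)) (∈-map⁺ pr c∈))
        f₀ : arr t₀ h₀ _ ∈ F
        f₀ = here refl
        f₁ : arr t₁ h₀ _ ∈ F
        f₁ = there (here refl)
        f₂ : arr t₁ h₁ _ ∈ F
        f₂ = there (there (here refl))
        f₃ : arr t₂ h₁ _ ∈ F
        f₃ = there (there (there (here refl)))
        f₄ : arr t₂ h₂ _ ∈ F
        f₄ = there (there (there (there (here refl))))
        f₅ : arr t₀ h₂ _ ∈ F
        f₅ = there (there (there (there (there (here refl)))))

    hexagon-excluded : ∀ b → B ≡ b → ∀ t₀ h₀ t₁ h₁ t₂ h₂ →
      {True (unique? (t₀ ∷ h₀ ∷ t₁ ∷ h₁ ∷ t₂ ∷ h₂ ∷ []))} → {True (apart? (hexagon t₀ h₀ t₁ h₁ t₂ h₂))} →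
      {True (compatible? b (hexagon t₀ h₀ t₁ h₁ t₂ h₂))} → ⊥
    hexagon-excluded b B≡b t₀ h₀ t₁ h₁ t₂ h₂ {u} {a} {c} =
      hexagon-incompatible B≡b t₀ h₀ t₁ h₁ t₂ h₂ (toWitness u) (toWitness a) (toWitness c)

    edge-by-bits : ∀ {b} → B ≡ b → ∀ t h t′ h′ →
      {True (¬? (t ≟ t′) ×-dec ¬? (h ≟ h′) ×-dec ¬? (t ≟ h) ×-dec ¬? (t ≟ h′) ×-dec ¬? (t′ ≟ h) ×-dec ¬? (t′ ≟ h′))} →
      okᵇ b (P t) (Q h) (P t′) (Q h′) ≡ true → E t h t′ h′
    edge-by-bits B≡b t h t′ h′ {w} ok with tt , hh , x , y , z , u ← toWitness w =
      Equivalence.from (E⇔ok tt hh x y z u)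
        (subst (λ b → okᵇ b (P t) (Q h) (P t′) (Q h′) ≡ true) (sym B≡b) ok)

    private
      fin₃-elim : ∀ {P : Fin 3 → Set} → P zero → P (suc zero) → P (suc (suc zero)) → ∀ i → P i
      fin₃-elim a b c zero = a
      fin₃-elim a b c (suc zero) = b
      fin₃-elim a b c (suc (suc zero)) = c

    module _ (rep : RepresentsTriangulation Δ) where

      private
        evens : Fin 3 → Node n
        evens = fin₃ (# 0) (# 2) (# 4)

        evens-distinct : ∀ i → evens i ≢ evens (next i)
        evens-distinct = fin₃-elim (λ ()) (λ ()) (λ ())

      -- Dropping the last, first or middle head of HTHTH leaves HTHT, THTH or HTTH. If the first
      -- two bits agree and the third differs, the three edges are cyclic.
      cyclic-HTHTH : ∀ t t′ →
        {True (¬? (t ≟ t′) ×-dec allFin? (λ i → ¬? (t ≟ evens i)) ×-dec allFin? (λ i → ¬? (t′ ≟ evens i)))} →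
        E t (# 0) t′ (# 2) → E t (# 2) t′ (# 4) → E t (# 4) t′ (# 0) → ⊥
      cyclic-HTHTH t t′ {w} x y z with a , p , q ← toWitness w =
        cyclic-heads t t′ evens a evens-distinct p q (fin₃-elim x y z) rep

      -- Dropping the last, first or middle tail of THTHT leaves THTH, HTHT or THHT.
      cyclic-THTHT : ∀ h h′ →
        {True (¬? (h ≟ h′) ×-dec allFin? (λ i → ¬? (evens i ≟ h)) ×-dec allFin? (λ i → ¬? (evens i ≟ h′)))} →
        E (# 0) h (# 2) h′ → E (# 2) h (# 4) h′ → E (# 4) h (# 0) h′ → ⊥
      cyclic-THTHT h h′ {w} x y z with a , p , q ← toWitness w =
        cyclic-tails h h′ evens a evens-distinct p q (fin₃-elim x y z) rep

    represents⇒valid : ∀ b → B ≡ b → RepresentsTriangulation Δ → valid b ≡ true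
    represents⇒valid (bits false false false false _ _) eq rep = refl
    represents⇒valid (bits true true true true _ _) eq rep = refl
    represents⇒valid (bits false false true _ _ _) eq rep = ⊥-elim (cyclic-THTHT rep (# 1) (# 3)
      (edge-by-bits eq (# 0) (# 1) (# 2) (# 3) refl)
      (edge-by-bits eq (# 2) (# 1) (# 4) (# 3) refl)
      (edge-by-bits eq (# 4) (# 1) (# 0) (# 3) refl))
    represents⇒valid (bits true true false _ _ _) eq rep = ⊥-elim (cyclic-THTHT rep (# 3) (# 1)
      (edge-by-bits eq (# 0) (# 3) (# 2) (# 1) refl)
      (edge-by-bits eq (# 2) (# 3) (# 4) (# 1) refl)
      (edge-by-bits eq (# 4) (# 3) (# 0) (# 1) refl))
    represents⇒valid (bits false false false true _ _) eq rep = ⊥-elim (cyclic-HTHTH rep (# 1) (# 3)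
      (edge-by-bits eq (# 1) (# 0) (# 3) (# 2) refl)
      (edge-by-bits eq (# 1) (# 2) (# 3) (# 4) refl)
      (edge-by-bits eq (# 1) (# 4) (# 3) (# 0) refl))
    represents⇒valid (bits true true true false _ _) eq rep = ⊥-elim (cyclic-HTHTH rep (# 3) (# 1)
      (edge-by-bits eq (# 3) (# 0) (# 1) (# 2) refl)
      (edge-by-bits eq (# 3) (# 2) (# 1) (# 4) refl)
      (edge-by-bits eq (# 3) (# 4) (# 1) (# 0) refl))
    represents⇒valid (bits false true false _ _ _) eq rep = refl
    represents⇒valid (bits false true true false _ _) eq rep = refl
    represents⇒valid (bits false true true true true true) eq rep = refl
    -- With tails at 0, 2, 4 the word THTHTH contains TTHH, at 0, 2, 3, 5, but never HHTT; so one
    -- hexagon serves for both values of the last bit.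
    represents⇒valid (bits false true true true false false) eq rep =
      ⊥-elim (hexagon-excluded _ eq (# 0) (# 1) (# 4) (# 5) (# 2) (# 3))
    represents⇒valid (bits false true true true false true) eq rep =
      ⊥-elim (hexagon-excluded _ eq (# 0) (# 1) (# 4) (# 5) (# 2) (# 3))
    -- Now HHTT is at fault. It occurs in HTHTHT, which never contains TTHH, so the tails move to 1,
    -- 3, 5.
    represents⇒valid (bits false true true true true false) eq rep =
      ⊥-elim (hexagon-excluded _ eq (# 1) (# 2) (# 5) (# 0) (# 3) (# 4))
    represents⇒valid (bits true false false _ _ _) eq rep = refl
    represents⇒valid (bits true false true false _ _) eq rep = refl
    represents⇒valid (bits true false true true true true) eq rep = refl
    represents⇒valid (bits true false true true false false) eq rep =
      ⊥-elim (hexagon-excluded _ eq (# 0) (# 3) (# 4) (# 1) (# 2) (# 5))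
    represents⇒valid (bits true false true true false true) eq rep =
      ⊥-elim (hexagon-excluded _ eq (# 0) (# 3) (# 4) (# 1) (# 2) (# 5))
    represents⇒valid (bits true false true true true false) eq rep =
      ⊥-elim (hexagon-excluded _ eq (# 1) (# 0) (# 3) (# 2) (# 5) (# 4))

open import Data.Nat using (suc; s≤s)
open import Data.List.Membership.Propositional.Properties using (∈-map⁺)
open import Data.Product using (_,_)
open import Function.Bundles using (mk⇔)
open import Relation.Binary.PropositionalEquality using (refl)
open Endpoints using (pr)
open EdgeTypes using (module Edges)
open SwapOrder using (module Order)
open Triangulation using (module Geometry)
open Conditions using (base; base-mono; module TypeConditions)
open Necessity using (module Converse)

theorem3p2 : (n : ℕ) → 5 ≤ n → (Δ : SimplicialComplex n) →
    IsPermissible Δ → IsUniformFlag Δ →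
    RepresentsTriangulation Δ ⇔ ExactlyOne3 (Condition1 Δ) (Condition2 Δ) (Condition3 Δ)
-- Five successors make the node set `Fin (6 + m)`, where 0, ..., 5 are available as literals.
theorem3p2 (suc (suc (suc (suc (suc m))))) (s≤s (s≤s (s≤s (s≤s (s≤s _))))) Δ perm uf =
  mk⇔ (λ rep → valid⇒conditions B refl (represents⇒valid B refl rep))
      (λ conditions → Geometry.triangulation Δ (Order.swapSystem _ B (conditions⇒valid conditions))
        face⇒alternating face⇒ok
        (λ alt clique → clique⇒face alt (λ a∈ b∈ → clique (∈-map⁺ pr a∈) (∈-map⁺ pr b∈))))
  where
  open Edges Δ perm uf (base {m}) (base-mono {m})
  open TypeConditions Δ perm uf
  open Converse Δ perm uf
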